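{- Let $m,n\in\mathbb{Z}$ with $\sqrt{m+ni}\notin\mathbb{Q}(i)$, where $\sqrt{m+ni}$ is a complex square root of $m+ni$. Let $\alpha=\sqrt{m+ni}-\lfloor\sqrt{m+ni}\rfloor_H$. Then the sequence $(\alpha^H_{(n)})$ produced from $\alpha$ by J. Hurwitz's algorithm is purely periodic.
   Context: Let $X=\{u(1+i)+v(1-i): -1/2\le u,v<1/2\}$, $\overline X$ its closure, $X^o$ its interior. For $0\le k<4$ set $L(i^k(1+i))=i^k(1+i)\mathbb{Z}_{>0}$, $L(i^k2)=\{i^k(m(1+i)+l(1-i)): m,l\in\mathbb{Z}_{>0}\}$. For $w\in(1+i)\mathbb{Z}[i]$: $Q_0=\overline X$; if $w\in L(i^k(1+i))$, $Q_w=(X^o+w)\cup\{ui^k(1+i)-\tfrac12 i^k(1-i)+w: -\tfrac12<u\le\tfrac12\}\cup\{\tfrac12 i^k(1+i)+ui^k(1-i)+w: -\tfrac12\le u\le\tfrac12\}\cup\{ui^k(1+i)+\tfrac12 i^k(1-i)+w: -\tfrac12<u\le\tfrac12\}$; if $w\in L(i^k2)$, $Q_w=(X^o+w)\cup\{ui^k(1+i)+\tfrac12 i^k(1-i)+w: -\tfrac12<u\le\tfrac12\}\cup\{\tfrac12 i^k(1+i)+ui^k(1-i)+w: -\tfrac12<u\le\tfrac12\}$. These partition $\mathbb{C}$; for $z\notin\mathbb{Z}[i]$, $\lfloor z\rfloor_H$ is the unique $w$ with $z\in Q_w$, and $\lfloor z\rfloor_H=z$ for $z\in\mathbb{Z}[i]$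 (so here $\alpha\in\overline X$). $T_H(z)=1/z-\lfloor1/z\rfloor_H$ for $z\ne0$, $T_H(0)=0$. J. Hurwitz's algorithm: $\alpha^H_{(1)}=\alpha$; if $\alpha^H_{(n)}\ne0$ then $\alpha^H_{(n+1)}=T_H(\alpha^H_{(n)})$; if $\alpha^H_{(n)}=0$ the sequence terminates. Purely periodic means the sequence is infinite and there is $l\ge1$ with $\alpha^H_{(n+l)}=\alpha^H_{(n)}$ for all $n\ge1$. -}

module Defs where

open import Data.Bool using (Bool; true; false)
open import Data.Nat using (ℕ; suc)
open import Data.Fin using (Fin)
import Data.Fin as F
open import Data.Integer as ℤ using (ℤ; +_; -[1+_])
open import Data.Rational using (ℚ; _+_; _*_; -_; _-_; _<_; _≤_; _/_; 0ℚ; 1ℚ; ½)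
open import Data.Product using (Σ; _×_; _,_; ∃)
open import Data.Sum using (_⊎_)
open import Relation.Nullary using (¬_)
open import Relation.Binary.PropositionalEquality using (_≡_; _≢_)

ι : ℤ → ℚ
ι z = z / 1

GI : Set
GI = ℤ × ℤ

GQ : Set
GQ = ℚ × ℚ

ιG : GI → GQ
ιG (x , y) = (ι x , ι y)

_*GI_ : GI → GI → GI
(x , y) *GI (x' , y') = (x ℤ.* x' ℤ.- y ℤ.* y' , x ℤ.* y' ℤ.+ y ℤ.* x')

_+GI_ : GI → GI → GI
(x , y) +GI (x' , y') = (x ℤ.+ x' , y ℤ.+ y')

0GI : GI
0GI = (+ 0 , + 0)

ipow : Fin 4 → GI
ipow F.zero = (+ 1 , + 0)
ipow (F.suc F.zero) = (+ 0 , + 1)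
ipow (F.suc (F.suc F.zero)) = (-[1+ 0 ] , + 0)
ipow (F.suc (F.suc (F.suc F.zero))) = (+ 0 , -[1+ 0 ])

conjGI : GI → GI
conjGI (x , y) = (x , ℤ.- y)

e₁ e₂ : GI
e₁ = (+ 1 , + 1)
e₂ = (+ 1 , -[1+ 0 ])

ℕ⁺ : ℕ → GI
ℕ⁺ c = (+ suc c , + 0)

_+G_ _-G_ _*G_ : GQ → GQ → GQ
(x , y) +G (x' , y') = (x + x' , y + y')
(x , y) -G (x' , y') = (x - x' , y - y')
(x , y) *G (x' , y') = (x * x' - y * y' , x * y' + y * x')

0G 1G : GQ
0G = (0ℚ , 0ℚ)
1G = (1ℚ , 0ℚ)

DG : ℤ → ℤ → GQ
DG m n = (ι m , ι n)

HasSqrtInQi : ℤ → ℤ → Set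
HasSqrtInQi m n = Σ GQ λ r → r *G r ≡ DG m n

-- The field ℚ(i)(√D), D = m + n i, elements written a + b √D with
-- a, b ∈ ℚ(i) and represented as pairs (a , b).  When √D ∉ ℚ(i) this
-- representation is unique, so ≡ on pairs is equality of complex numbers.

K : Set
K = GQ × GQ

_+K_ _-K_ : K → K → K
(a , b) +K (c , d) = (a +G c , b +G d)
(a , b) -K (c , d) = (a -G c , b -G d)

mulK : ℤ → ℤ → K → K → K
mulK m n (a , b) (c , d) = ((a *G c) +G ((b *G d) *G DG m n) , (a *G d) +G (b *G c))

0K 1K : K
0K = (0G , 0G)
1K = (1G , 0G)

embedGI : GI → K
embedGI g = (ιG g , 0G)

sqrtK : K
sqrtK = (0G , 1G)

-- Real numbers of the form c₀ + c₁ p + c₂ q, where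
--   R = √(m² + n²) ≥ 0,  p = √((R + m)/2) ≥ 0,  q = √((R - m)/2) ≥ 0,
-- so that the two complex square roots of m + n i are ±(p + ε q i),
-- ε = 1 if n ≥ 0 and ε = -1 if n < 0.
-- p and q are given by their Dedekind cuts (rational conditions).

Lin : Set
Lin = ℚ × ℚ × ℚ

signℚ : ℤ → ℚ
signℚ (+ _) = 1ℚ
signℚ -[1+ _ ] = - 1ℚ

two : ℚ
two = ι (+ 2)

module Reals (m n : ℤ) where
  M N S : ℚ
  M = ι m
  N = ι n
  S = M * M + N * N

  PLower : ℚ → Set
  PLower a = a < 0ℚ ⊎ ((two * (a * a) - M) < 0ℚ ⊎ (two * (a * a) - M) * (two * (a * a) - M) < S)
  PUpper : ℚ → Set
  PUpper a = 0ℚ < a × 0ℚ < two * (a * a) - M × S < (two * (a * a) - M) * (two * (a * a) - M)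
  QLower : ℚ → Set
  QLower b = b < 0ℚ ⊎ ((two * (b * b) + M) < 0ℚ ⊎ (two * (b * b) + M) * (two * (b * b) + M) < S)
  QUpper : ℚ → Set
  QUpper b = 0ℚ < b × 0ℚ < two * (b * b) + M × S < (two * (b * b) + M) * (two * (b * b) + M)

  val : Lin → ℚ → ℚ → ℚ
  val (c₀ , c₁ , c₂) x y = c₀ + c₁ * x + c₂ * y

  -- c₀ + c₁ p + c₂ q > 0 : witnessed by a rational box around (p , q)
  -- on all of whose corners the linear function is positive
  Pos : Lin → Set
  Pos e = Σ ℚ λ a → Σ ℚ λ a' → Σ ℚ λ b → Σ ℚ λ b' →
    PLower a × PUpper a' × QLower b × QUpper b' ×
    0ℚ < val e a b × 0ℚ < val e a b' × 0ℚ < val e a' b × 0ℚ < val e a' b'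

  _-L_ : Lin → Lin → Lin
  (c₀ , c₁ , c₂) -L (d₀ , d₁ , d₂) = (c₀ - d₀ , c₁ - d₁ , c₂ - d₂)

  _<L_ _≤L_ _≈L_ : Lin → Lin → Set
  e <L f = Pos (f -L e)
  e ≤L f = ¬ Pos (e -L f)
  e ≈L f = e ≤L f × f ≤L e

  constL : ℚ → Lin
  constL c = (c , 0ℚ , 0ℚ)

  halfL m½L : Lin
  halfL = constL ½
  m½L = constL (- ½)

  CL : Set
  CL = Lin × Lin

  scaleL : ℚ → Lin → Lin
  scaleL c (c₀ , c₁ , c₂) = (c * c₀ , c * c₁ , c * c₂)

  _+L_ : Lin → Lin → Lin
  (c₀ , c₁ , c₂) +L (d₀ , d₁ , d₂) = (c₀ + d₀ , c₁ + d₁ , c₂ + d₂)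

  mulGI : GI → CL → CL
  mulGI (g , h) (x , y) =
    (scaleL (ι g) x -L scaleL (ι h) y , scaleL (ι g) y +L scaleL (ι h) x)

  subGI : CL → GI → CL
  subGI (x , y) (g , h) = (x -L constL (ι g) , y -L constL (ι h))

  -- coordinates (u , v) with z = u(1+i) + v(1-i), i.e. u = (x+y)/2, v = (x-y)/2
  coords : CL → Lin × Lin
  coords (x , y) = (scaleL ½ (x +L y) , scaleL ½ (x -L y))

  -- coordinates (u , v) with z = u i^k (1+i) + v i^k (1-i)
  coordsRot : Fin 4 → CL → Lin × Lin
  coordsRot k z = coords (mulGI (conjGI (ipow k)) z)

  ε : ℚ
  ε = signℚ n

  sgn : Bool → ℚ
  sgn true = 1ℚ
  sgn false = - 1ℚ

  -- the chosen complex square root √(m+ni) = σ (p + ε q i)  (σ = ±1);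
  -- the complex number a + b √D, a = a₁ + a₂ i, b = b₁ + b₂ i
  toCL : Bool → K → CL
  toCL σ ((a₁ , a₂) , (b₁ , b₂)) =
    ( (a₁ , b₁ * sgn σ , - (b₂ * sgn σ * ε))
    , (a₂ , b₂ * sgn σ , b₁ * sgn σ * ε) )

  -- X^o (rotation invariant)
  InXo : Lin × Lin → Set
  InXo (u , v) = m½L <L u × u <L halfL × m½L <L v × v <L halfL

  InXbar : Lin × Lin → Set
  InXbar (u , v) = m½L ≤L u × u ≤L halfL × m½L ≤L v × v ≤L halfL

  InLA : Fin 4 → GI → Set
  InLA k w = Σ ℕ λ c → w ≡ ipow k *GI (e₁ *GI ℕ⁺ c)

  InLB : Fin 4 → GI → Set
  InLB k w = Σ ℕ λ c → Σ ℕ λ l → w ≡ ipow k *GI ((ℕ⁺ c *GI e₁) +GI (ℕ⁺ l *GI e₂))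

  -- membership of z - w in Q_w - w, in coordinates w.r.t. i^k(1+i), i^k(1-i)
  ShapeA : Lin × Lin → Set
  ShapeA (u , v) =
    InXo (u , v)
    ⊎ (m½L <L u × u ≤L halfL × v ≈L m½L)
    ⊎ (u ≈L halfL × m½L ≤L v × v ≤L halfL)
    ⊎ (m½L <L u × u ≤L halfL × v ≈L halfL)

  ShapeB : Lin × Lin → Set
  ShapeB (u , v) =
    InXo (u , v)
    ⊎ (m½L <L u × u ≤L halfL × v ≈L halfL)
    ⊎ (u ≈L halfL × m½L <L v × v ≤L halfL)

  InQ : CL → GI → Set
  InQ z w =
    (w ≡ 0GI × InXbar (coords z))
    ⊎ (Σ (Fin 4) λ k → InLA k w × ShapeA (coordsRot k (subGI z w)))
    ⊎ (Σ (Fin 4) λ k → InLB k w × ShapeB (coordsRot k (subGI z w)))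

  InZi : K → Set
  InZi z = Σ GI λ g → z ≡ embedGI g

  FloorH : Bool → K → GI → Set
  FloorH σ z w = z ≡ embedGI w ⊎ (¬ InZi z × InQ (toCL σ z) w)

  HStep : Bool → K → K → Set
  HStep σ x x' = x ≢ 0K × Σ K λ y → Σ GI λ w →
    mulK m n x y ≡ 1K × FloorH σ y w × x' ≡ y -K embedGI w

  -- the sequence α_(1), α_(2), … (indexed from 0 here) is infinite and
  -- purely periodic
  PurelyPeriodic : Bool → K → Set
  PurelyPeriodic σ α = Σ (ℕ → K) λ s →
    s 0 ≡ α × (∀ k → HStep σ (s k) (s (suc k))) ×
    Σ ℕ λ l → 1 Data.Nat.≤ l × (∀ k → s (k Data.Nat.+ l) ≡ s k)

-- Every number in the expansion is x = (β + √D) / a with Gaussian integers a, β, c such that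
-- β² + a c = D. Let Y = (√D − β) / a, minus the conjugate of x. The map x ↦ 1/x − w, Y ↦ 1/Y + w
-- preserves the set of pairs with |Re x| + |Im x| ≤ 1 and |Y| > 1 for which Y avoids a certain disc
-- whenever x lies in the corresponding one of the four discs around (±1 ± i)/2; it contains the
-- starting pair √D − w₀, √D + w₀. On this set the pair determines its predecessor: two values of
-- 1/Y differ by a nonzero multiple of 1 + i of modulus at most 2, and the discs exclude this.
-- Moreover a is bounded: x and −Y can only be close to each other near ±1 or ±i, where the
-- quadratic polynomial with roots x and −Y takes nonzero Gaussian integer values. So the orbit is
-- finite, and by injectivity it is purely periodic.
--
-- Signs of the real numbers involved are decided in the ordered algebra obtained from ℚ by
-- adjoining √(m² + n²), √((r + m)/2) and √((r − m)/2), where r = √(m² + n²).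
module Submission where

open import Defs
open import Data.Bool using (Bool; true; false)
open import Data.Integer using (ℤ)
open import Relation.Nullary using (¬_)

open import Algebra.Bundles using (CommutativeRing)
import Algebra.Solver.Ring as RingSolver
open import Algebra.Solver.Ring.AlmostCommutativeRing using (_-Raw-AlmostCommutative⟶_; fromCommutativeRing)
import Data.Bool as Bool
open import Data.Empty using (⊥; ⊥-elim)
open import Data.Fin as Fin using (Fin)
open import Data.Fin.Patterns using (0F; 1F; 2F; 3F)
import Data.Fin.Properties as FP
open import Data.Integer as ℤ using (+_; -[1+_])
import Data.Integer.Properties as ℤP
import Data.Integer.Solver as ℤS
open import Data.Maybe as Maybe using (Maybe; just; is-just)
open import Data.Nat as ℕ using (ℕ; zero; suc)
import Data.Nat.Properties as ℕP
open import Data.Product using (Σ; ∃; _×_; _,_; proj₁; proj₂)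
open import Data.Rational as ℚ using (ℚ; 0ℚ; 1ℚ; ½)
import Data.Rational.Properties as ℚP
import Data.Rational.Unnormalised as ℚᵘ
import Data.Rational.Unnormalised.Properties as ℚᵘP
open import Data.Sum using (_⊎_; inj₁; inj₂; [_,_]′)
import Data.Vec as Vec
open import Data.Vec.N-ary using (N-ary; Eq; curryⁿ; curryⁿ-cong; _$ⁿ_)
open import Level using (0ℓ)
open import Relation.Binary.PropositionalEquality as ≡ using (_≡_; _≢_)
open import Relation.Nullary using (Dec; yes; no)
open import Relation.Nullary.Decidable using (dec⇒maybe)

-- In the coordinates s = Re + Im, t = Re - Im the square is |s|, |t| ≤ 1, the lattice (1 + i)ℤ[i]
-- is (2ℤ)², and the boundary rules of the sets Q_w say that each coordinate is rounded with halves
-- going towards zero. So a positive coordinate of w forces the matching coordinate of 1/x to exceed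
-- 1 strictly, and inversion turns that open half-plane into one of the four discs. For x in the
-- disc about ω/2 the number Y avoids the open unit disc about -ω; as |ω|² = 2, that circle is
-- orthogonal to the unit circle, so inversion merely conjugates it and the condition passes from Y
-- to 1/Y. The estimates alone give |x| ≤ 1 ≤ |Y|. Strictness is arithmetic: |x| = 1 occurs only at
-- the corners ±1, ±i, and |Y| = 1 would make √D Gaussian rational or force |x| = 1. The corners are
-- also why |x| < 1 < |Y| by itself does not bound a. Rounding and case distinctions need a
-- decidable order. It is built on formal pairs, whether or not a radicand is already a square, so
-- zero divisors may occur until the final quotient.

toℚᵘ-ι : ∀ z → ℚ.toℚᵘ (ι z) ℚᵘ.≃ ℚᵘ.mkℚᵘ z 0
toℚᵘ-ι z = ℚP.toℚᵘ-fromℚᵘ (ℚᵘ.mkℚᵘ z 0)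

ι-+ : ∀ a b → ι (a ℤ.+ b) ≡ ι a ℚ.+ ι b
ι-+ a b = ℚP.toℚᵘ-injective (ℚᵘP.≃-trans (toℚᵘ-ι (a ℤ.+ b)) (ℚᵘP.≃-trans
  (ℚᵘ.*≡* (≡.cong (ℤ._* + 1) (≡.sym (≡.cong₂ ℤ._+_ (ℤP.*-identityʳ a) (ℤP.*-identityʳ b)))))
  (ℚᵘP.≃-sym (ℚᵘP.≃-trans (ℚP.toℚᵘ-homo-+ (ι a) (ι b)) (ℚᵘP.+-cong (toℚᵘ-ι a) (toℚᵘ-ι b))))))

ι-* : ∀ a b → ι (a ℤ.* b) ≡ ι a ℚ.* ι b
ι-* a b = ℚP.toℚᵘ-injective (ℚᵘP.≃-trans (toℚᵘ-ι (a ℤ.* b))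
  (ℚᵘP.≃-sym (ℚᵘP.≃-trans (ℚP.toℚᵘ-homo-* (ι a) (ι b)) (ℚᵘP.*-cong (toℚᵘ-ι a) (toℚᵘ-ι b)))))

ι-mono-≤ : ∀ {a b} → a ℤ.≤ b → ι a ℚ.≤ ι b
ι-mono-≤ {a} {b} a≤b = ℚP.toℚᵘ-cancel-≤ (ℚᵘP.≤-respˡ-≃ (ℚᵘP.≃-sym (toℚᵘ-ι a))
  (ℚᵘP.≤-respʳ-≃ (ℚᵘP.≃-sym (toℚᵘ-ι b))
    (ℚᵘ.*≤* (≡.subst₂ ℤ._≤_ (≡.sym (ℤP.*-identityʳ a)) (≡.sym (ℤP.*-identityʳ b)) a≤b))))

ι-cancel-≤ : ∀ {a b} → ι a ℚ.≤ ι b → a ℤ.≤ b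
ι-cancel-≤ {a} {b} p with ℚᵘP.≤-respˡ-≃ (toℚᵘ-ι a) (ℚᵘP.≤-respʳ-≃ (toℚᵘ-ι b) (ℚP.toℚᵘ-mono-≤ p))
... | ℚᵘ.*≤* q = ≡.subst₂ ℤ._≤_ (ℤP.*-identityʳ a) (ℤP.*-identityʳ b) q

ι-injective : ∀ {a b} → ι a ≡ ι b → a ≡ b
ι-injective e = ℤP.≤-antisym (ι-cancel-≤ (ℚP.≤-reflexive e)) (ι-cancel-≤ (ℚP.≤-reflexive (≡.sym e)))

-- Algebras over ℚ, their ring solver, and ordered algebras

-- All number systems below are instances, so one solver serves ℚ, the real tower and the complex
-- numbers over either. Equality is a setoid relation because the final model identifies x and y
-- when x - y is both ≥ 0 and ≤ 0.
record ℚAlgebra : Set₁ where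
  field
    commutativeRing : CommutativeRing 0ℓ 0ℓ
  open CommutativeRing commutativeRing public using
    ( Carrier; _≈_; _+_; _*_; -_; _-_; 0#; 1#; setoid; refl; sym; trans; reflexive
    ; +-cong; +-congˡ; +-congʳ; *-cong; *-congˡ; *-congʳ; -‿cong; +-assoc; +-comm; *-assoc; *-comm
    ; +-identityˡ; +-identityʳ; *-identityˡ; *-identityʳ; -‿inverseˡ; -‿inverseʳ; zeroˡ; zeroʳ; distribˡ; distribʳ )
  field
    φ   : ℚ → Carrier
    φ-+ : ∀ a b → φ (a ℚ.+ b) ≈ φ a + φ b
    φ-* : ∀ a b → φ (a ℚ.* b) ≈ φ a * φ b
    φ-1 : φ 1ℚ ≈ 1#

  open import Algebra.Properties.Ring (CommutativeRing.ring commutativeRing)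
    using (x+x≈x⇒x≈0; -0#≈0#; +-inverseʳ-unique) public
  open import Relation.Binary.Reasoning.Setoid setoid

  φ-0 : φ 0ℚ ≈ 0#
  φ-0 = x+x≈x⇒x≈0 (φ 0ℚ) (sym (φ-+ 0ℚ 0ℚ))

  φ-neg : ∀ a → φ (ℚ.- a) ≈ - φ a
  φ-neg a = +-inverseʳ-unique (φ a) (φ (ℚ.- a)) (begin
    φ a + φ (ℚ.- a) ≈⟨ φ-+ a (ℚ.- a) ⟨
    φ (a ℚ.- a)     ≡⟨ ≡.cong φ (ℚP.+-inverseʳ a) ⟩
    φ 0ℚ            ≈⟨ φ-0 ⟩
    0# ∎)

  φ-- : ∀ a b → φ (a ℚ.- b) ≈ φ a - φ b
  φ-- a b = trans (φ-+ a (ℚ.- b)) (+-congˡ (φ-neg b))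

  -- κ is abstract because conversion checking would otherwise unfold the gcd hidden in ι.
  abstract
    κ : ℤ → Carrier
    κ z = φ (ι z)

    κ≈φι : ∀ z → κ z ≈ φ (ι z)
    κ≈φι z = refl

  κ-+ : ∀ a b → κ (a ℤ.+ b) ≈ κ a + κ b
  κ-+ a b = trans (κ≈φι _) (trans (trans (reflexive (≡.cong φ (ι-+ a b))) (φ-+ _ _)) (sym (+-cong (κ≈φι a) (κ≈φι b))))

  κ-* : ∀ a b → κ (a ℤ.* b) ≈ κ a * κ b
  κ-* a b = trans (κ≈φι _) (trans (trans (reflexive (≡.cong φ (ι-* a b))) (φ-* _ _)) (sym (*-cong (κ≈φι a) (κ≈φι b))))

  κ-pos-* : ∀ m n → κ (+ (m ℕ.* n)) ≈ κ (+ m) * κ (+ n)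
  κ-pos-* m n = trans (reflexive (≡.cong κ (ℤP.pos-* m n))) (κ-* (+ m) (+ n))

  κ-0 : κ (+ 0) ≈ 0#
  κ-0 = trans (κ≈φι (+ 0)) φ-0

  κ-1 : κ (+ 1) ≈ 1#
  κ-1 = trans (κ≈φι (+ 1)) φ-1

  κ-neg : ∀ a → κ (ℤ.- a) ≈ - κ a
  κ-neg a = +-inverseʳ-unique (κ a) (κ (ℤ.- a)) (begin
    κ a + κ (ℤ.- a) ≈⟨ κ-+ a (ℤ.- a) ⟨
    κ (a ℤ.- a)     ≡⟨ ≡.cong κ (ℤP.+-inverseʳ a) ⟩
    κ (+ 0)         ≈⟨ κ-0 ⟩
    0# ∎)

  κ-- : ∀ a b → κ (a ℤ.- b) ≈ κ a - κ b
  κ-- a b = trans (κ-+ a (ℤ.- b)) (+-congˡ (κ-neg b))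

  κ-morphism : ℤ.+-*-rawRing -Raw-AlmostCommutative⟶ fromCommutativeRing commutativeRing
  κ-morphism = record
    { ⟦_⟧ = κ ; +-homo = κ-+ ; *-homo = κ-* ; -‿homo = κ-neg ; 0-homo = κ-0 ; 1-homo = κ-1 }

  private
    module Solver = RingSolver ℤ.+-*-rawRing (fromCommutativeRing commutativeRing) κ-morphism
      (λ a b → Maybe.map (λ e → reflexive (≡.cong κ e)) (dec⇒maybe (a ℤP.≟ b)))
  open Solver public using (Polynomial; con; _:+_; _:*_; :-_; _:-_; _:=_)
  open Solver using (⟦_⟧; var; _≈N_; normalise; _≟N_; ⟦_⟧N-cong; prove)

  private
    closed : ∀ n → N-ary n (Polynomial n) (Polynomial n × Polynomial n) → Polynomial n × Polynomial n
    closed n f = f $ⁿ Vec.map var (Vec.allFin n)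

    prove-normal : ∀ {n} (e e′ : Polynomial n) (d : Maybe (normalise e ≈N normalise e′)) → Bool.T (is-just d) → ∀ ρ →
        ⟦ e ⟧ ρ ≈ ⟦ e′ ⟧ ρ
    prove-normal e e′ (just h) _ ρ = prove ρ e e′ (⟦ h ⟧N-cong ρ)

  -- Comparing normal forms syntactically keeps all the work in closed terms.
  solve : ∀ n (f : N-ary n (Polynomial n) (Polynomial n × Polynomial n)) (let e = closed n f) →
          {Bool.T (is-just (normalise (proj₁ e) ≟N normalise (proj₂ e)))} →
          Eq n _≈_ (curryⁿ ⟦ proj₁ e ⟧) (curryⁿ ⟦ proj₂ e ⟧)
  solve n f {p} = curryⁿ-cong _≈_ ⟦ proj₁ e ⟧ ⟦ proj₂ e ⟧ (prove-normal (proj₁ e) (proj₂ e) _ p)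
    where
    e : Polynomial n × Polynomial n
    e = closed n f

-- NN x means x ≥ 0 and PP x means x > 0; x ≥ 0 and x ≤ 0 need not imply x ≈ 0.
record OrderedℚAlgebra : Set₁ where
  field
    algebra : ℚAlgebra
  open ℚAlgebra algebra public

  field
    NN : Carrier → Set

  PP : Carrier → Set
  PP x = ¬ NN (- x)

  field
    NN-resp  : ∀ {x y} → x ≈ y → NN x → NN y
    NN-+     : ∀ {x y} → NN x → NN y → NN (x + y)
    NN-*     : ∀ {x y} → NN x → NN y → NN (x * y)
    NN?      : ∀ x → Dec (NN x)
    NN-total : ∀ x → NN x ⊎ NN (- x)
    PP-*     : ∀ {x y} → PP x → PP y → PP (x * y)
    PP-1     : PP 1#
    φ-NN     : ∀ {q} → 0ℚ ℚ.≤ q → NN (φ q)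
    arch     : ∀ x y → PP x → ∃ λ n → NN (κ (+ n) * x - y)

  PP-resp : ∀ {x y} → x ≈ y → PP x → PP y
  PP-resp e p n = p (NN-resp (-‿cong (sym e)) n)

  PP⇒NN : ∀ {x} → PP x → NN x
  PP⇒NN {x} p with NN-total x
  ... | inj₁ n = n
  ... | inj₂ n = ⊥-elim (p n)

  NN⊎PP : ∀ x → NN x ⊎ PP (- x)
  NN⊎PP x with NN? x
  ... | yes n = inj₁ n
  ... | no ¬n = inj₂ (λ n → ¬n (NN-resp (solve 1 (λ a → :- (:- a) := a) x) n))

  PP-+ˡ : ∀ {x y} → PP x → NN y → PP (x + y)
  PP-+ˡ {x} {y} p n m = p (NN-resp (solve 2 (λ a b → :- (a :+ b) :+ b := :- a) x y) (NN-+ m n))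

  PP-+ʳ : ∀ {x y} → NN x → PP y → PP (x + y)
  PP-+ʳ {x} {y} n p = PP-resp (+-comm y x) (PP-+ˡ p n)

  NN-κ : ∀ n → NN (κ (+ n))
  NN-κ n = NN-resp (sym (κ≈φι (+ n))) (φ-NN (ι-mono-≤ {+ 0} {+ n} (ℤ.+≤+ ℕ.z≤n)))

  NN-0 : NN 0#
  NN-0 = NN-resp κ-0 (NN-κ 0)

  PP-κ : ∀ n → PP (κ (+ suc n))
  PP-κ n = PP-resp (trans (+-congʳ (sym κ-1)) (sym (κ-+ (+ 1) (+ n)))) (PP-+ˡ PP-1 (NN-κ n))

  NN-sq : ∀ x → NN (x * x)
  NN-sq x with NN-total x
  ... | inj₁ n = NN-* n n
  ... | inj₂ n = NN-resp (solve 1 (λ a → (:- a) :* (:- a) := a :* a) x) (NN-* n n)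

  PP⇒¬NN- : ∀ {x y} → x ≈ - y → PP x → ¬ NN y
  PP⇒¬NN- {x} {y} e p n = p (NN-resp (trans (solve 1 (λ a → a := :- (:- a)) y) (-‿cong (sym e))) n)

  NN-cancel : ∀ {x y} → PP x → NN (x * y) → NN y
  NN-cancel {x} {y} p n with NN⊎PP y
  ... | inj₁ m = m
  ... | inj₂ q = ⊥-elim (PP⇒¬NN- (solve 2 (λ a b → a :* (:- b) := :- (a :* b)) x y) (PP-* p q) n)

  PP-cancel : ∀ {x y} → NN x → PP (x * y) → PP y
  PP-cancel {x} {y} n p m = p (NN-resp (solve 2 (λ a b → a :* (:- b) := :- (a :* b)) x y) (NN-* n m))

  -- If x > y then x + y = (x - y) + 2y > 0, so x² - y² would be positive. This is the form in which
  -- square roots of inequalities are taken.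
  sq-cancel-NN : ∀ {x y} → NN y → NN (y * y - x * x) → NN (y - x)
  sq-cancel-NN {x} {y} ny n with NN⊎PP (y - x)
  ... | inj₁ m = m
  ... | inj₂ p = ⊥-elim (PP⇒¬NN-
    (solve 2 (λ a b → (:- (b :- a)) :* ((:- (b :- a)) :+ (b :+ b)) := :- (b :* b :- a :* a)) x y)
    (PP-* p (PP-+ˡ p (NN-+ ny ny))) n)

-- The algebra of formal pairs a + b √d

-- The element d is arbitrary: d = -1 gives ℚ(i) and the complex numbers, d ≥ 0 gives a step of the
-- real tower.
module Quadratic (A : ℚAlgebra) (d : ℚAlgebra.Carrier A) where
  open ℚAlgebra A

  infix 4 _≋_
  _≋_ : Carrier × Carrier → Carrier × Carrier → Set
  (a , b) ≋ (a' , b') = a ≈ a' × b ≈ b'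

  _⊕_ _⊗_ : Carrier × Carrier → Carrier × Carrier → Carrier × Carrier
  (a , b) ⊕ (a' , b') = (a + a' , b + b')
  (a , b) ⊗ (a' , b') = (a * a' + d * (b * b') , a * b' + b * a')

  ⊝_ : Carrier × Carrier → Carrier × Carrier
  ⊝ (a , b) = (- a , - b)

  quadratic : ℚAlgebra
  quadratic = record
    { commutativeRing = record
      { Carrier = Carrier × Carrier ; _≈_ = _≋_ ; _+_ = _⊕_ ; _*_ = _⊗_ ; -_ = ⊝_
      ; 0# = (0# , 0#) ; 1# = (1# , 0#)
      ; isCommutativeRing = record
        { isRing = record
          { +-isAbelianGroup = record
            { isGroup = record
              { isMonoid = record
                { isSemigroup = record
                  { isMagma = record
                    { isEquivalence = record
                      { refl = refl , refl
                      ; sym = λ (p , q) → sym p , sym q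
                      ; trans = λ (p , q) (r , s) → trans p r , trans q s }
                    ; ∙-cong = λ (p , q) (r , s) → +-cong p r , +-cong q s }
                  ; assoc = λ (a , b) (c , e) (f , g) → +-assoc a c f , +-assoc b e g }
                ; identity = (λ (a , b) → +-identityˡ a , +-identityˡ b)
                           , (λ (a , b) → +-identityʳ a , +-identityʳ b) }
              ; inverse = (λ (a , b) → -‿inverseˡ a , -‿inverseˡ b)
                        , (λ (a , b) → -‿inverseʳ a , -‿inverseʳ b)
              ; ⁻¹-cong = λ (p , q) → -‿cong p , -‿cong q }
            ; comm = λ (a , b) (c , e) → +-comm a c , +-comm b e }
          ; *-cong = λ (p , q) (r , s) →
              +-cong (*-cong p r) (*-congˡ (*-cong q s)) , +-cong (*-cong p s) (*-cong q r)
          ; *-assoc = λ (a , b) (c , e) (f , g) →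
              solve 7 (λ a b c e f g d →
                (a :* c :+ d :* (b :* e)) :* f :+ d :* ((a :* e :+ b :* c) :* g)
                := a :* (c :* f :+ d :* (e :* g)) :+ d :* (b :* (c :* g :+ e :* f))) a b c e f g d
            , solve 7 (λ a b c e f g d →
                (a :* c :+ d :* (b :* e)) :* g :+ (a :* e :+ b :* c) :* f
                := a :* (c :* g :+ e :* f) :+ b :* (c :* f :+ d :* (e :* g))) a b c e f g d
          ; *-identity = (λ x → ⊗-identityˡ x)
                       , (λ x → ≋-trans (⊗-comm x (1# , 0#)) (⊗-identityˡ x))
          ; distrib = (λ x y z → ⊗-distribˡ x y z)
                    , (λ x y z → ≋-trans (⊗-comm (y ⊕ z) x) (≋-trans (⊗-distribˡ x y z)
                        (⊕-cong (⊗-comm x y) (⊗-comm x z))))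
          }
        ; *-comm = ⊗-comm } }
    ; φ = λ q → φ q , 0#
    ; φ-+ = λ a b → φ-+ a b , sym (+-identityˡ 0#)
    ; φ-* = λ a b →
        trans (φ-* a b) (trans (sym (+-identityʳ _)) (+-congˡ (sym
          (trans (*-congˡ (zeroˡ 0#)) (zeroʳ d)))))
      , sym (trans (+-cong (zeroʳ _) (zeroˡ _)) (+-identityˡ 0#))
    ; φ-1 = φ-1 , refl
    }
    where
    ≋-trans : ∀ {x y z} → x ≋ y → y ≋ z → x ≋ z
    ≋-trans (p , q) (r , s) = trans p r , trans q s
    ⊕-cong : ∀ {x y u v} → x ≋ y → u ≋ v → (x ⊕ u) ≋ (y ⊕ v)
    ⊕-cong (p , q) (r , s) = +-cong p r , +-cong q s
    ⊗-comm : ∀ x y → (x ⊗ y) ≋ (y ⊗ x)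
    ⊗-comm (a , b) (c , e) =
        solve 5 (λ a b c e d → a :* c :+ d :* (b :* e) := c :* a :+ d :* (e :* b)) a b c e d
      , solve 4 (λ a b c e → a :* e :+ b :* c := c :* b :+ e :* a) a b c e
    ⊗-identityˡ : ∀ x → ((1# , 0#) ⊗ x) ≋ x
    ⊗-identityˡ (a , b) =
        trans (+-cong (*-identityˡ a) (trans (*-congˡ (zeroˡ b)) (zeroʳ d))) (+-identityʳ a)
      , trans (+-cong (*-identityˡ b) (zeroˡ a)) (+-identityʳ b)
    ⊗-distribˡ : ∀ x y z → (x ⊗ (y ⊕ z)) ≋ ((x ⊗ y) ⊕ (x ⊗ z))
    ⊗-distribˡ (a , b) (c , e) (f , g) =
        solve 7 (λ a b c e f g d → a :* (c :+ f) :+ d :* (b :* (e :+ g))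
          := a :* c :+ d :* (b :* e) :+ (a :* f :+ d :* (b :* g))) a b c e f g d
      , solve 6 (λ a b c e f g → a :* (e :+ g) :+ b :* (c :+ f)
          := a :* e :+ b :* c :+ (a :* g :+ b :* f)) a b c e f g

-- The order on a + b √d for d ≥ 0

module SquareRoot (F : OrderedℚAlgebra) (d : OrderedℚAlgebra.Carrier F)
                  (d≥0 : OrderedℚAlgebra.NN F d) where
  open OrderedℚAlgebra F
  open Quadratic algebra d
  private module E = ℚAlgebra quadratic

  -- a + b √d ≥ 0, by the signs of a and b.
  data NonNeg (a b : Carrier) : Set where
    both   : NN a → NN b → NonNeg a b
    first  : NN a → NN (- b) → NN (a * a - d * (b * b)) → NonNeg a b
    second : NN (- a) → NN b → NN (d * (b * b) - a * a) → NonNeg a b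

  NN' : E.Carrier → Set
  NN' (a , b) = NonNeg a b

  resp : ∀ {a b a' b'} → a ≈ a' → b ≈ b' → NonNeg a b → NonNeg a' b'
  resp p q (both m n) = both (NN-resp p m) (NN-resp q n)
  resp p q (first m n o) = first (NN-resp p m) (NN-resp (-‿cong q) n)
    (NN-resp (+-cong (*-cong p p) (-‿cong (*-congˡ (*-cong q q)))) o)
  resp p q (second m n o) = second (NN-resp (-‿cong p) m) (NN-resp q n)
    (NN-resp (+-cong (*-congˡ (*-cong q q)) (-‿cong (*-cong p p))) o)

  private
    neg² : ∀ {x} → NN x → NN (- (- x))
    neg² {x} = NN-resp (solve 1 (λ a → a := :- (:- a)) x)
    neg-+ : ∀ {x y} → NN (- x) → NN (- y) → NN (- (x + y))
    neg-+ {x} {y} m n = NN-resp (solve 2 (λ a b → :- a :+ :- b := :- (a :+ b)) x y) (NN-+ m n)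
    swap- : ∀ {x y} → NN (- (x - y)) → NN (y - x)
    swap- {x} {y} = NN-resp (solve 2 (λ a b → :- (a :- b) := b :- a) x y)

  nonNeg? : ∀ a b → Dec (NonNeg a b)
  nonNeg? a b with NN⊎PP a | NN⊎PP b
  ... | inj₁ na | inj₁ nb = yes (both na nb)
  ... | inj₂ pa | inj₂ pb = no λ { (both m n) → pa (neg² m) ; (first m n _) → pa (neg² m) ; (second m n _) → pb
      (neg² n) }
  ... | inj₁ na | inj₂ pb with NN? (a * a - d * (b * b))
  ...   | yes n = yes (first na (PP⇒NN pb) n)
  ...   | no ¬n = no λ { (both m n) → pb (neg² n) ; (first _ _ n) → ¬n n ; (second _ n _) → pb (neg² n) }
  nonNeg? a b | inj₂ pa | inj₁ nb with NN? (d * (b * b) - a * a)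
  ...   | yes n = yes (second (PP⇒NN pa) nb n)
  ...   | no ¬n = no λ { (both m n) → pa (neg² m) ; (first m _ _) → pa (neg² m) ; (second _ _ n) → ¬n n }

  nonNeg-total : ∀ a b → NonNeg a b ⊎ NonNeg (- a) (- b)
  nonNeg-total a b with NN-total a | NN-total b | NN-total (a * a - d * (b * b))
  ... | inj₁ m | inj₁ n | _ = inj₁ (both m n)
  ... | inj₂ m | inj₂ n | _ = inj₂ (both m n)
  ... | inj₁ m | inj₂ n | inj₁ o = inj₁ (first m n o)
  ... | inj₁ m | inj₂ n | inj₂ o = inj₂ (second (neg² m) n
        (NN-resp (solve 3 (λ a b d → :- (a :* a :- d :* (b :* b)) := d :* ((:- b) :* (:- b)) :- (:- a) :* (:- a)) a b
          d) o))
  ... | inj₂ m | inj₁ n | inj₂ o = inj₁ (second m n (swap- o))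
  ... | inj₂ m | inj₁ n | inj₁ o = inj₂ (first m (neg² n)
        (NN-resp (solve 3 (λ a b d → a :* a :- d :* (b :* b) := (:- a) :* (:- a) :- d :* ((:- b) :* (:- b))) a b d) o))

  private
    -- The hypotheses say |x| ≤ y √d and |u| ≤ v √d. As √d is not in the base, the squares (x u)²
    -- and (d y v)² are compared and `sq-cancel-NN` removes the squares; `mix′` is the same with the
    -- inequalities reversed.
    mix : ∀ x y u v → NN y → NN v → NN (d * (y * y) - x * x) → NN (d * (v * v) - u * u) → NN (d * (y * v) - x * u)
    mix x y u v ny nv h k = sq-cancel-NN (NN-* d≥0 (NN-* ny nv)) (NN-resp
      (solve 5 (λ x y u v d → (d :* (y :* y) :- x :* x) :* (d :* (v :* v)) :+ (x :* x) :* (d :* (v :* v) :- u :* u)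
         := (d :* (y :* v)) :* (d :* (y :* v)) :- (x :* u) :* (x :* u)) x y u v d)
      (NN-+ (NN-* h (NN-* d≥0 (NN-sq v))) (NN-* (NN-sq x) k)))

    mix′ : ∀ x y u v → NN x → NN u → NN (x * x - d * (y * y)) → NN (u * u - d * (v * v)) → NN (x * u - d * (y * v))
    mix′ x y u v nx nu h k = sq-cancel-NN (NN-* nx nu) (NN-resp
      (solve 5 (λ x y u v d → (x :* x :- d :* (y :* y)) :* (u :* u) :+ (d :* (y :* y)) :* (u :* u :- d :* (v :* v))
         := (x :* u) :* (x :* u) :- (d :* (y :* v)) :* (d :* (y :* v))) x y u v d)
      (NN-+ (NN-* h (NN-sq u)) (NN-* (NN-* d≥0 (NN-sq y)) k)))

  -- Cancellation happens in both coordinates, so the signs of the summands do not decide the sign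
  -- of the sum. If the sum violated its norm condition, subtracting one summand from it would give
  -- the other a norm of the wrong sign.
  first+second : ∀ {a b a' b'} → NN a → NN (- b) → NN (a * a - d * (b * b)) →
                 NN (- a') → NN b' → NN (d * (b' * b') - a' * a') → NonNeg (a + a') (b + b')
  first+second {a} {b} {a'} {b'} na nb h na' nb' k with NN-total (a + a') | NN-total (b + b')
  ... | inj₁ m | inj₁ n = both m n
  ... | inj₁ m | inj₂ n = first m n res
    where
    res : NN ((a + a') * (a + a') - d * ((b + b') * (b + b')))
    res with NN⊎PP ((a + a') * (a + a') - d * ((b + b') * (b + b')))
    ... | inj₁ r = r
    ... | inj₂ p = ⊥-elim (PP⇒¬NN-
      (solve 5 (λ a b a' b' d →
        (:- ((a :+ a') :* (a :+ a') :- d :* ((b :+ b') :* (b :+ b')))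
          :+ con (+ 2) :* (d :* ((:- (b :+ b')) :* b') :- (a :+ a') :* (:- a')))
          :+ (d :* (b' :* b') :- a' :* a')
        := :- (a :* a :- d :* (b :* b))) a b a' b' d)
      (PP-+ˡ (PP-+ˡ p (NN-* (NN-κ 2) (mix (a + a') (- (b + b')) (- a') b' n nb'
         (NN-resp (solve 5 (λ a b a' b' d → :- ((a :+ a') :* (a :+ a') :- d :* ((b :+ b') :* (b :+ b')))
            := d :* ((:- (b :+ b')) :* (:- (b :+ b'))) :- (a :+ a') :* (a :+ a')) a b a' b' d) (PP⇒NN p))
         (NN-resp (solve 3 (λ a' b' d → d :* (b' :* b') :- a' :* a' := d :* (b' :* b') :- (:- a') :* (:- a')) a' b'
           d) k)))) k) h)
  ... | inj₂ m | inj₁ n = second m n res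
    where
    res : NN (d * ((b + b') * (b + b')) - (a + a') * (a + a'))
    res with NN⊎PP (d * ((b + b') * (b + b')) - (a + a') * (a + a'))
    ... | inj₁ r = r
    ... | inj₂ p = ⊥-elim (PP⇒¬NN-
      (solve 5 (λ a b a' b' d →
        (:- (d :* ((b :+ b') :* (b :+ b')) :- (a :+ a') :* (a :+ a'))
          :+ con (+ 2) :* ((:- (a :+ a')) :* a :- d :* ((b :+ b') :* (:- b))))
          :+ (a :* a :- d :* (b :* b))
        := :- (d :* (b' :* b') :- a' :* a')) a b a' b' d)
      (PP-+ˡ (PP-+ˡ p (NN-* (NN-κ 2) (mix′ (- (a + a')) (b + b') a (- b) m na
         (NN-resp (solve 5 (λ a b a' b' d → :- (d :* ((b :+ b') :* (b :+ b')) :- (a :+ a') :* (a :+ a'))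
            := (:- (a :+ a')) :* (:- (a :+ a')) :- d :* ((b :+ b') :* (b :+ b'))) a b a' b' d) (PP⇒NN p))
         (NN-resp (solve 3 (λ a b d → a :* a :- d :* (b :* b) := a :* a :- d :* ((:- b) :* (:- b))) a b d) h)))) h) k)
  ... | inj₂ m | inj₂ n = first m' n
        (NN-resp (solve 5 (λ a b a' b' d →
            (a :+ a') :* (a :+ a') :+ (((((:- b) :- b') :* (con (+ 2) :* b')) :* d) :+
              ((a :* a :- d :* (b :* b)) :+ (a' :* a' :- a :* a) :+ (d :* (b' :* b') :- a' :* a')))
            := (a :+ a') :* (a :+ a') :- d :* ((b :+ b') :* (b :+ b'))) a b a' b' d)
          (NN-+ (NN-sq (a + a')) (NN-+ (NN-* (NN-* (NN-resp (solve 2 (λ b b' → :- (b :+ b') := (:- b) :- b') b b') n)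
             (NN-* (NN-κ 2) nb')) d≥0) (NN-+ (NN-+ h a'²≥a²) k))))
    where
    a'≥a : NN ((- a') - a)
    a'≥a = NN-resp (solve 2 (λ a a' → :- (a :+ a') := (:- a') :- a) a a') m
    a'²≥a² : NN (a' * a' - a * a)
    a'²≥a² = NN-resp (solve 2 (λ a a' → ((:- a') :- a) :* ((:- a') :+ a) := a' :* a' :- a :* a) a a')
      (NN-* a'≥a (NN-+ na' na))
    b≥b' : NN ((- b) - b')
    b≥b' = NN-resp (solve 2 (λ b b' → :- (b :+ b') := (:- b) :- b') b b') n
    -- a² ≥ d b² ≥ d b'² ≥ a'², so that a ≥ - a' as well.
    m' : NN (a + a')
    m' = NN-resp (solve 2 (λ a a' → a :- (:- a') := a :+ a') a a') (sq-cancel-NN na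
      (NN-resp (solve 5 (λ a b a' b' d → (a :* a :- d :* (b :* b)) :+ d :* (((:- b) :- b') :* ((:- b) :+ b')) :+
        (d :* (b' :* b') :- a' :* a')
          := a :* a :- (:- a') :* (:- a')) a b a' b' d)
        (NN-+ (NN-+ h (NN-* d≥0 (NN-* b≥b' (NN-+ nb nb')))) k)))

  private
    both+first : ∀ {a b a' b'} → NN a → NN b → NN a' → NN (- b') → NN (a' * a' - d * (b' * b')) →
                 NonNeg (a + a') (b + b')
    both+first {a} {b} {a'} {b'} na nb na' nb' h with NN-total (b + b')
    ... | inj₁ n = both (NN-+ na na') n
    ... | inj₂ n = first (NN-+ na na') n (NN-resp
      (solve 5 (λ a b a' b' d → (a' :* a' :- d :* (b' :* b')) :+
        (a :* (a :+ (a' :+ a')) :+ d :* (b :* (:- (b :+ b') :+ :- b')))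
        := (a :+ a') :* (a :+ a') :- d :* ((b :+ b') :* (b :+ b'))) a b a' b' d)
      (NN-+ h (NN-+ (NN-* na (NN-+ na (NN-+ na' na'))) (NN-* d≥0 (NN-* nb (NN-+ n nb'))))))

    both+second : ∀ {a b a' b'} → NN a → NN b → NN (- a') → NN b' → NN (d * (b' * b') - a' * a') →
                  NonNeg (a + a') (b + b')
    both+second {a} {b} {a'} {b'} na nb na' nb' h with NN-total (a + a')
    ... | inj₁ n = both n (NN-+ nb nb')
    ... | inj₂ n = second n (NN-+ nb nb') (NN-resp
      (solve 5 (λ a b a' b' d → (d :* (b' :* b') :- a' :* a') :+
        (d :* (b :* (b :+ (b' :+ b'))) :+ a :* (:- (a :+ a') :+ :- a'))
        := d :* ((b :+ b') :* (b :+ b')) :- (a :+ a') :* (a :+ a')) a b a' b' d)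
      (NN-+ h (NN-+ (NN-* d≥0 (NN-* nb (NN-+ nb (NN-+ nb' nb')))) (NN-* na (NN-+ n na')))))

    swapᶜ : ∀ {a b a' b'} → NonNeg (a' + a) (b' + b) → NonNeg (a + a') (b + b')
    swapᶜ = resp (+-comm _ _) (+-comm _ _)

  nonNeg-+ : ∀ {a b a' b'} → NonNeg a b → NonNeg a' b' → NonNeg (a + a') (b + b')
  nonNeg-+ (both m n) (both m' n') = both (NN-+ m m') (NN-+ n n')
  nonNeg-+ (both m n) (first m' n' h) = both+first m n m' n' h
  nonNeg-+ (both m n) (second m' n' h) = both+second m n m' n' h
  nonNeg-+ (first m n h) (both m' n') = swapᶜ (both+first m' n' m n h)
  nonNeg-+ (second m n h) (both m' n') = swapᶜ (both+second m' n' m n h)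
  nonNeg-+ (first m n h) (second m' n' h') = first+second m n h m' n' h'
  nonNeg-+ (second m n h) (first m' n' h') = swapᶜ (first+second m' n' h' m n h)
  nonNeg-+ {a} {b} {a'} {b'} (first m n h) (first m' n' h') = first (NN-+ m m') (neg-+ n n') (NN-resp
    (solve 5 (λ a b a' b' d → (a :* a :- d :* (b :* b)) :+
      (con (+ 2) :* (a :* a' :- d :* ((:- b) :* (:- b'))) :+ (a' :* a' :- d :* (b' :* b')))
       := (a :+ a') :* (a :+ a') :- d :* ((b :+ b') :* (b :+ b'))) a b a' b' d)
    (NN-+ h (NN-+ (NN-* (NN-κ 2) (mix′ a (- b) a' (- b') m m' (flip a b h) (flip a' b' h'))) h')))
    where
    flip : ∀ a b → NN (a * a - d * (b * b)) → NN (a * a - d * ((- b) * (- b)))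
    flip a b = NN-resp (solve 3 (λ a b d → a :* a :- d :* (b :* b) := a :* a :- d :* ((:- b) :* (:- b))) a b d)
  nonNeg-+ {a} {b} {a'} {b'} (second m n h) (second m' n' h') = second (neg-+ m m') (NN-+ n n') (NN-resp
    (solve 5 (λ a b a' b' d → (d :* (b :* b) :- a :* a) :+
      (con (+ 2) :* (d :* (b :* b') :- (:- a) :* (:- a')) :+ (d :* (b' :* b') :- a' :* a'))
       := d :* ((b :+ b') :* (b :+ b')) :- (a :+ a') :* (a :+ a')) a b a' b' d)
    (NN-+ h (NN-+ (NN-* (NN-κ 2) (mix (- a) b (- a') b' n n' (flip a b h) (flip a' b' h'))) h')))
    where
    flip : ∀ a b → NN (d * (b * b) - a * a) → NN (d * (b * b) - (- a) * (- a))
    flip a b = NN-resp (solve 3 (λ a b d → d :* (b :* b) :- a :* a := d :* (b :* b) :- (:- a) :* (:- a)) a b d)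

  scale : ∀ {c a b} → NN c → NonNeg a b → NonNeg (c * a) (c * b)
  scale nc (both m n) = both (NN-* nc m) (NN-* nc n)
  scale {c} {a} {b} nc (first m n h) = first (NN-* nc m)
    (NN-resp (solve 2 (λ c b → c :* (:- b) := :- (c :* b)) c b) (NN-* nc n))
    (NN-resp (solve 4 (λ c a b d → (c :* c) :* (a :* a :- d :* (b :* b)) := (c :* a) :* (c :* a) :- d :*
      ((c :* b) :* (c :* b))) c a b d)
      (NN-* (NN-sq c) h))
  scale {c} {a} {b} nc (second m n h) = second
    (NN-resp (solve 2 (λ c b → c :* (:- b) := :- (c :* b)) c a) (NN-* nc m)) (NN-* nc n)
    (NN-resp (solve 4 (λ c a b d → (c :* c) :* (d :* (b :* b) :- a :* a) := d :* ((c :* b) :* (c :* b)) :- (c :* a)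
      :* (c :* a)) c a b d)
      (NN-* (NN-sq c) h))

  unscale : ∀ {c a b} → PP c → NonNeg (c * a) (c * b) → NonNeg a b
  unscale pc (both m n) = both (NN-cancel pc m) (NN-cancel pc n)
  unscale {c} {a} {b} pc (first m n h) = first (NN-cancel pc m)
    (NN-cancel pc (NN-resp (solve 2 (λ c b → :- (c :* b) := c :* (:- b)) c b) n))
    (NN-cancel (PP-* pc pc) (NN-resp (solve 4 (λ c a b d → (c :* a) :* (c :* a) :- d :* ((c :* b) :* (c :* b)) :=
      (c :* c) :* (a :* a :- d :* (b :* b))) c a b d) h))
  unscale {c} {a} {b} pc (second m n h) = second
    (NN-cancel pc (NN-resp (solve 2 (λ c b → :- (c :* b) := c :* (:- b)) c a) m)) (NN-cancel pc n)
    (NN-cancel (PP-* pc pc) (NN-resp (solve 4 (λ c a b d → d :* ((c :* b) :* (c :* b)) :- (c :* a) :* (c :* a) :=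
      (c :* c) :* (d :* (b :* b) :- a :* a)) c a b d) h))

  -- This is multiplication by √d, which sends a + b √d to d b + a √d. With `scale` and addition it
  -- yields all products with a factor of type `both`.
  root-scale : ∀ {a b} → NonNeg a b → NonNeg (d * b) a
  root-scale (both m n) = both (NN-* d≥0 n) m
  root-scale {a} {b} (first m n h) = second
    (NN-resp (solve 2 (λ c b → c :* (:- b) := :- (c :* b)) d b) (NN-* d≥0 n)) m
    (NN-resp (solve 3 (λ a b d → d :* (a :* a :- d :* (b :* b)) := d :* (a :* a) :- (d :* b) :* (d :* b)) a b d)
      (NN-* d≥0 h))
  root-scale {a} {b} (second m n h) = first (NN-* d≥0 n) m
    (NN-resp (solve 3 (λ a b d → d :* (d :* (b :* b) :- a :* a) := (d :* b) :* (d :* b) :- d :* (a :* a)) a b d)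
      (NN-* d≥0 h))

  private
    both-* : ∀ {c e a b} → NN c → NN e → NonNeg a b → NonNeg (c * a + d * (e * b)) (c * b + e * a)
    both-* {c} {e} {a} {b} nc ne h = resp
      (solve 5 (λ c e a b d → c :* a :+ e :* (d :* b) := c :* a :+ d :* (e :* b)) c e a b d) refl
      (nonNeg-+ (scale nc h) (scale ne (root-scale h)))

    swapᵐ : ∀ {a b c e} → NonNeg (c * a + d * (e * b)) (c * b + e * a) → NonNeg (a * c + d * (b * e)) (a * e + b * c)
    swapᵐ {a} {b} {c} {e} = resp
      (solve 5 (λ c e a b d → c :* a :+ d :* (e :* b) := a :* c :+ d :* (b :* e)) c e a b d)
      (solve 4 (λ c e a b → c :* b :+ e :* a := a :* e :+ b :* c) c e a b)

    mixed-* : ∀ {a b c e} → NN a → NN (- b) → NN (a * a - d * (b * b)) →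
              NN (- c) → NN e → NN (d * (e * e) - c * c) → NonNeg (a * c + d * (b * e)) (a * e + b * c)
    mixed-* {a} {b} {c} {e} m n h m' n' h' = second
      (NN-resp (solve 5 (λ a b c e d → a :* (:- c) :+ d :* ((:- b) :* e) := :- (a :* c :+ d :* (b :* e))) a b c e d)
        (NN-+ (NN-* m m') (NN-* d≥0 (NN-* n n'))))
      (NN-resp (solve 4 (λ a b c e → a :* e :+ (:- b) :* (:- c) := a :* e :+ b :* c) a b c e)
        (NN-+ (NN-* m n') (NN-* n m')))
      (NN-resp (solve 5 (λ a b c e d → (a :* a :- d :* (b :* b)) :* (d :* (e :* e) :- c :* c)
        := d :* ((a :* e :+ b :* c) :* (a :* e :+ b :* c)) :- (a :* c :+ d :* (b :* e)) :* (a :* c :+ d :* (b :* e)))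
          a b c e d)
        (NN-* h h'))

  nonNeg-* : ∀ {a b c e} → NonNeg a b → NonNeg c e → NonNeg (a * c + d * (b * e)) (a * e + b * c)
  nonNeg-* (both m n) y = both-* m n y
  nonNeg-* x@(first _ _ _) (both m' n') = swapᵐ (both-* m' n' x)
  nonNeg-* x@(second _ _ _) (both m' n') = swapᵐ (both-* m' n' x)
  nonNeg-* (first m n h) (second m' n' h') = mixed-* m n h m' n' h'
  nonNeg-* (second m n h) (first m' n' h') = swapᵐ (mixed-* m' n' h' m n h)
  nonNeg-* {a} {b} {c} {e} (first m n h) (first m' n' h') = first
      (NN-resp (solve 5 (λ a b c e d → a :* c :+ d :* ((:- b) :* (:- e)) := a :* c :+ d :* (b :* e)) a b c e d)
        (NN-+ (NN-* m m') (NN-* d≥0 (NN-* n n'))))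
      (NN-resp (solve 4 (λ a b c e → a :* (:- e) :+ (:- b) :* c := :- (a :* e :+ b :* c)) a b c e)
        (NN-+ (NN-* m n') (NN-* n m')))
      (NN-resp (solve 5 (λ a b c e d → (a :* a :- d :* (b :* b)) :* (c :* c :- d :* (e :* e))
        := (a :* c :+ d :* (b :* e)) :* (a :* c :+ d :* (b :* e)) :- d :* ((a :* e :+ b :* c) :* (a :* e :+ b :* c)))
          a b c e d)
        (NN-* h h'))
  nonNeg-* {a} {b} {c} {e} (second m n h) (second m' n' h') = first
      (NN-resp (solve 5 (λ a b c e d → (:- a) :* (:- c) :+ d :* (b :* e) := a :* c :+ d :* (b :* e)) a b c e d)
        (NN-+ (NN-* m m') (NN-* d≥0 (NN-* n n'))))
      (NN-resp (solve 4 (λ a b c e → (:- a) :* e :+ b :* (:- c) := :- (a :* e :+ b :* c)) a b c e)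
        (NN-+ (NN-* m n') (NN-* n m')))
      (NN-resp (solve 5 (λ a b c e d → (d :* (b :* b) :- a :* a) :* (d :* (e :* e) :- c :* c)
        := (a :* c :+ d :* (b :* e)) :* (a :* c :+ d :* (b :* e)) :- d :* ((a :* e :+ b :* c) :* (a :* e :+ b :* c)))
          a b c e d)
        (NN-* h h'))

  norm : Carrier → Carrier → Carrier
  norm a b = a * a - d * (b * b)

  rational-NN : ∀ {a b} → b ≈ 0# → NonNeg a b → NN a
  rational-NN e (both m n) = m
  rational-NN e (first m n h) = m
  rational-NN {a} {b} e (second m n h) with NN⊎PP a
  ... | inj₁ r = r
  ... | inj₂ p = ⊥-elim (PP⇒¬NN- (solve 1 (λ a → (:- a) :* (:- a) := :- (con (+ 0) :- a :* a)) a) (PP-* p p)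
         (NN-resp (+-congʳ (trans (*-congˡ (trans (*-congʳ e) (zeroˡ b))) (trans (zeroʳ d) (sym κ-0)))) h))

  -- As d may be a square, a positive element can have norm zero.
  pos-degenerate : ∀ {a b} → ¬ NonNeg (- a) (- b) → NN (norm a b) → NN (- norm a b) → PP a × NN b
  pos-degenerate {a} {b} pos n n' = pa , nb
    where
    pa : PP a
    pa na with NN-total b
    ... | inj₂ m = pos (both na m)
    ... | inj₁ m = pos (first na (neg² m) (NN-resp (solve 3
        (λ a b d → a :* a :- d :* (b :* b) := (:- a) :* (:- a) :- d :* ((:- b) :* (:- b))) a b d) n))
    nb : NN b
    nb with NN-total b
    ... | inj₁ m = m
    ... | inj₂ m = ⊥-elim (pos (second (neg² (PP⇒NN pa)) m
           (NN-resp (solve 3 (λ a b d → :- (a :* a :- d :* (b :* b)) := d :* ((:- b) :* (:- b)) :- (:- a) :* (:- a))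
             a b d) n')))

  pos⇒nonNeg : ∀ {a b} → ¬ NonNeg (- a) (- b) → NonNeg a b
  pos⇒nonNeg {a} {b} p with nonNeg-total a b
  ... | inj₁ n = n
  ... | inj₂ n = ⊥-elim (p n)

  private
    conj-norm : ∀ u v → u * u + d * (v * (- v)) ≈ norm u v
    conj-norm u v = solve 3 (λ u v d → u :* u :+ d :* (v :* (:- v)) := u :* u :- d :* (v :* v)) u v d
    cancel₀ : ∀ u v → u * (- v) + v * u ≈ 0#
    cancel₀ u v = trans (solve 2 (λ u v → u :* (:- v) :+ v :* u := con (+ 0)) u v) κ-0

    -- Either u - v √d or its negative is ≥ 0. Multiplying it by u + v √d and by -(u + v √d), both ≥
    -- 0, gives the norm with both signs.
    zero-norm : ∀ {u v} → NonNeg u v → NonNeg (- u) (- v) → NN (norm u v) × NN (- norm u v)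
    zero-norm {u} {v} x y with nonNeg-total u (- v)
    ... | inj₁ z = NN-resp (conj-norm u v) (rational-NN (cancel₀ u v) (nonNeg-* x z))
                 , NN-resp (trans (solve 3 (λ u v d → (:- u) :* u :+ d :* ((:- v) :* (:- v)) := :-
                   (u :* u :+ d :* (v :* (:- v)))) u v d) (-‿cong (conj-norm u v)))
                     (rational-NN (trans (solve 2 (λ u v → (:- u) :* (:- v) :+ (:- v) :* u := con (+ 0)) u v) κ-0)
                       (nonNeg-* y z))
    ... | inj₂ z = NN-resp (trans (solve 3 (λ u v d → (:- u) :* (:- u) :+ d :* ((:- v) :* (:- (:- v))) :=
        (u :* u :+ d :* (v :* (:- v)))) u v d) (conj-norm u v))
                     (rational-NN (trans (solve 2 (λ u v → (:- u) :* (:- (:- v)) :+ (:- v) :* (:- u) := con (+ 0)) u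
                       v) κ-0) (nonNeg-* y z))
                 , NN-resp (trans (solve 3 (λ u v d → u :* (:- u) :+ d :* (v :* (:- (:- v))) := :-
                   (u :* u :+ d :* (v :* (:- v)))) u v d) (-‿cong (conj-norm u v)))
                     (rational-NN (trans (solve 2 (λ u v → u :* (:- (:- v)) :+ v :* (:- u) := con (+ 0)) u v) κ-0)
                       (nonNeg-* x z))

    trichotomy : ∀ z → PP z ⊎ PP (- z) ⊎ (NN z × NN (- z))
    trichotomy z with NN⊎PP z | NN? (- z)
    ... | inj₂ p | _     = inj₂ (inj₁ p)
    ... | inj₁ n | yes m = inj₂ (inj₂ (n , m))
    ... | inj₁ n | no ¬m = inj₁ ¬m

    -- Since b √d times the second factor is ≥ 0, adding it to a nonnegative -(product) leaves -a
    -- times the second factor, and a > 0 can be cancelled.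
    degenerate-* : ∀ {a b c e} → PP a → NN b → ¬ NonNeg (- c) (- e) →
                   ¬ NonNeg (- (a * c + d * (b * e))) (- (a * e + b * c))
    degenerate-* {a} {b} {c} {e} pa nb q n = q (unscale pa (resp
      (solve 5 (λ a b c e d → :- (a :* c :+ d :* (b :* e)) :+ b :* (d :* e) := a :* (:- c)) a b c e d)
      (solve 4 (λ a b c e → :- (a :* e :+ b :* c) :+ b :* c := a :* (:- e)) a b c e)
      (nonNeg-+ n (scale nb (root-scale (pos⇒nonNeg q))))))

  -- If the product were ≤ 0, its norm would be both ≥ 0 and ≤ 0. The norm is multiplicative, so
  -- this contradicts two norms of definite sign; a factor of norm zero is left to `degenerate-*`.
  pos-* : ∀ {a b c e} → ¬ NonNeg (- a) (- b) → ¬ NonNeg (- c) (- e) →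
          ¬ NonNeg (- (a * c + d * (b * e))) (- (a * e + b * c))
  pos-* {a} {b} {c} {e} p q n with trichotomy (norm a b) | trichotomy (norm c e)
                                 | zero-norm (nonNeg-* (pos⇒nonNeg p) (pos⇒nonNeg q)) n
  ... | inj₂ (inj₂ (x , y)) | _ | _ = let pa , nb = pos-degenerate p x y in degenerate-* pa nb q n
  ... | _ | inj₂ (inj₂ (x , y)) | _ = let pc , ne = pos-degenerate q x y in degenerate-* pc ne p (resp
      (solve 5 (λ a b c e d → :- (a :* c :+ d :* (b :* e)) := :- (c :* a :+ d :* (e :* b))) a b c e d)
      (solve 4 (λ a b c e → :- (a :* e :+ b :* c) := :- (c :* b :+ e :* a)) a b c e) n)
  ... | inj₁ x | inj₁ y | _ , m = PP⇒¬NN- (solve 5 (λ a b c e d → (a :* a :- d :* (b :* b)) :*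
      (c :* c :- d :* (e :* e)) := :- (:- ((a :* c :+ d :* (b :* e)) :* (a :* c :+ d :* (b :* e)) :- d :*
      ((a :* e :+ b :* c) :* (a :* e :+ b :* c))))) a b c e d)
      (PP-* x y) m
  ... | inj₂ (inj₁ x) | inj₂ (inj₁ y) | _ , m = PP⇒¬NN-
      (solve 5 (λ a b c e d → (:- (a :* a :- d :* (b :* b))) :* (:- (c :* c :- d :* (e :* e))) := :-
      (:- ((a :* c :+ d :* (b :* e)) :* (a :* c :+ d :* (b :* e)) :- d :*
      ((a :* e :+ b :* c) :* (a :* e :+ b :* c))))) a b c e d)
      (PP-* x y) m
  ... | inj₁ x | inj₂ (inj₁ y) | m , _ = PP⇒¬NN- (solve 5
      (λ a b c e d → (a :* a :- d :* (b :* b)) :* (:- (c :* c :- d :* (e :* e))) := :-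
      ((a :* c :+ d :* (b :* e)) :* (a :* c :+ d :* (b :* e)) :- d :* ((a :* e :+ b :* c) :* (a :* e :+ b :* c)))) a
      b c e d)
      (PP-* x y) m
  ... | inj₂ (inj₁ x) | inj₁ y | m , _ = PP⇒¬NN- (solve 5
      (λ a b c e d → (:- (a :* a :- d :* (b :* b))) :* (c :* c :- d :* (e :* e)) := :-
      ((a :* c :+ d :* (b :* e)) :* (a :* c :+ d :* (b :* e)) :- d :* ((a :* e :+ b :* c) :* (a :* e :+ b :* c)))) a
      b c e d)
      (PP-* x y) m

  open import Relation.Binary.Reasoning.Setoid setoid

  private
    bound : ∀ x → ∃ λ n → NN (κ (+ n) - x)
    bound x with arch 1# x PP-1
    ... | n , h = n , NN-resp (+-congʳ (*-identityʳ _)) h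

  -- A natural number k ≥ d + 1 has k² ≥ d and so dominates √d; with i ≥ a and j ≥ b the number i +
  -- j k dominates a + b √d.
  upper-bound : ∀ a b → ∃ λ n → NonNeg (κ (+ n) - a) (- b)
  upper-bound a b with bound a | bound b | bound (d + κ (+ 1))
  ... | i , hi | j , hj | k , hk = i ℕ.+ j ℕ.* k , resp
      (trans (solve 4 (λ i a j k → (i :- a) :+ j :* k := (i :+ j :* k) :- a) (κ (+ i)) a (κ (+ j)) (κ (+ k)))
        (+-congʳ (sym (trans (κ-+ (+ i) (+ (j ℕ.* k))) (+-congˡ (κ-pos-* j k))))))
      (solve 2 (λ j b → (j :- b) :+ (:- j) := :- b) (κ (+ j)) b)
      (nonNeg-+ (both hi hj) (first (NN-* (NN-κ j) (NN-κ k)) (neg² (NN-κ j))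
        (NN-resp (solve 3 (λ j k d → (j :* j) :* (k :* k :- d) := (j :* k) :* (j :* k) :- d :* ((:- j) :* (:- j)))
          (κ (+ j)) (κ (+ k)) d)
          (NN-* (NN-sq _) k²≥d))))
    where
    k²≥d : NN (κ (+ k) * κ (+ k) - d)
    k²≥d = NN-resp
      (solve 2 (λ k d → (k :- (d :+ con (+ 1))) :* (k :+ (d :+ con (+ 1))) :+ (d :* d :+ (d :+ con (+ 1))) := k :* k
        :- d) (κ (+ k)) d)
      (NN-+ (NN-* hk (NN-+ (NN-κ k) (NN-+ d≥0 (NN-κ 1)))) (NN-+ (NN-sq d) (NN-+ d≥0 (NN-κ 1))))

  private
    kx-norm≥0 : ∀ a b k → NonNeg a b → NonNeg (κ (+ k) - a) (- (- b)) → NonNeg (κ (+ k) * a - norm a b) (κ (+ k) * b)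
    kx-norm≥0 a b k x z = resp
      (solve 4 (λ a b k d → a :* (k :- a) :+ d :* (b :* (:- (:- b))) := k :* a :- (a :* a :- d :* (b :* b))) a b
        (κ (+ k)) d)
      (solve 3 (λ a b k → a :* (:- (:- b)) :+ b :* (k :- a) := k :* b) a b (κ (+ k))) (nonNeg-* x z)

    kx+norm≥0 : ∀ a b k → NonNeg a b → NonNeg (κ (+ k) - (- a)) (- b) → NonNeg (κ (+ k) * a - (- norm a b))
        (κ (+ k) * b)
    kx+norm≥0 a b k x z = resp
      (solve 4 (λ a b k d → a :* (k :- (:- a)) :+ d :* (b :* (:- b)) := k :* a :- (:- (a :* a :- d :* (b :* b)))) a b
        (κ (+ k)) d)
      (solve 3 (λ a b k → a :* (:- b) :+ b :* (k :- (:- a)) := k :* b) a b (κ (+ k))) (nonNeg-* x z)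

    combine : ∀ a b k n m → NonNeg (κ (+ k) * a - m) (κ (+ k) * b) → NN (κ (+ n) * m - 1#) →
              NonNeg (κ (+ (n ℕ.* k)) * a - 1#) (κ (+ (n ℕ.* k)) * b)
    combine a b k n m x h = resp
      (trans (solve 5 (λ a k n m o → n :* (k :* a :- m) :+ (n :* m :- o) := (n :* k) :* a :- o) a (κ (+ k)) (κ (+ n))
        m 1#)
         (+-congʳ (*-congʳ (sym (κ-pos-* n k)))))
      (trans (solve 3 (λ b k n → n :* (k :* b) :+ con (+ 0) := (n :* k) :* b) b (κ (+ k)) (κ (+ n)))
        (*-congʳ (sym (κ-pos-* n k))))
      (nonNeg-+ (scale (NN-κ n) x) (both h (NN-κ 0)))

  -- If k dominates the conjugate of x, or its negative when the norm is negative, then k x is at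
  -- least the absolute value of the norm, to which the archimedean property of the base applies.
  -- For norm zero, a > 0 and b ≥ 0 do the work.
  lower-bound : ∀ a b → ¬ NonNeg (- a) (- b) → ∃ λ n → NonNeg (κ (+ n) * a - 1#) (κ (+ n) * b)
  lower-bound a b p with trichotomy (norm a b)
  ... | inj₁ x = let k , z = upper-bound a (- b) ; n , h = arch (norm a b) 1# x in
        n ℕ.* k , combine a b k n (norm a b) (kx-norm≥0 a b k (pos⇒nonNeg p) z) h
  ... | inj₂ (inj₁ x) = let k , z = upper-bound (- a) b ; n , h = arch (- norm a b) 1# x in
        n ℕ.* k , combine a b k n (- norm a b) (kx+norm≥0 a b k (pos⇒nonNeg p) z) h
  ... | inj₂ (inj₂ (x , y)) = let pa , nb = pos-degenerate p x y ; n , h = arch a 1# pa in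
        n , both h (NN-* (NN-κ n) nb)

  squareRoot : OrderedℚAlgebra
  squareRoot = record
    { algebra = quadratic
    ; NN = NN'
    ; NN-resp = λ (p , q) → resp p q
    ; NN-+ = nonNeg-+
    ; NN-* = nonNeg-*
    ; NN? = λ (a , b) → nonNeg? a b
    ; NN-total = λ (a , b) → nonNeg-total a b
    ; PP-* = pos-*
    ; PP-1 = λ n → PP-1 (rational-NN -0#≈0# n)
    ; φ-NN = λ q → both (φ-NN q) NN-0
    ; arch = arch'
    }
    where
    κ-pair : ∀ z → (κ z , 0#) ≋ E.κ z
    κ-pair z = E.trans {κ z , 0#} {φ (ι z) , 0#} {E.κ z} (κ≈φι z , refl) (E.sym {E.κ z} {φ (ι z) , 0#} (E.κ≈φι z))

    arch-step : ∀ a b e f k n → NonNeg (κ (+ n) * a - 1#) (κ (+ n) * b) → NonNeg (κ (+ k) - e) (- f) →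
                NN' (E.κ (+ (k ℕ.* n)) E.* (a , b) E.- (e , f))
    arch-step a b e f k n h z = resp (proj₁ eq) (proj₂ eq) (nonNeg-+ (scale (NN-κ k) h) z)
      where
      J = κ (+ k)
      N = κ (+ n)
      eq₁ : J * (N * a - 1#) + (J - e) ≈ κ (+ (k ℕ.* n)) * a + d * (0# * b) - e
      eq₁ = begin
        J * (N * a - 1#) + (J - e)
          ≈⟨ solve 5 (λ a e k n o → k :* (n :* a :- o) :+ (k :- e) := (k :* n) :* a :+ (k :- k :* o) :- e) a e J N 1# ⟩
        (J * N) * a + (J - J * 1#) - e
          ≈⟨ +-congʳ (+-cong (*-congʳ (sym (κ-pos-* k n))) (trans (+-congˡ (-‿cong (*-identityʳ J))) (-‿inverseʳ J))) ⟩
        κ (+ (k ℕ.* n)) * a + 0# - e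
          ≈⟨ +-congʳ (+-congˡ (sym (trans (*-congˡ (zeroˡ b)) (zeroʳ d)))) ⟩
        κ (+ (k ℕ.* n)) * a + d * (0# * b) - e ∎
      eq₂ : J * (N * b) + (- f) ≈ κ (+ (k ℕ.* n)) * b + 0# * a - f
      eq₂ = begin
        J * (N * b) + (- f)
          ≈⟨ +-congʳ (trans (sym (*-assoc J N b)) (*-congʳ (sym (κ-pos-* k n)))) ⟩
        κ (+ (k ℕ.* n)) * b - f
          ≈⟨ +-congʳ (trans (sym (+-identityʳ (κ (+ (k ℕ.* n)) * b))) (+-congˡ (sym (zeroˡ a)))) ⟩
        κ (+ (k ℕ.* n)) * b + 0# * a - f ∎
      eq : (J * (N * a - 1#) + (J - e) , J * (N * b) + (- f)) ≋ (E.κ (+ (k ℕ.* n)) E.* (a , b) E.- (e , f))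
      eq = E.trans {_} {(κ (+ (k ℕ.* n)) , 0#) E.* (a , b) E.- (e , f)} {E.κ (+ (k ℕ.* n)) E.* (a , b) E.- (e , f)}
          (eq₁ , eq₂)
        (E.+-congʳ {E.- (e , f)} {(κ (+ (k ℕ.* n)) , 0#) E.* (a , b)} {E.κ (+ (k ℕ.* n)) E.* (a , b)}
          (E.*-congʳ {a , b} {κ (+ (k ℕ.* n)) , 0#} {E.κ (+ (k ℕ.* n))} (κ-pair (+ (k ℕ.* n)))))

    arch' : ∀ x y → ¬ NN' (E.- x) → ∃ λ n → NN' (E.κ (+ n) E.* x E.- y)
    arch' (a , b) (e , f) p =
      let n , h = lower-bound a b p ; k , z = upper-bound e f
      in k ℕ.* n , arch-step a b e f k n h z

-- The rational numbers as base of the tower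

ℚ-algebra : ℚAlgebra
ℚ-algebra = record
  { commutativeRing = ℚP.+-*-commutativeRing
  ; φ = λ q → q ; φ-+ = λ _ _ → ≡.refl ; φ-* = λ _ _ → ≡.refl ; φ-1 = ≡.refl }

module ℚA = ℚAlgebra ℚ-algebra

abstract
  ℚ-ordered : OrderedℚAlgebra
  ℚ-ordered = record
    { algebra = ℚ-algebra
    ; NN = 0ℚ ℚ.≤_
    ; NN-resp = λ e → ≡.subst (0ℚ ℚ.≤_) e
    ; NN-+ = λ m n → ℚP.+-mono-≤ m n
    ; NN-* = λ {x} {y} m n → ℚP.nonNegative⁻¹ (x ℚ.* y)
        {{ℚP.nonNeg*nonNeg⇒nonNeg x {{ℚ.nonNegative m}} y {{ℚ.nonNegative n}}}}
    ; NN? = λ x → 0ℚ ℚP.≤? x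
    ; NN-total = λ x → [ inj₁ , (λ x≤0 → inj₂ (ℚP.neg-antimono-≤ x≤0)) ]′ (ℚP.≤-total 0ℚ x)
    ; PP-* = λ {x} {y} m n → 0<⇒PP (ℚP.positive⁻¹ (x ℚ.* y)
        {{ℚP.pos*pos⇒pos x {{ℚ.positive (PP⇒0< m)}} y {{ℚ.positive (PP⇒0< n)}}}})
    ; PP-1 = 0<⇒PP (ℚP.positive⁻¹ 1ℚ)
    ; φ-NN = λ n → n
    -- A positive x has numerator at least 1, so x times its denominator is at least 1, while y is
    -- at most the absolute value of its numerator.
    ; arch = λ x y m → ℤ.∣ ℚ.↥ y ∣ ℕ.* ℚ.↧ₙ x , ≡.subst (λ z → 0ℚ ℚ.≤ z ℚ.* x ℚ.- y)
        (≡.sym (ℚA.κ≈φι (+ (ℤ.∣ ℚ.↥ y ∣ ℕ.* ℚ.↧ₙ x)))) (large x y (PP⇒0< m))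
    }
    where
    PP⇒0< : ∀ {x} → ¬ 0ℚ ℚ.≤ ℚ.- x → 0ℚ ℚ.< x
    PP⇒0< {x} n = ℚP.≰⇒> (λ x≤0 → n (ℚP.neg-antimono-≤ x≤0))
    0<⇒PP : ∀ {x} → 0ℚ ℚ.< x → ¬ 0ℚ ℚ.≤ ℚ.- x
    0<⇒PP l n = ℚP.<-irrefl ≡.refl (ℚP.<-≤-trans (ℚP.neg-antimono-< l) n)

    p≤q⇒0≤q-p : ∀ {p q} → p ℚ.≤ q → 0ℚ ℚ.≤ q ℚ.- p
    p≤q⇒0≤q-p {p} {q} l = ≡.subst (ℚ._≤ q ℚ.- p) (ℚP.+-inverseʳ p) (ℚP.+-monoˡ-≤ (ℚ.- p) l)

    x*↧x : ∀ x → x ℚ.* ι (ℚ.↧ x) ≡ ι (ℚ.↥ x)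
    x*↧x x@(ℚ.mkℚ n k _) = ℚP.toℚᵘ-injective (ℚᵘP.≃-trans (ℚP.toℚᵘ-homo-* x (ι (ℚ.↧ x)))
      (ℚᵘP.≃-trans (ℚᵘP.*-cong (ℚᵘP.≃-refl {ℚ.toℚᵘ x}) (toℚᵘ-ι (ℚ.↧ x)))
        (ℚᵘP.≃-trans (ℚᵘ.*≡* {_} {ℚᵘ.mkℚᵘ n 0} (≡.trans (ℤP.*-identityʳ (n ℤ.* + suc k))
          (≡.cong (λ z → n ℤ.* + z) (≡.sym (ℕP.*-identityʳ (suc k))))))
          (ℚᵘP.≃-sym (toℚᵘ-ι (ℚ.↥ x))))))
      where import Data.Rational.Unnormalised as ℚᵘ
            import Data.Rational.Unnormalised.Properties as ℚᵘP

    y≤∣↥y∣ : ∀ y → y ℚ.≤ ι (+ ℤ.∣ ℚ.↥ y ∣)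
    y≤∣↥y∣ y = ℚP.*-cancelʳ-≤-pos (ι (ℚ.↧ y)) {{ℚ.positive (0<ι (ℚ.↧ₙ y))}} (begin
      y ℚ.* ι (ℚ.↧ y)                        ≡⟨ x*↧x y ⟩
      ι (ℚ.↥ y)                              ≤⟨ ι-mono-≤ (i≤∣i∣*n (ℚ.↥ y) _) ⟩
      ι (+ ℤ.∣ ℚ.↥ y ∣ ℤ.* ℚ.↧ y)            ≡⟨ ι-* (+ ℤ.∣ ℚ.↥ y ∣) (ℚ.↧ y) ⟩
      ι (+ ℤ.∣ ℚ.↥ y ∣) ℚ.* ι (ℚ.↧ y) ∎)
      where
      open ℚP.≤-Reasoning
      0<ι : ∀ n .{{_ : ℕ.NonZero n}} → 0ℚ ℚ.< ι (+ n)
      0<ι (suc n) = ℚP.<-≤-trans (ℚP.positive⁻¹ 1ℚ) (ι-mono-≤ {+ 1} {+ suc n} (ℤ.+≤+ (ℕ.s≤s ℕ.z≤n)))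
      i≤∣i∣*n : ∀ i n → i ℤ.≤ + ℤ.∣ i ∣ ℤ.* + suc n
      i≤∣i∣*n i n = ℤP.≤-trans (i≤∣i∣ i) (≡.subst (+ ℤ.∣ i ∣ ℤ.≤_) (ℤP.pos-* ℤ.∣ i ∣ (suc n))
          (ℤ.+≤+ (ℕP.m≤m*n ℤ.∣ i ∣ (suc n))))
        where
        i≤∣i∣ : ∀ i → i ℤ.≤ + ℤ.∣ i ∣
        i≤∣i∣ (+ n) = ℤP.≤-refl
        i≤∣i∣ -[1+ n ] = ℤ.-≤+

    1≤↥ : ∀ x → 0ℚ ℚ.< x → 1ℚ ℚ.≤ ι (ℚ.↥ x)
    1≤↥ x l with ℚ.positive l
    1≤↥ (ℚ.mkℚ (+ suc n) _ _) l | _ = ι-mono-≤ {+ 1} {+ suc n} (ℤ.+≤+ (ℕ.s≤s ℕ.z≤n))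

    large : ∀ x y → 0ℚ ℚ.< x → 0ℚ ℚ.≤ ι (+ (ℤ.∣ ℚ.↥ y ∣ ℕ.* ℚ.↧ₙ x)) ℚ.* x ℚ.- y
    large x y l = p≤q⇒0≤q-p (begin
      y                                      ≤⟨ y≤∣↥y∣ y ⟩
      ι (+ k)                                ≡⟨ ℚP.*-identityʳ _ ⟨
      ι (+ k) ℚ.* 1ℚ                         ≤⟨ ℚP.*-monoˡ-≤-nonNeg (ι (+ k))
          {{ℚ.nonNegative (ι-mono-≤ {+ 0} {+ k} (ℤ.+≤+ ℕ.z≤n))}} (1≤↥ x l) ⟩
      ι (+ k) ℚ.* ι (ℚ.↥ x)                  ≡⟨ ≡.cong (ι (+ k) ℚ.*_) (≡.trans (≡.sym (x*↧x x)) (ℚP.*-comm x _)) ⟩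
      ι (+ k) ℚ.* (ι (ℚ.↧ x) ℚ.* x)          ≡⟨ ℚP.*-assoc (ι (+ k)) (ι (ℚ.↧ x)) x ⟨
      ι (+ k) ℚ.* ι (ℚ.↧ x) ℚ.* x            ≡⟨ ≡.cong (ℚ._* x)
          (≡.trans (≡.sym (ι-* (+ k) (ℚ.↧ x))) (≡.cong ι (≡.sym (ℤP.pos-* k (ℚ.↧ₙ x))))) ⟩
      ι (+ (k ℕ.* ℚ.↧ₙ x)) ℚ.* x ∎)
      where
      open ℚP.≤-Reasoning
      k : ℕ
      k = ℤ.∣ ℚ.↥ y ∣

-- The tower containing |D| and the coordinates of √D

-- The interface through which an extension is used. Since `adjoin` is abstract, the nested pairs
-- and sign cases of the three extensions never unfold.
record Adjunction (F : OrderedℚAlgebra) (d : OrderedℚAlgebra.Carrier F) : Set₁ where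
  private module F = OrderedℚAlgebra F
  field
    extension : OrderedℚAlgebra
  private module G = OrderedℚAlgebra extension
  field
    embed    : F.Carrier → G.Carrier
    embed-≈  : ∀ {x y} → x F.≈ y → embed x G.≈ embed y
    embed-+  : ∀ x y → embed (x F.+ y) G.≈ embed x G.+ embed y
    embed-*  : ∀ x y → embed (x F.* y) G.≈ embed x G.* embed y
    embed-φ  : ∀ q → embed (F.φ q) G.≈ G.φ q
    embed-NN : ∀ {x} → F.NN x → G.NN (embed x)
    root     : G.Carrier
    root≥0   : G.NN root
    root²    : root G.* root G.≈ embed d

  embed-κ : ∀ z → embed (F.κ z) G.≈ G.κ z
  embed-κ z = G.trans (embed-≈ (F.κ≈φι z)) (G.trans (embed-φ (ι z)) (G.sym (G.κ≈φι z)))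

  embed-neg : ∀ x → embed (F.- x) G.≈ G.- embed x
  embed-neg x = G.+-inverseʳ-unique (embed x) (embed (F.- x)) (G.trans (G.sym (embed-+ x (F.- x)))
    (G.trans (embed-≈ (F.trans (F.-‿inverseʳ x) (F.sym F.κ-0))) (G.trans (embed-κ (+ 0)) G.κ-0)))

abstract
  adjoin : ∀ F d → OrderedℚAlgebra.NN F d → Adjunction F d
  adjoin F d d≥0 = record
    { extension = SquareRoot.squareRoot F d d≥0
    ; embed = λ x → x , 0#
    ; embed-≈ = λ e → e , refl
    ; embed-+ = λ x y → refl , sym (+-identityˡ 0#)
    ; embed-* = λ x y → trans (sym (+-identityʳ _)) (+-congˡ (sym (trans (*-congˡ (zeroˡ 0#)) (zeroʳ d))))
                      , sym (trans (+-cong (zeroʳ x) (zeroˡ y)) (+-identityˡ 0#))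
    ; embed-φ = λ q → refl , refl
    ; embed-NN = λ n → SquareRoot.both n NN-0
    ; root = 0# , 1#
    ; root≥0 = SquareRoot.both NN-0 (PP⇒NN PP-1)
    ; root² = trans (+-cong (zeroˡ 0#) (trans (*-congˡ (*-identityˡ 1#)) (*-identityʳ d))) (+-identityˡ d)
            , trans (+-cong (zeroˡ 1#) (zeroʳ 1#)) (+-identityˡ 0#)
    }
    where open OrderedℚAlgebra F

-- p + q i is a square root of m + n i up to the sign of q, and r = |m + n i|.
record RootTower (m n : ℤ) : Set₁ where
  field
    ordered : OrderedℚAlgebra
  open OrderedℚAlgebra ordered public
  field
    p q r : Carrier
    p≥0   : NN p
    q≥0   : NN q
    r≥0   : NN r
    r²    : r * r ≈ κ m * κ m + κ n * κ n
    2p²   : κ (+ 2) * (p * p) ≈ r + κ m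
    2q²   : κ (+ 2) * (q * q) ≈ r - κ m

rootTower : ∀ m n → RootTower m n
rootTower m n = record
  { ordered = F₃ ; p = A₃.embed A₂.root ; q = A₃.root ; r = A₃.embed (A₂.embed r₁)
  ; p≥0 = A₃.embed-NN A₂.root≥0 ; q≥0 = A₃.root≥0 ; r≥0 = A₃.embed-NN (A₂.embed-NN A₁.root≥0)
  ; r² = begin
      A₃.embed (A₂.embed r₁) * A₃.embed (A₂.embed r₁) ≈⟨ A₃.embed-* _ _ ⟨
      A₃.embed (A₂.embed r₁ F₂.* A₂.embed r₁)         ≈⟨ A₃.embed-≈ (A₂.embed-* _ _) ⟨
      A₃.embed (A₂.embed (r₁ F₁.* r₁))                ≈⟨ A₃.embed-≈ (A₂.embed-≈ r₁²) ⟩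
      A₃.embed (A₂.embed (F₁.κ m F₁.* F₁.κ m F₁.+ F₁.κ n F₁.* F₁.κ n))
        ≈⟨ A₃.embed-≈ (A₂.embed-≈ (F₁.+-cong (F₁.κ-* m m) (F₁.κ-* n n))) ⟨
      A₃.embed (A₂.embed (F₁.κ (m ℤ.* m) F₁.+ F₁.κ (n ℤ.* n)))
        ≈⟨ A₃.embed-≈ (A₂.embed-≈ (F₁.κ-+ (m ℤ.* m) (n ℤ.* n))) ⟨
      A₃.embed (A₂.embed (F₁.κ (m ℤ.* m ℤ.+ n ℤ.* n)))
        ≈⟨ trans (A₃.embed-≈ (A₂.embed-κ _)) (A₃.embed-κ _) ⟩
      κ (m ℤ.* m ℤ.+ n ℤ.* n)
        ≈⟨ trans (κ-+ (m ℤ.* m) (n ℤ.* n)) (+-cong (κ-* m m) (κ-* n n)) ⟩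
      κ m * κ m + κ n * κ n ∎
  ; 2p² = begin
      κ (+ 2) * (A₃.embed A₂.root * A₃.embed A₂.root) ≈⟨ *-congˡ (A₃.embed-* _ _) ⟨
      κ (+ 2) * A₃.embed (A₂.root F₂.* A₂.root)       ≈⟨ *-congˡ (A₃.embed-≈ A₂.root²) ⟩
      κ (+ 2) * A₃.embed (A₂.embed (F₁.φ ½ F₁.* (r₁ F₁.+ F₁.κ m))) ≈⟨ double-half (r₁ F₁.+ F₁.κ m) ⟩
      A₃.embed (A₂.embed (r₁ F₁.+ F₁.κ m))            ≈⟨ E-+ r₁ (F₁.κ m) ⟩
      A₃.embed (A₂.embed r₁) + A₃.embed (A₂.embed (F₁.κ m)) ≈⟨ +-congˡ (E-κ m) ⟩
      A₃.embed (A₂.embed r₁) + κ m ∎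
  ; 2q² = begin
      κ (+ 2) * (A₃.root * A₃.root)                   ≈⟨ *-congˡ A₃.root² ⟩
      κ (+ 2) * A₃.embed (A₂.embed (F₁.φ ½ F₁.* (r₁ F₁.- F₁.κ m))) ≈⟨ double-half (r₁ F₁.- F₁.κ m) ⟩
      A₃.embed (A₂.embed (r₁ F₁.- F₁.κ m))            ≈⟨ E-+ r₁ (F₁.- F₁.κ m) ⟩
      A₃.embed (A₂.embed r₁) + A₃.embed (A₂.embed (F₁.- F₁.κ m))
        ≈⟨ +-congˡ (trans (A₃.embed-≈ (A₂.embed-neg (F₁.κ m)))
          (trans (A₃.embed-neg (A₂.embed (F₁.κ m))) (-‿cong (E-κ m)))) ⟩
      A₃.embed (A₂.embed r₁) - κ m ∎
  }
  where
  module F₀ = OrderedℚAlgebra ℚ-ordered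
  A₁ = adjoin ℚ-ordered (F₀.κ m F₀.* F₀.κ m F₀.+ F₀.κ n F₀.* F₀.κ n) (F₀.NN-+ (F₀.NN-sq (F₀.κ m)) (F₀.NN-sq (F₀.κ n)))
  module A₁ = Adjunction A₁
  F₁ = A₁.extension
  module F₁ = OrderedℚAlgebra F₁
  r₁ = A₁.root
  r₁² : r₁ F₁.* r₁ F₁.≈ F₁.κ m F₁.* F₁.κ m F₁.+ F₁.κ n F₁.* F₁.κ n
  r₁² = F₁.trans A₁.root² (F₁.trans (A₁.embed-+ _ _) (F₁.+-cong (sq m) (sq n)))
    where
    sq : ∀ z → A₁.embed (F₀.κ z F₀.* F₀.κ z) F₁.≈ F₁.κ z F₁.* F₁.κ z
    sq z = F₁.trans (A₁.embed-* (F₀.κ z) (F₀.κ z)) (F₁.*-cong (A₁.embed-κ z) (A₁.embed-κ z))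
  -- Here r₁² - x² = n² ≥ 0. For x = ±m this makes both radicands (r ± m)/2 nonnegative.
  r-sq : ∀ x → x F₁.* x F₁.≈ F₁.κ m F₁.* F₁.κ m → F₁.NN (r₁ F₁.- x)
  r-sq x e = F₁.sq-cancel-NN A₁.root≥0 (F₁.NN-resp
    (F₁.sym (F₁.trans (F₁.+-cong r₁² (F₁.-‿cong e)) (F₁.solve 2 (λ a b → (a F₁.:+ b) F₁.:- a F₁.:= b)
      (F₁.κ m F₁.* F₁.κ m) (F₁.κ n F₁.* F₁.κ n))))
    (F₁.NN-sq (F₁.κ n)))
  ½≥0 : F₁.NN (F₁.φ ½)
  ½≥0 = F₁.φ-NN (ℚP.nonNegative⁻¹ ½)
  A₂ = adjoin F₁ (F₁.φ ½ F₁.* (r₁ F₁.+ F₁.κ m)) (F₁.NN-* ½≥0 (F₁.NN-resp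
         (F₁.solve 2 (λ a b → a F₁.:- (F₁.:- b) F₁.:= a F₁.:+ b) r₁ (F₁.κ m))
         (r-sq (F₁.- F₁.κ m) (F₁.solve 1 (λ a → (F₁.:- a) F₁.:* (F₁.:- a) F₁.:= a F₁.:* a) (F₁.κ m)))))
  module A₂ = Adjunction A₂
  F₂ = A₂.extension
  module F₂ = OrderedℚAlgebra F₂
  A₃ = adjoin F₂ (A₂.embed (F₁.φ ½ F₁.* (r₁ F₁.- F₁.κ m))) (A₂.embed-NN (F₁.NN-* ½≥0 (r-sq (F₁.κ m) F₁.refl)))
  module A₃ = Adjunction A₃
  F₃ = A₃.extension
  open OrderedℚAlgebra F₃
  open import Relation.Binary.Reasoning.Setoid setoid
  E-+ : ∀ x y → A₃.embed (A₂.embed (x F₁.+ y)) ≈ A₃.embed (A₂.embed x) + A₃.embed (A₂.embed y)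
  E-+ x y = trans (A₃.embed-≈ (A₂.embed-+ x y)) (A₃.embed-+ _ _)
  E-κ : ∀ z → A₃.embed (A₂.embed (F₁.κ z)) ≈ κ z
  E-κ z = trans (A₃.embed-≈ (A₂.embed-κ z)) (A₃.embed-κ z)
  double-half : ∀ x → κ (+ 2) * A₃.embed (A₂.embed (F₁.φ ½ F₁.* x)) ≈ A₃.embed (A₂.embed x)
  double-half x = begin
    κ (+ 2) * A₃.embed (A₂.embed (F₁.φ ½ F₁.* x))
      ≈⟨ *-congˡ (trans (A₃.embed-≈ (A₂.embed-* (F₁.φ ½) x)) (A₃.embed-* _ _)) ⟩
    κ (+ 2) * (A₃.embed (A₂.embed (F₁.φ ½)) * A₃.embed (A₂.embed x))
      ≈⟨ *-cong (κ≈φι (+ 2)) (*-congʳ (trans (A₃.embed-≈ (A₂.embed-φ ½)) (A₃.embed-φ ½))) ⟩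
    φ (ι (+ 2)) * (φ ½ * A₃.embed (A₂.embed x))
      ≈⟨ trans (sym (*-assoc _ _ _)) (*-congʳ (trans (sym (φ-* (ι (+ 2)) ½)) φ-1)) ⟩
    1# * A₃.embed (A₂.embed x)
      ≈⟨ *-identityˡ _ ⟩
    A₃.embed (A₂.embed x) ∎

-- Adjoining a root of a square creates nonzero elements that are both ≥ 0 and ≤ 0; here they become zero.
module Antisymmetric (F : OrderedℚAlgebra) where
  open OrderedℚAlgebra F

  infix 4 _≃_
  _≃_ : Carrier → Carrier → Set
  x ≃ y = NN (x - y) × NN (y - x)

  ≈⇒≃ : ∀ {x y} → x ≈ y → x ≃ y
  ≈⇒≃ {x} {y} e = NN-resp (trans (sym (-‿inverseʳ y)) (+-congʳ (sym e))) NN-0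
                , NN-resp (trans (sym (-‿inverseʳ y)) (+-congˡ (-‿cong (sym e)))) NN-0

  ≃-trans : ∀ {x y z} → x ≃ y → y ≃ z → x ≃ z
  ≃-trans (a , b) (c , d) = go a c , go d b
    where
    go : ∀ {x y z} → NN (x - y) → NN (y - z) → NN (x - z)
    go {x} {y} {z} m n = NN-resp (solve 3 (λ x y z → (x :- y) :+ (y :- z) := x :- z) x y z) (NN-+ m n)

  ≃-neg : ∀ {x y} → x ≃ y → (- x) ≃ (- y)
  ≃-neg {x} {y} (a , b) = NN-resp (eq y x) b , NN-resp (eq x y) a
    where
    eq : ∀ x y → x - y ≈ - y - (- x)
    eq = solve 2 (λ x y → x :- y := (:- y) :- (:- x))

  ≃-+ : ∀ {x y u v} → x ≃ y → u ≃ v → (x + u) ≃ (y + v)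
  ≃-+ {x} {y} {u} {v} (a , b) (c , d) = NN-resp (eq x y u v) (NN-+ a c) , NN-resp (eq y x v u) (NN-+ b d)
    where
    eq : ∀ x y u v → (x - y) + (u - v) ≈ x + u - (y + v)
    eq = solve 4 (λ x y u v → (x :- y) :+ (u :- v) := x :+ u :- (y :+ v))

  ≃-*ʳ : ∀ {x y} z → x ≃ y → (x * z) ≃ (y * z)
  ≃-*ʳ {x} {y} z (a , b) with NN-total z
  ... | inj₁ n = NN-resp (eq x y z) (NN-* a n) , NN-resp (eq y x z) (NN-* b n)
    where
    eq : ∀ x y z → (x - y) * z ≈ x * z - y * z
    eq = solve 3 (λ x y z → (x :- y) :* z := x :* z :- y :* z)
  ... | inj₂ n = NN-resp (eq x y z) (NN-* b n) , NN-resp (eq y x z) (NN-* a n)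
    where
    eq : ∀ x y z → (y - x) * (- z) ≈ x * z - y * z
    eq = solve 3 (λ x y z → (y :- x) :* (:- z) := x :* z :- y :* z)

  ≃-* : ∀ {x y u v} → x ≃ y → u ≃ v → (x * u) ≃ (y * v)
  ≃-* {x} {y} {u} {v} p q = ≃-trans (≃-*ʳ u p) (≃-trans (≈⇒≃ (*-comm y u)) (≃-trans (≃-*ʳ y q) (≈⇒≃ (*-comm v y))))

  NN-≃ : ∀ {x y} → x ≃ y → NN x → NN y
  NN-≃ {x} {y} (_ , h) n = NN-resp (solve 2 (λ x y → (y :- x) :+ x := y) x y) (NN-+ h n)

  ≃-algebra : ℚAlgebra
  ≃-algebra = record
    { commutativeRing = record
      { Carrier = Carrier ; _≈_ = _≃_ ; _+_ = _+_ ; _*_ = _*_ ; -_ = -_ ; 0# = 0# ; 1# = 1#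
      ; isCommutativeRing = record
        { isRing = record
          { +-isAbelianGroup = record
            { isGroup = record
              { isMonoid = record
                { isSemigroup = record
                  { isMagma = record
                    { isEquivalence = record { refl = ≈⇒≃ refl ; sym = λ (a , b) → b , a ; trans = ≃-trans }
                    ; ∙-cong = ≃-+ }
                  ; assoc = λ x y z → ≈⇒≃ (+-assoc x y z) }
                ; identity = (λ x → ≈⇒≃ (+-identityˡ x)) , (λ x → ≈⇒≃ (+-identityʳ x)) }
              ; inverse = (λ x → ≈⇒≃ (-‿inverseˡ x)) , (λ x → ≈⇒≃ (-‿inverseʳ x))
              ; ⁻¹-cong = ≃-neg }
            ; comm = λ x y → ≈⇒≃ (+-comm x y) }
          ; *-cong = ≃-*
          ; *-assoc = λ x y z → ≈⇒≃ (*-assoc x y z)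
          ; *-identity = (λ x → ≈⇒≃ (*-identityˡ x)) , (λ x → ≈⇒≃ (*-identityʳ x))
          ; distrib = (λ x y z → ≈⇒≃ (distribˡ x y z)) , (λ x y z → ≈⇒≃ (distribʳ x y z)) }
        ; *-comm = λ x y → ≈⇒≃ (*-comm x y) } }
    ; φ = φ
    ; φ-+ = λ a b → ≈⇒≃ (φ-+ a b)
    ; φ-* = λ a b → ≈⇒≃ (φ-* a b)
    ; φ-1 = ≈⇒≃ φ-1 }

  private module E = ℚAlgebra ≃-algebra

  κ≃ : ∀ z → κ z ≃ E.κ z
  κ≃ z = ≃-trans (≈⇒≃ (κ≈φι z)) (E.sym (E.κ≈φι z))

  ≃-ordered : OrderedℚAlgebra
  ≃-ordered = record
    { algebra = ≃-algebra
    ; NN = NN ; NN-resp = NN-≃ ; NN-+ = NN-+ ; NN-* = NN-* ; NN? = NN? ; NN-total = NN-total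
    ; PP-* = PP-* ; PP-1 = PP-1 ; φ-NN = φ-NN
    ; arch = λ x y p → let n , h = arch x y p in n , NN-≃ (≃-+ (≃-*ʳ x (κ≃ (+ n))) (≈⇒≃ refl)) h }

record SqrtModel (m n : ℤ) : Set₁ where
  field
    tower : RootTower m n
  open RootTower tower public
  field
    antisym : ∀ {x y} → NN (x - y) → NN (y - x) → x ≈ y

  -- Both sides are ≥ 0 and have the same square, as (r + m)(r - m) = n². Passing from equal squares
  -- to equality is what requires `antisym`.
  2pq : κ (+ 2) * (p * q) ≈ κ (+ ℤ.∣ n ∣)
  2pq = antisym (sq-cancel-NN 2pq≥0 (NN-resp (trans (sym (-‿inverseʳ _)) (+-congˡ (-‿cong same))) NN-0))
                (sq-cancel-NN (NN-κ ℤ.∣ n ∣) (NN-resp (trans (sym (-‿inverseʳ _)) (+-congʳ same)) NN-0))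
    where
    open import Relation.Binary.Reasoning.Setoid setoid
    2pq≥0 : NN (κ (+ 2) * (p * q))
    2pq≥0 = NN-* (NN-κ 2) (NN-* p≥0 q≥0)
    ∣∣² : ∀ z → κ z * κ z ≈ κ (+ ℤ.∣ z ∣) * κ (+ ℤ.∣ z ∣)
    ∣∣² (+ k) = refl
    ∣∣² -[1+ k ] = trans (*-cong (κ-neg (+ suc k)) (κ-neg (+ suc k))) (solve 1 (λ a → (:- a) :* (:- a) := a :* a) _)
    same : κ (+ 2) * (p * q) * (κ (+ 2) * (p * q)) ≈ κ (+ ℤ.∣ n ∣) * κ (+ ℤ.∣ n ∣)
    same = begin
      κ (+ 2) * (p * q) * (κ (+ 2) * (p * q)) ≈⟨ solve 2
          (λ p q → con (+ 2) :* (p :* q) :* (con (+ 2) :* (p :* q)) := (con (+ 2) :* (p :* p)) :*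
          (con (+ 2) :* (q :* q))) p q ⟩
      κ (+ 2) * (p * p) * (κ (+ 2) * (q * q)) ≈⟨ *-cong 2p² 2q² ⟩
      (r + κ m) * (r - κ m)                   ≈⟨ solve 2 (λ r m → (r :+ m) :* (r :- m) := r :* r :- m :* m) r (κ m) ⟩
      r * r - κ m * κ m                       ≈⟨ +-congʳ r² ⟩
      κ m * κ m + κ n * κ n - κ m * κ m       ≈⟨ solve 2 (λ x y → x :+ y :- x := y) (κ m * κ m) (κ n * κ n) ⟩
      κ n * κ n                               ≈⟨ ∣∣² n ⟩
      κ (+ ℤ.∣ n ∣) * κ (+ ℤ.∣ n ∣) ∎

fromTower : ∀ {m n} → RootTower m n → SqrtModel m n
fromTower {m} {n} tower = record
  { antisym = λ a b → a , b
  ; tower = record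
  { ordered = ≃-ordered
  ; p = p ; q = q ; r = r ; p≥0 = p≥0 ; q≥0 = q≥0 ; r≥0 = r≥0
  ; r² = E.trans (≈⇒≃ r²) (E.+-cong (E.*-cong (κ≃ m) (κ≃ m)) (E.*-cong (κ≃ n) (κ≃ n)))
  ; 2p² = E.trans (E.*-congʳ (E.sym (κ≃ (+ 2)))) (E.trans (≈⇒≃ 2p²) (E.+-congˡ (κ≃ m)))
  ; 2q² = E.trans (E.*-congʳ (E.sym (κ≃ (+ 2)))) (E.trans (≈⇒≃ 2q²) (E.+-congˡ (E.-‿cong (κ≃ m)))) } }
  where
  open RootTower tower
  open Antisymmetric (RootTower.ordered tower)
  module E = OrderedℚAlgebra ≃-ordered

sqrtModel : ∀ m n → SqrtModel m n
sqrtModel m n = fromTower (rootTower m n)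

-- Lattice coordinates and Gaussian integers

-- U (1 + i) + V (1 - i)
grid : ℤ → ℤ → GI
grid U V = (U ℤ.+ V , U ℤ.- V)

-- Multiplication by i sends the coordinates (U , V) to (V , -U). The families of the floor function
-- thus become the four open half-axes, and by `quadrant` the four open quadrants, of the (U , V)
-- plane.
axis : Fin 4 → ℤ → GI
axis 0F C = grid C (+ 0)
axis 1F C = grid (+ 0) (ℤ.- C)
axis 2F C = grid (ℤ.- C) (+ 0)
axis 3F C = grid (+ 0) C

quadrant : Fin 4 → ℤ → ℤ → GI
quadrant 0F C L = grid C L
quadrant 1F C L = grid L (ℤ.- C)
quadrant 2F C L = grid (ℤ.- C) (ℤ.- L)
quadrant 3F C L = grid (ℤ.- L) C

private
  module Z = ℤS.+-*-Solver

  Pol : ℕ → Set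
  Pol k = Z.Polynomial k × Z.Polynomial k

  infixl 7 _⊗_
  infixl 6 _⊕_ _⊖_
  _⊗_ _⊕_ _⊖_ : ∀ {k} → Pol k → Pol k → Pol k
  (x , y) ⊗ (x' , y') = (x Z.:* x' Z.:- y Z.:* y' , x Z.:* y' Z.:+ y Z.:* x')
  (x , y) ⊕ (x' , y') = (x Z.:+ x' , y Z.:+ y')
  (x , y) ⊖ (x' , y') = (x Z.:- x' , y Z.:- y')

  neg : ∀ {k} → Pol k → Pol k
  neg (x , y) = (Z.:- x , Z.:- y)

  constant : ∀ {k} → GI → Pol k
  constant (x , y) = (Z.con x , Z.con y)

  axisP : ∀ {k} → Fin 4 → Z.Polynomial k → Pol k
  axisP k C = constant (ipow k) ⊗ (constant e₁ ⊗ (C , Z.con (+ 0)))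

  quadrantP : ∀ {k} → Fin 4 → Z.Polynomial k → Z.Polynomial k → Pol k
  quadrantP k C L = constant (ipow k) ⊗ ((C , Z.con (+ 0)) ⊗ constant e₁ ⊕ (L , Z.con (+ 0)) ⊗ constant e₂)

axis-≡ : ∀ k c → ipow k *GI (e₁ *GI ℕ⁺ c) ≡ axis k (+ suc c)
axis-≡ 0F c = ≡.cong₂ _,_
  (Z.solve 1 (λ C → proj₁ (axisP 0F C) Z.:= C Z.:+ Z.con (+ 0)) ≡.refl (+ suc c))
  (Z.solve 1 (λ C → proj₂ (axisP 0F C) Z.:= C Z.:- Z.con (+ 0)) ≡.refl (+ suc c))
axis-≡ 1F c = ≡.cong₂ _,_
  (Z.solve 1 (λ C → proj₁ (axisP 1F C) Z.:= Z.con (+ 0) Z.:+ (Z.:- C)) ≡.refl (+ suc c))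
  (Z.solve 1 (λ C → proj₂ (axisP 1F C) Z.:= Z.con (+ 0) Z.:- (Z.:- C)) ≡.refl (+ suc c))
axis-≡ 2F c = ≡.cong₂ _,_
  (Z.solve 1 (λ C → proj₁ (axisP 2F C) Z.:= (Z.:- C) Z.:+ Z.con (+ 0)) ≡.refl (+ suc c))
  (Z.solve 1 (λ C → proj₂ (axisP 2F C) Z.:= (Z.:- C) Z.:- Z.con (+ 0)) ≡.refl (+ suc c))
axis-≡ 3F c = ≡.cong₂ _,_
  (Z.solve 1 (λ C → proj₁ (axisP 3F C) Z.:= Z.con (+ 0) Z.:+ C) ≡.refl (+ suc c))
  (Z.solve 1 (λ C → proj₂ (axisP 3F C) Z.:= Z.con (+ 0) Z.:- C) ≡.refl (+ suc c))

quadrant-≡ : ∀ k c l → ipow k *GI ((ℕ⁺ c *GI e₁) +GI (ℕ⁺ l *GI e₂)) ≡ quadrant k (+ suc c) (+ suc l)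
quadrant-≡ 0F c l = ≡.cong₂ _,_
  (Z.solve 2 (λ C L → proj₁ (quadrantP 0F C L) Z.:= C Z.:+ L) ≡.refl (+ suc c) (+ suc l))
  (Z.solve 2 (λ C L → proj₂ (quadrantP 0F C L) Z.:= C Z.:- L) ≡.refl (+ suc c) (+ suc l))
quadrant-≡ 1F c l = ≡.cong₂ _,_
  (Z.solve 2 (λ C L → proj₁ (quadrantP 1F C L) Z.:= L Z.:+ (Z.:- C)) ≡.refl (+ suc c) (+ suc l))
  (Z.solve 2 (λ C L → proj₂ (quadrantP 1F C L) Z.:= L Z.:- (Z.:- C)) ≡.refl (+ suc c) (+ suc l))
quadrant-≡ 2F c l = ≡.cong₂ _,_
  (Z.solve 2 (λ C L → proj₁ (quadrantP 2F C L) Z.:= (Z.:- C) Z.:+ (Z.:- L)) ≡.refl (+ suc c) (+ suc l))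
  (Z.solve 2 (λ C L → proj₂ (quadrantP 2F C L) Z.:= (Z.:- C) Z.:- (Z.:- L)) ≡.refl (+ suc c) (+ suc l))
quadrant-≡ 3F c l = ≡.cong₂ _,_
  (Z.solve 2 (λ C L → proj₁ (quadrantP 3F C L) Z.:= (Z.:- L) Z.:+ C) ≡.refl (+ suc c) (+ suc l))
  (Z.solve 2 (λ C L → proj₂ (quadrantP 3F C L) Z.:= (Z.:- L) Z.:- C) ≡.refl (+ suc c) (+ suc l))

negGI : GI → GI
negGI (x , y) = (ℤ.- x , ℤ.- y)

infixl 6 _-GI_
_-GI_ : GI → GI → GI
(x , y) -GI (x' , y') = (x ℤ.- x' , y ℤ.- y')

normGI : GI → ℤ
normGI (x , y) = x ℤ.* x ℤ.+ y ℤ.* y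

private
  sq-nonneg : ∀ x → ∃ λ k → x ℤ.* x ≡ + k × (k ≡ 0 → x ≡ + 0)
  sq-nonneg (+ k) = k ℕ.* k , ≡.sym (ℤP.pos-* k k) , λ e → ≡.cong +_ ([ (λ e → e) , (λ e → e) ]′ (ℕP.m*n≡0⇒m≡0∨n≡0 k e))
  sq-nonneg -[1+ k ] = suc k ℕ.* suc k , ≡.refl , λ ()

norm≡0⇒≡0 : ∀ g → normGI g ≡ + 0 → g ≡ 0GI
norm≡0⇒≡0 (x , y) e with sq-nonneg x | sq-nonneg y
... | k , p , f | l , q , g = ≡.cong₂ _,_ (f (ℕP.m+n≡0⇒m≡0 k k+l≡0)) (g (ℕP.m+n≡0⇒n≡0 k k+l≡0))
  where
  k+l≡0 : k ℕ.+ l ≡ 0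
  k+l≡0 = ℤP.+-injective (≡.trans (≡.sym (≡.cong₂ ℤ._+_ p q)) e)

1≤norm : ∀ g → g ≢ 0GI → + 1 ℤ.≤ normGI g
1≤norm g@(x , y) h with sq-nonneg x | sq-nonneg y
... | k , p , _ | l , q , _ = positive (k ℕ.+ l) (≡.cong₂ ℤ._+_ p q)
  where
  positive : ∀ j → normGI g ≡ + j → + 1 ℤ.≤ normGI g
  positive zero e = ⊥-elim (h (norm≡0⇒≡0 g e))
  positive (suc j) e = ≡.subst (+ 1 ℤ.≤_) (≡.sym e) (ℤ.+≤+ (ℕ.s≤s ℕ.z≤n))

-- The default value at 0 makes `ginv` and `point` total functions of Gaussian integers, so that
-- points can be compared without proofs of a ≠ 0 inside them.
recip : ℚ → ℚ
recip q with q ℚP.≟ 0ℚ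
... | yes _ = 0ℚ
... | no q≢0 = ℚ.1/_ q {{ℚ.≢-nonZero q≢0}}

recip-inverse : ∀ q → q ≢ 0ℚ → q ℚ.* recip q ≡ 1ℚ
recip-inverse q q≢0 with q ℚP.≟ 0ℚ
... | yes e = ⊥-elim (q≢0 e)
... | no h = ℚP.*-inverseʳ q {{ℚ.≢-nonZero h}}

abstract
  ginv : GI → GQ
  ginv (x , y) = let c = recip (ι (normGI (x , y))) in (ι x ℚ.* c , (ℚ.- ι y) ℚ.* c)

-- Arithmetic of the numbers (β + √D) / a

module FractionIdentities (E : ℚAlgebra) where
  open ℚAlgebra E

  product : ∀ a c β A C → a * A ≈ 1# → c * C ≈ 1# →
            (β * A) * ((- β) * C) + A * C * (β * β + a * c) ≈ 1#
  product a c β A C p q = trans (solve 5 (λ a c β A C →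
      (β :* A) :* ((:- β) :* C) :+ A :* C :* (β :* β :+ a :* c) := (a :* A) :* (c :* C)) a c β A C)
    (trans (*-cong p q) (*-identityˡ 1#))

  cross : ∀ β A C → (β * A) * C + A * ((- β) * C) ≈ 0#
  cross β A C = trans (solve 3 (λ β A C → (β :* A) :* C :+ A :* ((:- β) :* C) := con (+ 0)) β A C) κ-0

  shift : ∀ c β w C → c * C ≈ 1# → (β + c * w) * C ≈ β * C + w
  shift c β w C p = trans (solve 4 (λ c β w C → (β :+ c :* w) :* C := β :* C :+ w :* (c :* C)) c β w C)
    (+-congˡ (trans (*-congˡ p) (*-identityʳ w)))

ℚi : ℚAlgebra
ℚi = Quadratic.quadratic ℚ-algebra (ℚA.κ -[1+ 0 ])

private
  module G = ℚAlgebra ℚi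
  module Frac = FractionIdentities ℚi

≋⇒≡ : ∀ {x y : GQ} → x G.≈ y → x ≡ y
≋⇒≡ (p , q) = ≡.cong₂ _,_ p q

≡⇒≋ : ∀ {x y : GQ} → x ≡ y → x G.≈ y
≡⇒≋ ≡.refl = ≡.refl , ≡.refl

*G≡* : ∀ x y → x *G y ≡ x G.* y
*G≡* (x , y) (x' , y') = ≡.cong (_, x ℚ.* y' ℚ.+ y ℚ.* x') (≡.cong (λ z → x ℚ.* x' ℚ.+ z)
  (≡.trans (≡.cong ℚ.-_ (≡.sym (ℚP.*-identityˡ (y ℚ.* y')))) (≡.trans (ℚP.neg-distribˡ-* 1ℚ (y ℚ.* y'))
    (≡.cong (ℚ._* (y ℚ.* y')) (≡.sym (ℚA.κ≈φι -[1+ 0 ]))))))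

ι-neg : ∀ x → ι (ℤ.- x) ≡ ℚ.- ι x
ι-neg x = ≡.trans (≡.sym (ℚA.κ≈φι (ℤ.- x))) (≡.trans (ℚA.κ-neg x) (≡.cong ℚ.-_ (ℚA.κ≈φι x)))

ιG-+ : ∀ g h → ιG (g +GI h) ≡ ιG g G.+ ιG h
ιG-+ (x , y) (x' , y') = ≡.cong₂ _,_ (ι-+ x x') (ι-+ y y')

ιG-neg : ∀ g → ιG (negGI g) ≡ G.- ιG g
ιG-neg (x , y) = ≡.cong₂ _,_ (ι-neg x) (ι-neg y)

ιG-* : ∀ g h → ιG (g *GI h) ≡ ιG g G.* ιG h
ιG-* (x , y) (x' , y') = ≡.trans (≡.cong₂ _,_
    (≡.trans (ι-+ (x ℤ.* x') (ℤ.- (y ℤ.* y'))) (≡.cong₂ ℚ._+_ (ι-* x x')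
      (≡.trans (ι-neg (y ℤ.* y')) (≡.cong ℚ.-_ (ι-* y y')))))
    (≡.trans (ι-+ (x ℤ.* y') (y ℤ.* x')) (≡.cong₂ ℚ._+_ (ι-* x y') (ι-* y x'))))
  (*G≡* (ιG (x , y)) (ιG (x' , y')))

ι≡0 : ∀ {z} → ι z ≡ 0ℚ → z ≡ + 0
ι≡0 {z} e = ι-injective {z} {+ 0} e

abstract
  ginv-inverse : ∀ a → a ≢ 0GI → ιG a G.* ginv a ≡ 1G
  ginv-inverse (x , y) h = ≡.trans (≡.sym (*G≡* (ιG (x , y)) (ginv (x , y)))) (≡.cong₂ _,_
    (≡.trans (ℚA.solve 3 (λ x y c → x ℚA.:* (x ℚA.:* c) ℚA.:- y ℚA.:* ((ℚA.:- y) ℚA.:* c) ℚA.:=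
      (x ℚA.:* x ℚA.:+ y ℚA.:* y) ℚA.:* c) (ι x) (ι y) c)
      (≡.trans (≡.cong (ℚ._* c) (≡.sym (≡.trans (ι-+ (x ℤ.* x) (y ℤ.* y)) (≡.cong₂ ℚ._+_ (ι-* x x) (ι-* y y)))))
        (recip-inverse (ι (normGI (x , y))) (λ e → h (norm≡0⇒≡0 (x , y) (ι≡0 e))))))
    (≡.trans (ℚA.solve 3 (λ x y c → x ℚA.:* ((ℚA.:- y) ℚA.:* c) ℚA.:+ y ℚA.:* (x ℚA.:* c) ℚA.:= ℚA.con (+ 0)) (ι x)
      (ι y) c) (ℚA.κ≈φι (+ 0))))
    where
    c : ℚ
    c = recip (ι (normGI (x , y)))

-- (β + √D) / a
point : GI → GI → K
point a β = (ιG β G.* ginv a , ginv a)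

module QuadraticField (m n : ℤ) where
  D : GI
  D = (m , n)

  mulK≡ : ∀ a b c d → mulK m n (a , b) (c , d) ≡ (a G.* c G.+ b G.* d G.* ιG D , a G.* d G.+ b G.* c)
  mulK≡ a b c d = ≡.cong₂ _,_
    (≡.cong₂ _+G_ (*G≡* a c) (≡.trans (≡.cong (_*G ιG D) (*G≡* b d)) (*G≡* (b G.* d) (ιG D))))
    (≡.cong₂ _+G_ (*G≡* a d) (*G≡* b c))

  -- Since (√D + β)(√D - β) = D - β² = a c, the reciprocal of (β + √D)/a is (-β + √D)/c: inversion
  -- exchanges a and c and negates β.
  point-mul : ∀ a β c → a ≢ 0GI → c ≢ 0GI → (β *GI β) +GI (a *GI c) ≡ D →
              mulK m n (point a β) (point c (negGI β)) ≡ 1K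
  point-mul a β c a≢0 c≢0 e = ≡.trans (mulK≡ (ιG β G.* ginv a) (ginv a) (ιG (negGI β) G.* ginv c) (ginv c)) (≡.cong₂ _,_
    (≡.trans (≡.cong₂ (λ u v → (ιG β G.* ginv a) G.* (u G.* ginv c) G.+ ginv a G.* ginv c G.* v) (ιG-neg β)
        (≡.trans (≡.cong ιG (≡.sym e)) (≡.trans (ιG-+ (β *GI β) (a *GI c)) (≡.cong₂ G._+_ (ιG-* β β) (ιG-* a c)))))
      (≋⇒≡ (Frac.product (ιG a) (ιG c) (ιG β) (ginv a) (ginv c) (≡⇒≋ (ginv-inverse a a≢0)) (≡⇒≋ (ginv-inverse c c≢0)))))
    (≡.trans (≡.cong (λ u → (ιG β G.* ginv a) G.* ginv c G.+ ginv a G.* (u G.* ginv c)) (ιG-neg β))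
      (≋⇒≡ (Frac.cross (ιG β) (ginv a) (ginv c)))))

  point-shift : ∀ c β w → c ≢ 0GI → point c (β +GI (c *GI w)) ≡ point c β +K embedGI w
  point-shift c β w c≢0 = ≡.cong₂ _,_
    (≡.trans (≡.cong (G._* ginv c) (≡.trans (ιG-+ β (c *GI w)) (≡.cong (λ z → ιG β G.+ z) (ιG-* c w))))
      (≋⇒≡ (Frac.shift (ιG c) (ιG β) (ιG w) (ginv c) (≡⇒≋ (ginv-inverse c c≢0)))))
    (≋⇒≡ (G.sym (G.+-identityʳ (ginv c))))

-- Comparison with rationals and Dedekind cuts

module OrderedTheory (F : OrderedℚAlgebra) where
  open OrderedℚAlgebra F
  open import Relation.Binary.Reasoning.Setoid setoid

  -- If φ b - φ a were ≤ 0, multiplying by the image of 1/(b - a) would make -1 nonnegative.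
  <⇒PP : ∀ {a b} → a ℚ.< b → PP (φ b - φ a)
  <⇒PP {a} {b} a<b n = PP-1 (NN-resp eq (NN-* n (φ-NN (ℚP.<⇒≤ (ℚP.positive⁻¹ (ℚ.1/ c) {{ℚP.1/pos⇒pos c}})))))
    where
    c = b ℚ.- a
    instance
      c>0 : ℚ.Positive c
      c>0 = ℚ.positive (≡.subst (ℚ._< c) (ℚP.+-inverseʳ a) (ℚP.+-monoˡ-< (ℚ.- a) a<b))
      c≢0 : ℚ.NonZero c
      c≢0 = ℚP.pos⇒nonZero c
    eq : - (φ b - φ a) * φ (ℚ.1/ c) ≈ - 1#
    eq = begin
      - (φ b - φ a) * φ (ℚ.1/ c)   ≈⟨ *-congʳ (-‿cong (φ-- b a)) ⟨
      - φ c * φ (ℚ.1/ c)           ≈⟨ solve 2 (λ x y → (:- x) :* y := :- (x :* y)) (φ c) (φ (ℚ.1/ c)) ⟩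
      - (φ c * φ (ℚ.1/ c))         ≈⟨ -‿cong (φ-* c (ℚ.1/ c)) ⟨
      - φ (c ℚ.* ℚ.1/ c)           ≡⟨ ≡.cong (λ z → - φ z) (ℚP.*-inverseʳ c) ⟩
      - φ 1ℚ                       ≈⟨ -‿cong φ-1 ⟩
      - 1# ∎

  ≤⇒NN : ∀ {a b} → a ℚ.≤ b → NN (φ b - φ a)
  ≤⇒NN {a} {b} a≤b = NN-resp (φ-- b a) (φ-NN (≡.subst (ℚ._≤ b ℚ.- a) (ℚP.+-inverseʳ a) (ℚP.+-monoˡ-≤ (ℚ.- a) a≤b)))

  PP⇒< : ∀ {a b} → PP (φ b - φ a) → a ℚ.< b
  PP⇒< {a} {b} h = ℚP.≰⇒> (λ b≤a → h (NN-resp (solve 2 (λ x y → x :- y := :- (y :- x)) (φ a) (φ b)) (≤⇒NN b≤a)))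

  NN⇒≤ : ∀ {a b} → NN (φ b - φ a) → a ℚ.≤ b
  NN⇒≤ {a} {b} h = ℚP.≮⇒≥ (λ b<a → PP⇒¬NN- (solve 2 (λ x y → x :- y := :- (y :- x)) (φ a) (φ b)) (<⇒PP b<a) h)

  0<⇒PP : ∀ {a} → 0ℚ ℚ.< a → PP (φ a)
  0<⇒PP {a} l = PP-resp (trans (+-congˡ (-‿cong (trans φ-0 (sym κ-0)))) (solve 1 (λ x → x :- con (+ 0) := x) (φ a)))
      (<⇒PP l)

  PP⇒0< : ∀ {a} → PP (φ a) → 0ℚ ℚ.< a
  PP⇒0< {a} h = PP⇒< (PP-resp (sym (trans (+-congˡ (-‿cong (trans φ-0 (sym κ-0))))
      (solve 1 (λ x → x :- con (+ 0) := x) (φ a)))) h)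

  <0⇒PP : ∀ {a} → a ℚ.< 0ℚ → PP (- φ a)
  <0⇒PP {a} l = PP-resp (trans (+-congʳ φ-0) (+-identityˡ _)) (<⇒PP l)

  κ-NN⇒≤ : ∀ {a b} → NN (κ b - κ a) → a ℤ.≤ b
  κ-NN⇒≤ h = ι-cancel-≤ (NN⇒≤ (NN-resp (+-cong (κ≈φι _) (-‿cong (κ≈φι _))) h))

  κ-≤ : ∀ {a b} → a ℤ.≤ b → NN (κ b - κ a)
  κ-≤ l = NN-resp (sym (+-cong (κ≈φι _) (-‿cong (κ≈φι _)))) (≤⇒NN (ι-mono-≤ l))

  φ-injective : ∀ {a b} → φ a ≈ φ b → a ≡ b
  φ-injective {a} {b} e = ℚP.≤-antisym (NN⇒≤ (NN-resp (sym (trans (+-congʳ (sym e)) (-‿inverseʳ _))) NN-0))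
                                       (NN⇒≤ (NN-resp (sym (trans (+-congʳ e) (-‿inverseʳ _))) NN-0))

  -- The Dedekind cuts of Defs describe the real number s ≥ 0 with 2 s² = r + c, where h a = 2 a² − c.
  module Cut (S : ℚ) (s r c : Carrier) (s≥0 : NN s) (r≥0 : NN r)
             (r² : r * r ≈ φ S) (2s² : κ (+ 2) * (s * s) ≈ r + c)
             (h : ℚ → ℚ) (φ-h : ∀ a → φ (h a) ≈ κ (+ 2) * (φ a * φ a) - c) where

    Lower Upper : ℚ → Set
    Lower a = a ℚ.< 0ℚ ⊎ (h a ℚ.< 0ℚ ⊎ h a ℚ.* h a ℚ.< S)
    Upper a = 0ℚ ℚ.< a × 0ℚ ℚ.< h a × S ℚ.< h a ℚ.* h a

    -- The cut conditions rest on two factorisations, this one and `h²-S`: the sign of a - s passes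
    -- to h a - r, and from there to (h a)² - S, as long as the cofactors a + s and h a + r are
    -- positive.
    h-r : ∀ a → κ (+ 2) * ((φ a - s) * (φ a + s)) ≈ φ (h a) - r
    h-r a = begin
      κ (+ 2) * ((φ a - s) * (φ a + s))
        ≈⟨ solve 2 (λ a s → con (+ 2) :* ((a :- s) :* (a :+ s)) := con (+ 2) :* (a :* a) :- con (+ 2) :* (s :* s))
          (φ a) s ⟩
      κ (+ 2) * (φ a * φ a) - κ (+ 2) * (s * s)
        ≈⟨ +-congˡ (-‿cong 2s²) ⟩
      κ (+ 2) * (φ a * φ a) - (r + c)
        ≈⟨ solve 3 (λ x r c → x :- (r :+ c) := (x :- c) :- r) _ r c ⟩
      (κ (+ 2) * (φ a * φ a) - c) - r
        ≈⟨ +-congʳ (φ-h a) ⟨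
      φ (h a) - r ∎

    h²-S : ∀ a → (φ (h a) - r) * (φ (h a) + r) ≈ φ (h a ℚ.* h a) - φ S
    h²-S a = begin
      (φ (h a) - r) * (φ (h a) + r)  ≈⟨ solve 2 (λ x r → (x :- r) :* (x :+ r) := x :* x :- r :* r) (φ (h a)) r ⟩
      φ (h a) * φ (h a) - r * r      ≈⟨ +-cong (sym (φ-* (h a) (h a))) (-‿cong r²) ⟩
      φ (h a ℚ.* h a) - φ S ∎

    private
      neg-flip : ∀ x y → - (x - y) ≈ y - x
      neg-flip = solve 2 (λ x y → :- (x :- y) := y :- x)
      NN-h-r : ∀ {a} → NN (φ a - s) → NN (φ (h a) - r)
      NN-h-r {a} n = NN-resp (h-r a) (NN-* (NN-κ 2) (NN-* n
          (NN-resp (solve 2 (λ a s → (a :- s) :+ (s :+ s) := a :+ s) (φ a) s) (NN-+ n (NN-+ s≥0 s≥0)))))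
      NN-h : ∀ {a} → NN (φ a - s) → NN (φ (h a))
      NN-h {a} n = NN-resp (solve 2 (λ a s → (a :- s) :+ s := a) (φ (h a)) r) (NN-+ (NN-h-r n) r≥0)

    lower-sound : ∀ {a} → Lower a → PP (s - φ a)
    lower-sound (inj₁ a<0) = PP-+ʳ s≥0 (<0⇒PP a<0)
    lower-sound {a} (inj₂ (inj₁ h<0)) n = PP⇒¬NN- refl (<0⇒PP h<0) (NN-h (NN-resp (neg-flip s (φ a)) n))
    lower-sound {a} (inj₂ (inj₂ l)) n = PP⇒¬NN- (sym (neg-flip _ _)) (<⇒PP l)
      (NN-resp (h²-S a) (NN-* (NN-h-r n′) (NN-+ (NN-h n′) r≥0)))
      where n′ = NN-resp (neg-flip s (φ a)) n

    upper-sound : ∀ {a} → Upper a → PP (φ a - s)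
    upper-sound {a} (0<a , 0<h , l) n = PP⇒¬NN- (sym (neg-flip _ _)) (<⇒PP l) (NN-resp
      (trans (solve 2 (λ x r → (:- (x :- r)) :* (x :+ r) := :- ((x :- r) :* (x :+ r))) (φ (h a)) r)
        (trans (-‿cong (h²-S a)) (neg-flip _ _)))
      (NN-* r≥h (NN-+ (PP⇒NN (0<⇒PP 0<h)) r≥0)))
      where
      r≥h : NN (- (φ (h a) - r))
      r≥h = NN-resp (trans (solve 2 (λ a s → con (+ 2) :* ((:- (a :- s)) :* (a :+ s)) := :-
          (con (+ 2) :* ((a :- s) :* (a :+ s)))) (φ a) s) (-‿cong (h-r a)))
        (NN-* (NN-κ 2) (NN-* n (NN-+ (PP⇒NN (0<⇒PP 0<a)) s≥0)))

    lower-complete : ∀ {a} → PP (s - φ a) → Lower a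
    lower-complete {a} q with a ℚP.<? 0ℚ
    ... | yes l = inj₁ l
    ... | no ¬l with h a ℚP.<? 0ℚ
    ...   | yes l = inj₂ (inj₁ l)
    ...   | no ¬l′ = inj₂ (inj₂ (PP⇒< (PP-resp
        (trans (solve 2 (λ x r → (r :- x) :* (x :+ r) := :- ((x :- r) :* (x :+ r))) (φ (h a)) r)
          (trans (-‿cong (h²-S a)) (neg-flip _ _)))
        (PP-* r>h (PP-resp (solve 2 (λ x r → (r :- x) :+ (x :+ x) := x :+ r) (φ (h a)) r)
          (PP-+ˡ r>h (NN-+ h≥0 h≥0)))))))
      where
      a≥0 = φ-NN (ℚP.≮⇒≥ ¬l)
      h≥0 = φ-NN (ℚP.≮⇒≥ ¬l′)
      r>h : PP (r - φ (h a))
      r>h = PP-resp (trans (solve 2 (λ a s → con (+ 2) :* ((s :- a) :* (a :+ s)) := :-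
          (con (+ 2) :* ((a :- s) :* (a :+ s)))) (φ a) s)
                      (trans (-‿cong (h-r a)) (neg-flip _ _)))
        (PP-* (PP-κ 1) (PP-* q (PP-resp (solve 2 (λ a s → (s :- a) :+ (a :+ a) := a :+ s) (φ a) s)
          (PP-+ˡ q (NN-+ a≥0 a≥0)))))

    upper-complete : ∀ {a} → PP (φ a - s) → Upper a
    upper-complete {a} q = PP⇒0< (PP-resp (solve 2 (λ a s → (a :- s) :+ s := a) (φ a) s) (PP-+ˡ q s≥0))
                         , PP⇒0< (PP-resp (solve 2 (λ a s → (a :- s) :+ s := a) (φ (h a)) r) (PP-+ˡ h>r r≥0))
                         , PP⇒< (PP-resp (h²-S a) (PP-* h>r
                           (PP-resp (solve 2 (λ x r → (x :- r) :+ (r :+ r) := x :+ r) (φ (h a)) r)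
                           (PP-+ˡ h>r (NN-+ r≥0 r≥0)))))
      where
      h>r : PP (φ (h a) - r)
      h>r = PP-resp (h-r a) (PP-* (PP-κ 1) (PP-* q (PP-resp
          (solve 2 (λ a s → (a :- s) :+ (s :+ s) := a :+ s) (φ a) s) (PP-+ˡ q (NN-+ s≥0 s≥0)))))

    -- The tolerance is 2ε and not ε because the bounds are the grid points (k - 1)ε and (k + 1)ε
    -- around kε ≤ s < (k + 1)ε: the lower one must lie strictly below s even if s = kε.
    Near : ℚ → Set
    Near ε = ∃ λ a → ∃ λ b → Lower a × Upper b
             × NN (φ ε + φ ε + (φ a - s)) × NN (φ ε + φ ε - (φ b - s))

    private
      near-grid : ∀ ε a b k → φ b ≈ (κ (+ 1) + k) * φ ε → φ a ≈ (κ (+ 1) + k) * φ ε - (φ ε + φ ε) →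
                  PP (φ ε) → PP ((κ (+ 1) + k) * φ ε - s) → NN (s - k * φ ε) → Near ε
      near-grid ε a b k φb φa ε>0 q n = a , b , lower-complete s>a , upper-complete b>s , near-a , near-b
        where
        s>a : PP (s - φ a)
        s>a = PP-resp (trans (solve 3 (λ s k e → (s :- k :* e) :+ e := s :- ((con (+ 1) :+ k) :* e :- (e :+ e))) s k
            (φ ε)) (+-congˡ (-‿cong (sym φa)))) (PP-+ʳ n ε>0)
        b>s : PP (φ b - s)
        b>s = PP-resp (+-congʳ (sym φb)) q
        near-a : NN (φ ε + φ ε + (φ a - s))
        near-a = NN-resp (trans (solve 3 (λ s k e → (con (+ 1) :+ k) :* e :- s := (e :+ e) :+
            (((con (+ 1) :+ k) :* e :- (e :+ e)) :- s)) s k (φ ε)) (+-congˡ (+-congʳ (sym φa)))) (PP⇒NN q)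
        near-b : NN (φ ε + φ ε - (φ b - s))
        near-b = NN-resp (trans (solve 3 (λ s k e → (s :- k :* e) :+ e := (e :+ e) :- ((con (+ 1) :+ k) :* e :- s)) s
            k (φ ε)) (+-congˡ (-‿cong (+-congʳ (sym φb))))) (NN-+ n (PP⇒NN ε>0))

      κ-suc : ∀ k → κ (+ suc k) ≈ κ (+ 1) + κ (+ k)
      κ-suc k = κ-+ (+ 1) (+ k)

      search : ∀ ε → PP (φ ε) → ∀ k → PP (κ (+ k) * φ ε - s) → Near ε
      search ε ε>0 zero q = ⊥-elim (q (NN-resp (solve 2 (λ e s → s := :- (con (+ 0) :* e :- s)) (φ ε) s) s≥0))
      search ε ε>0 (suc k) q with NN⊎PP (s - κ (+ k) * φ ε)
      ... | inj₂ q′ = search ε ε>0 k (PP-resp (neg-flip s (κ (+ k) * φ ε)) q′)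
      ... | inj₁ n = near-grid ε (b ℚ.- (ε ℚ.+ ε)) b (κ (+ k)) φb
          (trans (φ-- b (ε ℚ.+ ε)) (+-cong φb (-‿cong (φ-+ ε ε)))) ε>0
          (PP-resp (+-congʳ (*-congʳ (κ-suc k))) q) n
        where
        b : ℚ
        b = ι (+ suc k) ℚ.* ε
        φb : φ b ≈ (κ (+ 1) + κ (+ k)) * φ ε
        φb = trans (φ-* (ι (+ suc k)) ε) (*-congʳ (trans (sym (κ≈φι (+ suc k))) (κ-suc k)))

    near : ∀ ε → 0ℚ ℚ.< ε → Near ε
    near ε 0<ε = let k , hk = arch (φ ε) s (0<⇒PP 0<ε) in search ε (0<⇒PP 0<ε) (suc k) (PP-resp
          (trans (solve 3 (λ k e s → (k :* e :- s) :+ e := (con (+ 1) :+ k) :* e :- s) (κ (+ k)) (φ ε) s)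
            (+-congʳ (*-congʳ (sym (κ-suc k)))))
          (PP-+ʳ hk (0<⇒PP 0<ε)))

  -- Rounding, and the regions containing x and Y

  Within : Carrier → Set
  Within x = NN (κ (+ 1) + x) × NN (κ (+ 1) - x)

  Within-resp : ∀ {x y} → x ≈ y → Within x → Within y
  Within-resp e (m , n) = NN-resp (+-congˡ e) m , NN-resp (+-congˡ (-‿cong e)) n

  -- U is s / 2 rounded to a nearest integer, halves towards zero: the boundary convention of the sets Q_w.
  record Rounds (U : ℤ) (s : Carrier) : Set where
    field
      within : Within (s - κ (+ 2) * κ U)
      above  : + 1 ℤ.≤ U → PP (κ (+ 1) + (s - κ (+ 2) * κ U))
      below  : U ℤ.≤ -[1+ 0 ] → PP (κ (+ 1) - (s - κ (+ 2) * κ U))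

  Rounds-neg : ∀ {U s} → Rounds U s → Rounds (ℤ.- U) (- s)
  Rounds-neg {U} {s} R = record
    { within = NN-resp (sym eq₁) (proj₂ R.within) , NN-resp (sym eq₂) (proj₁ R.within)
    ; above = λ h → PP-resp (sym eq₁) (R.below (≡.subst (ℤ._≤ -[1+ 0 ]) (ℤP.neg-involutive U) (ℤP.neg-mono-≤ h)))
    ; below = λ h → PP-resp (sym eq₂) (R.above (≡.subst (+ 1 ℤ.≤_) (ℤP.neg-involutive U) (ℤP.neg-mono-≤ h)))
    }
    where
    module R = Rounds R
    eq₁ : κ (+ 1) + (- s - κ (+ 2) * κ (ℤ.- U)) ≈ κ (+ 1) - (s - κ (+ 2) * κ U)
    eq₁ = trans (+-congˡ (+-congˡ (-‿cong (*-congˡ (κ-neg U)))))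
        (solve 2 (λ s u → con (+ 1) :+ (:- s :- con (+ 2) :* (:- u)) := con (+ 1) :- (s :- con (+ 2) :* u)) s (κ U))
    eq₂ : κ (+ 1) - (- s - κ (+ 2) * κ (ℤ.- U)) ≈ κ (+ 1) + (s - κ (+ 2) * κ U)
    eq₂ = trans (+-congˡ (-‿cong (+-congˡ (-‿cong (*-congˡ (κ-neg U))))))
        (solve 2 (λ s u → con (+ 1) :- (:- s :- con (+ 2) :* (:- u)) := con (+ 1) :+ (s :- con (+ 2) :* u)) s (κ U))

  -- The search descends from an archimedean bound to the least k with s - 2k ≤ 1. Its failure at
  -- the predecessor is exactly the strict inequality `above`, so a half is rounded towards zero.
  round⁺ : ∀ s → NN s → ∃ λ k → Rounds (+ k) s
  round⁺ s s≥0 = let k , h = arch (κ (+ 1)) s (PP-κ 0) in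
    search k (NN-resp (solve 2 (λ k s → (k :* con (+ 1) :- s) :+ (k :+ con (+ 1)) := con (+ 1) :-
        (s :- con (+ 2) :* k)) (κ (+ k)) s)
      (NN-+ h (NN-+ (NN-κ k) (NN-κ 1))))
    where
    search : ∀ k → NN (κ (+ 1) - (s - κ (+ 2) * κ (+ k))) → ∃ λ k → Rounds (+ k) s
    search zero n = 0 , record
      { within = NN-resp (solve 1 (λ s → con (+ 1) :+ s := con (+ 1) :+ (s :- con (+ 2) :* con (+ 0))) s)
          (NN-+ (NN-κ 1) s≥0) , n
      ; above = λ { (ℤ.+≤+ ()) } ; below = λ () }
    search (suc k) n with NN⊎PP (κ (+ 1) - (s - κ (+ 2) * κ (+ k)))
    ... | inj₁ n′ = search k n′
    ... | inj₂ q = suc k , record { within = PP⇒NN q′ , n ; above = λ _ → q′ ; below = λ () }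
      where
      q′ : PP (κ (+ 1) + (s - κ (+ 2) * κ (+ suc k)))
      q′ = PP-resp (sym (trans (+-congˡ (+-congˡ (-‿cong (*-congˡ (κ-+ (+ 1) (+ k))))))
             (solve 2 (λ k s → con (+ 1) :+ (s :- con (+ 2) :* (con (+ 1) :+ k)) := :-
               (con (+ 1) :- (s :- con (+ 2) :* k))) (κ (+ k)) s))) q

  Rounds-resp : ∀ {U s s'} → s ≈ s' → Rounds U s → Rounds U s'
  Rounds-resp e R = record
    { within = Within-resp (+-congʳ e) (Rounds.within R)
    ; above = λ h → PP-resp (+-congˡ (+-congʳ e)) (Rounds.above R h)
    ; below = λ h → PP-resp (+-congˡ (-‿cong (+-congʳ e))) (Rounds.below R h) }

  round : ∀ s → ∃ λ U → Rounds U s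
  round s with NN-total s
  ... | inj₁ n = let k , R = round⁺ s n in + k , R
  ... | inj₂ n = let k , R = round⁺ (- s) n in ℤ.- + k , Rounds-resp (solve 1 (λ s → :- (:- s) := s) s) (Rounds-neg R)

  -- A complex number is given by s = Re + Im and t = Re − Im; then s² + t² = 2 |·|².
  sq : Carrier → Carrier → Carrier
  sq s t = s * s + t * t

  sq≥0 : ∀ s t → NN (sq s t)
  sq≥0 s t = NN-+ (NN-sq s) (NN-sq t)

  sq-cong : ∀ {s s' t t'} → s ≈ s' → t ≈ t' → sq s t ≈ sq s' t'
  sq-cong p q = +-cong (*-cong p p) (*-cong q q)

  contradict : ∀ {x} → PP x → x ≈ κ (+ 0) → ⊥
  contradict p e = p (NN-resp (trans (solve 0 (con (+ 0) := :- con (+ 0))) (-‿cong (sym e))) (NN-κ 0))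

  PP⇒¬NN : ∀ {x y} → PP (x - y) → NN (y - x) → ⊥
  PP⇒¬NN {x} {y} p n = contradict (PP-+ˡ p n) (solve 2 (λ x y → (x :- y) :+ (y :- x) := con (+ 0)) x y)

  Within-sq : ∀ {s t} → Within s → Within t → NN (κ (+ 2) - sq s t)
  Within-sq {s} {t} (a , b) (c , d) = NN-resp
    (solve 2 (λ s t → (con (+ 1) :+ s) :* (con (+ 1) :- s) :+ (con (+ 1) :+ t) :* (con (+ 1) :- t) := con (+ 2) :-
      (s :* s :+ t :* t)) s t)
    (NN-+ (NN-* a b) (NN-* c d))

  data Small : ℤ → ℤ → Set where
    origin : Small (+ 0) (+ 0)
    east   : Small (+ 1) (+ 0)
    west   : Small -[1+ 0 ] (+ 0)
    north  : Small (+ 0) (+ 1)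
    south  : Small (+ 0) -[1+ 0 ]

  -- For W = a (1 + i) + b (1 - i) this is |W| ≥ 2, so translation by W moves no point of the closed
  -- unit disc into the open one. Only the five vectors of `Small` need further information.
  Far : ℤ → ℤ → Set
  Far a b = NN (sq (κ a) (κ b) - κ (+ 2))

  private
    κ-∣∣² : ∀ a → κ a * κ a ≈ κ (+ (ℤ.∣ a ∣ ℕ.* ℤ.∣ a ∣))
    κ-∣∣² (+ k) = sym (κ-pos-* k k)
    κ-∣∣² -[1+ k ] = trans (*-cong (κ-neg (+ suc k)) (κ-neg (+ suc k)))
        (trans (solve 1 (λ a → (:- a) :* (:- a) := a :* a) (κ (+ suc k))) (sym (κ-pos-* (suc k) (suc k))))

    far : ∀ a b → 2 ℕ.≤ ℤ.∣ a ∣ ℕ.* ℤ.∣ a ∣ ℕ.+ ℤ.∣ b ∣ ℕ.* ℤ.∣ b ∣ → Far a b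
    far a b h = NN-resp (+-congʳ (trans (κ-+ (+ (ℤ.∣ a ∣ ℕ.* ℤ.∣ a ∣)) (+ (ℤ.∣ b ∣ ℕ.* ℤ.∣ b ∣)))
        (sym (+-cong (κ-∣∣² a) (κ-∣∣² b)))))
      (κ-≤ {+ 2} {+ (ℤ.∣ a ∣ ℕ.* ℤ.∣ a ∣ ℕ.+ ℤ.∣ b ∣ ℕ.* ℤ.∣ b ∣)} (ℤ.+≤+ h))

    large-first : ∀ k b → 2 ℕ.≤ suc (suc k) ℕ.* suc (suc k) ℕ.+ b
    large-first k b = ℕ.s≤s (ℕ.s≤s ℕ.z≤n)

    large-second : ∀ a k → 2 ℕ.≤ a ℕ.+ suc (suc k) ℕ.* suc (suc k)
    large-second a k = ℕP.≤-trans (ℕ.s≤s (ℕ.s≤s ℕ.z≤n)) (ℕP.m≤n+m _ a)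

  classify : ∀ a b → Far a b ⊎ Small a b
  classify a@(+ suc (suc k)) b = inj₁ (far a b (large-first k _))
  classify a@(-[1+ suc k ]) b = inj₁ (far a b (large-first k _))
  classify a b@(+ suc (suc k)) = inj₁ (far a b (large-second (ℤ.∣ a ∣ ℕ.* ℤ.∣ a ∣) k))
  classify a b@(-[1+ suc k ]) = inj₁ (far a b (large-second (ℤ.∣ a ∣ ℕ.* ℤ.∣ a ∣) k))
  classify (+ 0) (+ 0) = inj₂ origin
  classify (+ 1) (+ 0) = inj₂ east
  classify -[1+ 0 ] (+ 0) = inj₂ west
  classify (+ 0) (+ 1) = inj₂ north
  classify (+ 0) -[1+ 0 ] = inj₂ south
  classify (+ 1) (+ 1) = inj₁ (far (+ 1) (+ 1) ℕP.≤-refl)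
  classify (+ 1) -[1+ 0 ] = inj₁ (far (+ 1) -[1+ 0 ] ℕP.≤-refl)
  classify -[1+ 0 ] (+ 1) = inj₁ (far -[1+ 0 ] (+ 1) ℕP.≤-refl)
  classify -[1+ 0 ] -[1+ 0 ] = inj₁ (far -[1+ 0 ] -[1+ 0 ] ℕP.≤-refl)

  -- This is 2 (|P + W|² - 1) with W = a (1 + i) + b (1 - i); being nonnegative puts P outside the
  -- open unit disc about -W.
  shifted : ℤ → ℤ → Carrier → Carrier → Carrier
  shifted a b s t = sq (s + κ (+ 2) * κ a) (t + κ (+ 2) * κ b) - κ (+ 2)

  -- The parallelogram law: |W|² ≤ 2 |P + W|² + 2 |P|².
  far-shift : ∀ a b s t → Far a b → NN (κ (+ 2) - sq s t) → NN (shifted a b s t)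
  far-shift a b s t f h = NN-cancel (PP-κ 1) (NN-resp
    (solve 4 (λ a b s t →
       con (+ 2) :* (con (+ 2) :- (s :* s :+ t :* t))
       :+ (con (+ 4) :* ((a :* a :+ b :* b) :- con (+ 2))
       :+ ((con (+ 2) :* s :+ con (+ 2) :* a) :* (con (+ 2) :* s :+ con (+ 2) :* a) :+
           (con (+ 2) :* t :+ con (+ 2) :* b) :* (con (+ 2) :* t :+ con (+ 2) :* b)))
       := con (+ 2) :* (((s :+ con (+ 2) :* a) :* (s :+ con (+ 2) :* a) :+ (t :+ con (+ 2) :* b) :*
         (t :+ con (+ 2) :* b)) :- con (+ 2))) (κ a) (κ b) s t)
    (NN-+ (NN-* (NN-κ 2) h) (NN-+ (NN-* (NN-κ 4) f) (sq≥0 _ _))))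

  -- What the history of an orbit forces on y = 1 / Y when U (1 + i) + V (1 − i) is the next partial quotient.
  record Dual (U V : ℤ) (s t : Carrier) : Set where
    field
      inside   : PP (κ (+ 2) - sq s t)
      eastern  : + 1 ℤ.≤ U → NN (shifted (+ 1) (+ 0) s t)
      western  : U ℤ.≤ -[1+ 0 ] → NN (shifted -[1+ 0 ] (+ 0) s t)
      northern : + 1 ℤ.≤ V → NN (shifted (+ 0) (+ 1) s t)
      southern : V ℤ.≤ -[1+ 0 ] → NN (shifted (+ 0) -[1+ 0 ] s t)

  shifted-swap : ∀ {a b} s t → shifted a b s t ≈ shifted b a t s
  shifted-swap s t = +-congʳ (+-comm _ _)

  shifted-neg : ∀ a b s t → shifted a b s t ≈ shifted (ℤ.- a) b (- s) t
  shifted-neg a b s t = +-congʳ (+-congʳ (trans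
    (solve 2 (λ s a → (s :+ con (+ 2) :* a) :* (s :+ con (+ 2) :* a) := ((:- s) :+ con (+ 2) :* (:- a)) :*
      ((:- s) :+ con (+ 2) :* (:- a))) s (κ a))
    (sym (*-cong (+-congˡ (*-congˡ (κ-neg a))) (+-congˡ (*-congˡ (κ-neg a)))))))

  private
    1≤-neg : ∀ {U} → + 1 ℤ.≤ ℤ.- U → U ℤ.≤ -[1+ 0 ]
    1≤-neg {U} h = ≡.subst (ℤ._≤ -[1+ 0 ]) (ℤP.neg-involutive U) (ℤP.neg-mono-≤ h)
    neg-≤-1 : ∀ {U} → ℤ.- U ℤ.≤ -[1+ 0 ] → + 1 ℤ.≤ U
    neg-≤-1 {U} h = ≡.subst (+ 1 ℤ.≤_) (ℤP.neg-involutive U) (ℤP.neg-mono-≤ h)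

  Dual-swap : ∀ {U V s t} → Dual U V s t → Dual V U t s
  Dual-swap {U} {V} {s} {t} D = record
    { inside = PP-resp (+-congˡ (-‿cong (+-comm _ _))) inside
    ; eastern = λ h → NN-resp (shifted-swap s t) (northern h)
    ; western = λ h → NN-resp (shifted-swap s t) (southern h)
    ; northern = λ h → NN-resp (shifted-swap s t) (eastern h)
    ; southern = λ h → NN-resp (shifted-swap s t) (western h) }
    where open Dual D

  Dual-neg : ∀ {U V s t} → Dual U V s t → Dual (ℤ.- U) V (- s) t
  Dual-neg {U} {V} {s} {t} D = record
    { inside = PP-resp (solve 2 (λ s t → con (+ 2) :- (s :* s :+ t :* t) := con (+ 2) :-
        ((:- s) :* (:- s) :+ t :* t)) s t) inside
    ; eastern = λ h → NN-resp (shifted-neg -[1+ 0 ] (+ 0) s t) (western (1≤-neg h))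
    ; western = λ h → NN-resp (shifted-neg (+ 1) (+ 0) s t) (eastern (neg-≤-1 h))
    ; northern = λ h → NN-resp (shifted-neg (+ 0) (+ 1) s t) (northern h)
    ; southern = λ h → NN-resp (shifted-neg (+ 0) -[1+ 0 ] s t) (southern h) }
    where open Dual D

  -- A quotient w of modulus at least 2 is harmless by `far-shift`, and for the four shortest
  -- nonzero w the claim is the matching field of `Dual`. It yields |y + w| ≥ 1 for the next Y.
  dual-growth : ∀ {U V s t} → Dual U V s t → ¬ (U ≡ + 0 × V ≡ + 0) → NN (shifted U V s t)
  dual-growth {U} {V} {s} {t} D nz with classify U V
  ... | inj₁ f = far-shift U V s t f (PP⇒NN (Dual.inside D))
  ... | inj₂ origin = ⊥-elim (nz (≡.refl , ≡.refl))
  ... | inj₂ east = Dual.eastern D (ℤ.+≤+ ℕP.≤-refl)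
  ... | inj₂ west = Dual.western D ℤP.≤-refl
  ... | inj₂ north = Dual.northern D (ℤ.+≤+ ℕP.≤-refl)
  ... | inj₂ south = Dual.southern D ℤP.≤-refl

  -- z = 1 / x for x in the closed square, i.e. z lies outside four open discs.
  record OutsideDiscs (s t : Carrier) : Set where
    field
      eastern  : NN (sq s t - κ (+ 2) * s)
      western  : NN (sq s t + κ (+ 2) * s)
      northern : NN (sq s t - κ (+ 2) * t)
      southern : NN (sq s t + κ (+ 2) * t)

  OutsideDiscs-swap : ∀ {s t} → OutsideDiscs s t → OutsideDiscs t s
  OutsideDiscs-swap O = record
    { eastern = NN-resp (+-congʳ (+-comm _ _)) northern ; western = NN-resp (+-congʳ (+-comm _ _)) southern
    ; northern = NN-resp (+-congʳ (+-comm _ _)) eastern ; southern = NN-resp (+-congʳ (+-comm _ _)) western }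
    where open OutsideDiscs O

  OutsideDiscs-neg : ∀ {s t} → OutsideDiscs s t → OutsideDiscs (- s) t
  OutsideDiscs-neg {s} {t} O = record
    { eastern = NN-resp (solve 2 (λ s t → (s :* s :+ t :* t) :+ con (+ 2) :* s := ((:- s) :* (:- s) :+ t :* t) :- con
        (+ 2) :* (:- s)) s t) western
    ; western = NN-resp (solve 2 (λ s t → (s :* s :+ t :* t) :- con (+ 2) :* s := ((:- s) :* (:- s) :+ t :* t) :+ con
      (+ 2) :* (:- s)) s t) eastern
    ; northern = NN-resp (solve 2 (λ s t → (s :* s :+ t :* t) :- con (+ 2) :* t := ((:- s) :* (:- s) :+ t :* t) :-
      con (+ 2) :* t) s t) northern
    ; southern = NN-resp (solve 2 (λ s t → (s :* s :+ t :* t) :+ con (+ 2) :* t := ((:- s) :* (:- s) :+ t :* t) :+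
      con (+ 2) :* t) s t) southern }
    where open OutsideDiscs O

  -- If x lies in one of four open discs then Y avoids the corresponding open disc; this is the
  -- domain of the natural extension (x , Y) ↦ (1 / x − w , w + 1 / Y).
  record Avoids (xs xt Ys Yt : Carrier) : Set where
    field
      eastern  : PP (κ (+ 2) * xs - sq xs xt) → NN (shifted (+ 1) (+ 0) Ys Yt)
      western  : PP (κ (+ 2) * (- xs) - sq xs xt) → NN (shifted -[1+ 0 ] (+ 0) Ys Yt)
      northern : PP (κ (+ 2) * xt - sq xs xt) → NN (shifted (+ 0) (+ 1) Ys Yt)
      southern : PP (κ (+ 2) * (- xt) - sq xs xt) → NN (shifted (+ 0) -[1+ 0 ] Ys Yt)

  private
    shift-suc : ∀ a b U V s t → shifted (U ℤ.+ a) (V ℤ.+ b) s t ≈ shifted a b (s + κ (+ 2) * κ U) (t + κ (+ 2) * κ V)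
    shift-suc a b U V s t = +-congʳ (sq-cong (lem U a s) (lem V b t))
      where
      lem : ∀ U a s → s + κ (+ 2) * κ (U ℤ.+ a) ≈ s + κ (+ 2) * κ U + κ (+ 2) * κ a
      lem U a s = trans (+-congˡ (*-congˡ (κ-+ U a))) (solve 3
          (λ s u a → s :+ con (+ 2) :* (u :+ a) := s :+ con (+ 2) :* u :+ con (+ 2) :* a) s (κ U) (κ a))

    -- The next Y plus 1 + i is y + W with W = w + (1 + i), so only short W matter. If W = 0, the
    -- point z = x - (1 + i) would lie in the disc opposite to that of x, which `OutsideDiscs`
    -- forbids; W = 1 + i means w = 0; for the other three W a coordinate of w has the sign that
    -- activates a field of `Dual`.
    avoid-east : ∀ {U V zs zt ys yt} → OutsideDiscs zs zt → Dual U V ys yt → ¬ (U ≡ + 0 × V ≡ + 0) →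
      let xs = zs - κ (+ 2) * κ U ; xt = zt - κ (+ 2) * κ V in
      PP (κ (+ 2) * xs - sq xs xt) → NN (shifted (+ 1) (+ 0) (ys + κ (+ 2) * κ U) (yt + κ (+ 2) * κ V))
    avoid-east {U} {V} {zs} {zt} {ys} {yt} O D nz p = NN-resp (trans (shift-suc (+ 1) (+ 0) U V ys yt) refl)
      (cases (U ℤ.+ + 1) (V ℤ.+ + 0) ≡.refl (ℤP.+-identityʳ V) (classify (U ℤ.+ + 1) (V ℤ.+ + 0)))
      where
      U-eq : ∀ {a} → U ℤ.+ + 1 ≡ a → U ≡ a ℤ.- + 1
      U-eq {a} ≡.refl = ≡.sym (≡.trans (ℤP.+-assoc U (+ 1) -[1+ 0 ]) (ℤP.+-identityʳ U))
      cases : ∀ a b → U ℤ.+ + 1 ≡ a → b ≡ V → Far a b ⊎ Small a b → NN (shifted a b ys yt)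
      cases a b e e' (inj₁ f) = far-shift a b ys yt f (PP⇒NN (Dual.inside D))
      cases _ _ e ≡.refl (inj₂ origin) = ⊥-elim (PP⇒¬NN- (lem (U-eq e)) p (OutsideDiscs.western O))
        where
        lem : U ≡ -[1+ 0 ] → κ (+ 2) * (zs - κ (+ 2) * κ U) - sq (zs - κ (+ 2) * κ U) (zt - κ (+ 2) * κ (+ 0)) ≈ -
            (sq zs zt + κ (+ 2) * zs)
        lem ≡.refl = solve 2 (λ s t → con (+ 2) :* (s :- con (+ 2) :* con -[1+ 0 ]) :-
            ((s :- con (+ 2) :* con -[1+ 0 ]) :* (s :- con (+ 2) :* con -[1+ 0 ]) :+ (t :- con (+ 2) :* con (+ 0)) :*
            (t :- con (+ 2) :* con (+ 0)))
                       := :- ((s :* s :+ t :* t) :+ con (+ 2) :* s)) zs zt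
      cases _ _ e ≡.refl (inj₂ east) = ⊥-elim (nz (U-eq e , ≡.refl))
      cases _ _ e ≡.refl (inj₂ west) = Dual.western D (≡.subst (ℤ._≤ -[1+ 0 ]) (≡.sym (U-eq e)) (ℤ.-≤- ℕ.z≤n))
      cases _ _ e ≡.refl (inj₂ north) = Dual.northern D (ℤ.+≤+ ℕP.≤-refl)
      cases _ _ e ≡.refl (inj₂ south) = Dual.southern D ℤP.≤-refl

    avoid-west : ∀ {U V zs zt ys yt} → OutsideDiscs zs zt → Dual U V ys yt → ¬ (U ≡ + 0 × V ≡ + 0) →
      let xs = zs - κ (+ 2) * κ U ; xt = zt - κ (+ 2) * κ V in
      PP (κ (+ 2) * (- xs) - sq xs xt) → NN (shifted -[1+ 0 ] (+ 0) (ys + κ (+ 2) * κ U) (yt + κ (+ 2) * κ V))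
    avoid-west {U} {V} {zs} {zt} {ys} {yt} O D nz p = NN-resp
      (trans (+-congʳ (sq-cong (+-congʳ (sym neg-y)) refl))
        (sym (shifted-neg -[1+ 0 ] (+ 0) (ys + κ (+ 2) * κ U) (yt + κ (+ 2) * κ V))))
      (avoid-east (OutsideDiscs-neg O) (Dual-neg D) (λ (e , e') → nz
        (≡.trans (≡.sym (ℤP.neg-involutive U)) (≡.cong ℤ.-_ e) , e'))
        (PP-resp (+-cong (*-congˡ neg-z) (-‿cong (trans
          (solve 2 (λ x y → x :* x :+ y := (:- x) :* (:- x) :+ y) (zs - κ (+ 2) * κ U) _) (sq-cong neg-z refl)))) p))
      where
      neg-z : - (zs - κ (+ 2) * κ U) ≈ - zs - κ (+ 2) * κ (ℤ.- U)
      neg-z = trans (solve 2 (λ z u → :- (z :- con (+ 2) :* u) := :- z :- con (+ 2) :* (:- u)) zs (κ U))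
          (+-congˡ (-‿cong (*-congˡ (sym (κ-neg U)))))
      neg-y : - (ys + κ (+ 2) * κ U) ≈ - ys + κ (+ 2) * κ (ℤ.- U)
      neg-y = trans (solve 2 (λ z u → :- (z :+ con (+ 2) :* u) := :- z :+ con (+ 2) :* (:- u)) ys (κ U))
          (+-congˡ (*-congˡ (sym (κ-neg U))))

  avoids-next : ∀ {U V zs zt ys yt} → OutsideDiscs zs zt → Dual U V ys yt → ¬ (U ≡ + 0 × V ≡ + 0) →
    Avoids (zs - κ (+ 2) * κ U) (zt - κ (+ 2) * κ V) (ys + κ (+ 2) * κ U) (yt + κ (+ 2) * κ V)
  avoids-next O D nz = record
    { eastern = avoid-east O D nz
    ; western = avoid-west O D nz
    ; northern = λ p → NN-resp (shifted-swap _ _) (avoid-east (OutsideDiscs-swap O) (Dual-swap D) nz′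
      (PP-resp (+-congˡ (-‿cong (+-comm _ _))) p))
    ; southern = λ p → NN-resp (shifted-swap _ _) (avoid-west (OutsideDiscs-swap O) (Dual-swap D) nz′
      (PP-resp (+-congˡ (-‿cong (+-comm _ _))) p))
    }
    where nz′ = λ (e , e') → nz (e' , e)

  -- z = 1 / x is the conjugate of x divided by |x|², and conjugation exchanges s and t.
  record Inverse (xs xt zs zt : Carrier) : Set where
    field
      norm : sq xs xt * sq zs zt ≈ κ (+ 4)
      zs-x : zs * sq xs xt ≈ κ (+ 2) * xt
      zt-x : zt * sq xs xt ≈ κ (+ 2) * xs
      xs-z : xs * sq zs zt ≈ κ (+ 2) * zt
      xt-z : xt * sq zs zt ≈ κ (+ 2) * zs

    x-pos : PP (sq xs xt)
    x-pos = PP-cancel (sq≥0 zs zt) (PP-resp (trans (sym norm) (*-comm _ _)) (PP-κ 3))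

  inverse : ∀ x₁ x₂ z₁ z₂ → x₁ * z₁ - x₂ * z₂ ≈ κ (+ 1) → x₁ * z₂ + x₂ * z₁ ≈ κ (+ 0) →
            Inverse (x₁ + x₂) (x₁ - x₂) (z₁ + z₂) (z₁ - z₂)
  inverse x₁ x₂ z₁ z₂ e₁ e₂ = record
    { norm = begin
        sq (x₁ + x₂) (x₁ - x₂) * sq (z₁ + z₂) (z₁ - z₂)
          ≈⟨ solve 4 (λ x y z w → ((x :+ y) :* (x :+ y) :+ (x :- y) :* (x :- y)) :*
            ((z :+ w) :* (z :+ w) :+ (z :- w) :* (z :- w))
               := con (+ 4) :* ((x :* z :- y :* w) :* (x :* z :- y :* w) :+ (x :* w :+ y :* z) :*
                 (x :* w :+ y :* z))) x₁ x₂ z₁ z₂ ⟩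
        κ (+ 4) * ((x₁ * z₁ - x₂ * z₂) * (x₁ * z₁ - x₂ * z₂) + (x₁ * z₂ + x₂ * z₁) * (x₁ * z₂ + x₂ * z₁))
          ≈⟨ *-congˡ (+-cong (*-cong e₁ e₁) (*-cong e₂ e₂)) ⟩
        κ (+ 4) * (κ (+ 1) * κ (+ 1) + κ (+ 0) * κ (+ 0))
          ≈⟨ solve 0 (con (+ 4) :* (con (+ 1) :* con (+ 1) :+ con (+ 0) :* con (+ 0)) := con (+ 4)) ⟩
        κ (+ 4) ∎
    ; zs-x = s-eq x₁ x₂ z₁ z₂ e₁ e₂
    ; zt-x = t-eq x₁ x₂ z₁ z₂ e₁ e₂
    ; xs-z = s-eq z₁ z₂ x₁ x₂ f₁ f₂
    ; xt-z = t-eq z₁ z₂ x₁ x₂ f₁ f₂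
    }
    where
    f₁ : z₁ * x₁ - z₂ * x₂ ≈ κ (+ 1)
    f₁ = trans (+-cong (*-comm z₁ x₁) (-‿cong (*-comm z₂ x₂))) e₁
    f₂ : z₁ * x₂ + z₂ * x₁ ≈ κ (+ 0)
    f₂ = trans (solve 4 (λ x y z w → z :* y :+ w :* x := x :* w :+ y :* z) x₁ x₂ z₁ z₂) e₂
    s-eq : ∀ x₁ x₂ z₁ z₂ → x₁ * z₁ - x₂ * z₂ ≈ κ (+ 1) → x₁ * z₂ + x₂ * z₁ ≈ κ (+ 0) →
           (z₁ + z₂) * sq (x₁ + x₂) (x₁ - x₂) ≈ κ (+ 2) * (x₁ - x₂)
    s-eq x₁ x₂ z₁ z₂ e₁ e₂ = begin
      (z₁ + z₂) * sq (x₁ + x₂) (x₁ - x₂)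
        ≈⟨ solve 4 (λ x y z w → (z :+ w) :* ((x :+ y) :* (x :+ y) :+ (x :- y) :* (x :- y))
             := con (+ 2) :* ((x :- y) :* (x :* z :- y :* w) :+ (x :+ y) :* (x :* w :+ y :* z))) x₁ x₂ z₁ z₂ ⟩
      κ (+ 2) * ((x₁ - x₂) * (x₁ * z₁ - x₂ * z₂) + (x₁ + x₂) * (x₁ * z₂ + x₂ * z₁))
        ≈⟨ *-congˡ (+-cong (*-congˡ e₁) (*-congˡ e₂)) ⟩
      κ (+ 2) * ((x₁ - x₂) * κ (+ 1) + (x₁ + x₂) * κ (+ 0))
        ≈⟨ solve 2 (λ x y → con (+ 2) :* ((x :- y) :* con (+ 1) :+ (x :+ y) :* con (+ 0)) := con (+ 2) :* (x :- y))
          x₁ x₂ ⟩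
      κ (+ 2) * (x₁ - x₂) ∎
    t-eq : ∀ x₁ x₂ z₁ z₂ → x₁ * z₁ - x₂ * z₂ ≈ κ (+ 1) → x₁ * z₂ + x₂ * z₁ ≈ κ (+ 0) →
           (z₁ - z₂) * sq (x₁ + x₂) (x₁ - x₂) ≈ κ (+ 2) * (x₁ + x₂)
    t-eq x₁ x₂ z₁ z₂ e₁ e₂ = begin
      (z₁ - z₂) * sq (x₁ + x₂) (x₁ - x₂)
        ≈⟨ solve 4 (λ x y z w → (z :- w) :* ((x :+ y) :* (x :+ y) :+ (x :- y) :* (x :- y))
             := con (+ 2) :* ((x :+ y) :* (x :* z :- y :* w) :+ (y :- x) :* (x :* w :+ y :* z))) x₁ x₂ z₁ z₂ ⟩
      κ (+ 2) * ((x₁ + x₂) * (x₁ * z₁ - x₂ * z₂) + (x₂ - x₁) * (x₁ * z₂ + x₂ * z₁))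
        ≈⟨ *-congˡ (+-cong (*-congˡ e₁) (*-congˡ e₂)) ⟩
      κ (+ 2) * ((x₁ + x₂) * κ (+ 1) + (x₂ - x₁) * κ (+ 0))
        ≈⟨ solve 2 (λ x y → con (+ 2) :* ((x :+ y) :* con (+ 1) :+ (y :- x) :* con (+ 0)) := con (+ 2) :* (x :+ y))
          x₁ x₂ ⟩
      κ (+ 2) * (x₁ + x₂) ∎

  -- One step of the natural extension and its injectivity

  record Reduced (xs xt Ys Yt : Carrier) : Set where
    field
      within-s : Within xs
      within-t : Within xt
      small    : PP (κ (+ 2) - sq xs xt)
      big      : PP (sq Ys Yt - κ (+ 2))
      avoids   : Avoids xs xt Ys Yt

  module Step {xs xt Ys Yt zs zt ys yt U V}
              (red : Reduced xs xt Ys Yt) (xz : Inverse xs xt zs zt) (Yy : Inverse Ys Yt ys yt)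
              (R : Rounds U zs) (T : Rounds V zt) where
    open Reduced red
    private
      module xz = Inverse xz
      module Yy = Inverse Yy

    outside : OutsideDiscs zs zt
    outside = record
      { eastern  = minus xz.xt-z (proj₂ within-t)
      ; western  = plus xz.xt-z (proj₁ within-t)
      ; northern = minus xz.xs-z (proj₂ within-s)
      ; southern = plus xz.xs-z (proj₁ within-s) }
      where
      minus : ∀ {a b} → a * sq zs zt ≈ b → NN (κ (+ 1) - a) → NN (sq zs zt - b)
      minus {a} e h = NN-resp (trans (solve 2 (λ a n → n :* (con (+ 1) :- a) := n :- a :* n) a (sq zs zt))
          (+-congˡ (-‿cong e))) (NN-* (sq≥0 zs zt) h)
      plus : ∀ {a b} → a * sq zs zt ≈ b → NN (κ (+ 1) + a) → NN (sq zs zt + b)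
      plus {a} e h = NN-resp (trans (solve 2 (λ a n → n :* (con (+ 1) :+ a) := n :+ a :* n) a (sq zs zt))
          (+-congˡ e)) (NN-* (sq≥0 zs zt) h)

    private
      unit-shift : ∀ a b → κ a * κ a + κ b * κ b ≈ κ (+ 1) → ∀ s t →
                   shifted a b s t ≈ sq s t + κ (+ 4) * (κ a * s + κ b * t) + κ (+ 2)
      unit-shift a b e s t = begin
        shifted a b s t
          ≈⟨ solve 4 (λ a b s t → (s :+ con (+ 2) :* a) :* (s :+ con (+ 2) :* a) :+ (t :+ con (+ 2) :* b) :*
            (t :+ con (+ 2) :* b) :- con (+ 2)
               := (s :* s :+ t :* t) :+ con (+ 4) :* (a :* s :+ b :* t) :+
                 (con (+ 4) :* (a :* a :+ b :* b) :- con (+ 2))) (κ a) (κ b) s t ⟩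
        sq s t + κ (+ 4) * (κ a * s + κ b * t) + (κ (+ 4) * (κ a * κ a + κ b * κ b) - κ (+ 2))
          ≈⟨ +-congˡ (+-congʳ (*-congˡ e)) ⟩
        sq s t + κ (+ 4) * (κ a * s + κ b * t) + (κ (+ 4) * κ (+ 1) - κ (+ 2))
          ≈⟨ +-congˡ (solve 0 (con (+ 4) :* con (+ 1) :- con (+ 2) := con (+ 2))) ⟩
        sq s t + κ (+ 4) * (κ a * s + κ b * t) + κ (+ 2) ∎

      -- The unit circle about -W with |W|² = 2 is orthogonal to the unit circle, so inversion maps
      -- it to the conjugate circle and exterior to exterior. Conjugation exchanges the coordinates
      -- a and b.
      reflect : ∀ a b → κ a * κ a + κ b * κ b ≈ κ (+ 1) → NN (shifted a b Ys Yt) → NN (shifted b a ys yt)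
      reflect a b e h = NN-cancel (PP-κ 1) (NN-resp eq (NN-* h (sq≥0 ys yt)))
        where
        eq : shifted a b Ys Yt * sq ys yt ≈ κ (+ 2) * shifted b a ys yt
        eq = begin
          shifted a b Ys Yt * sq ys yt
            ≈⟨ *-congʳ (unit-shift a b e Ys Yt) ⟩
          (sq Ys Yt + κ (+ 4) * (κ a * Ys + κ b * Yt) + κ (+ 2)) * sq ys yt
            ≈⟨ solve 6 (λ N a s b t n → (N :+ con (+ 4) :* (a :* s :+ b :* t) :+ con (+ 2)) :* n
                 := N :* n :+ con (+ 4) :* (a :* (s :* n) :+ b :* (t :* n)) :+ con (+ 2) :* n) (sq Ys Yt) (κ a) Ys
                   (κ b) Yt (sq ys yt) ⟩
          sq Ys Yt * sq ys yt + κ (+ 4) * (κ a * (Ys * sq ys yt) + κ b * (Yt * sq ys yt)) + κ (+ 2) * sq ys yt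
            ≈⟨ +-congʳ (+-cong Yy.norm (*-congˡ (+-cong (*-congˡ Yy.xs-z) (*-congˡ Yy.xt-z)))) ⟩
          κ (+ 4) + κ (+ 4) * (κ a * (κ (+ 2) * yt) + κ b * (κ (+ 2) * ys)) + κ (+ 2) * sq ys yt
            ≈⟨ solve 5 (λ a s b t n → con (+ 4) :+ con (+ 4) :* (a :* (con (+ 2) :* t) :+ b :* (con (+ 2) :* s)) :+
              con (+ 2) :* n
                 := con (+ 2) :* (n :+ con (+ 4) :* (b :* s :+ a :* t) :+ con (+ 2))) (κ a) ys (κ b) yt (sq ys yt) ⟩
          κ (+ 2) * (sq ys yt + κ (+ 4) * (κ b * ys + κ a * yt) + κ (+ 2))
            ≈⟨ *-congˡ (unit-shift b a (trans (+-comm _ _) e) ys yt) ⟨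
          κ (+ 2) * shifted b a ys yt ∎

      -- The boundary convention enters here: with halves rounded towards zero, W ≥ 1 excludes s =
      -- 1, and the discs of `Avoids` are open.
      above-1 : ∀ {W s} → Rounds W s → + 1 ℤ.≤ W → PP (s - κ (+ 1))
      above-1 {W} {s} R h = PP-resp (solve 2 (λ s u → (con (+ 1) :+ (s :- con (+ 2) :* u)) :+ con (+ 2) :*
          (u :- con (+ 1)) := s :- con (+ 1)) s (κ W))
        (PP-+ˡ (Rounds.above R h) (NN-* (NN-κ 2) (κ-≤ h)))

      below-1 : ∀ {W s} → Rounds W s → W ℤ.≤ -[1+ 0 ] → PP (- s - κ (+ 1))
      below-1 {W} {s} R h = PP-resp (solve 2 (λ s u → (con (+ 1) :- (s :- con (+ 2) :* u)) :+ con (+ 2) :*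
          (con -[1+ 0 ] :- u) := :- s :- con (+ 1)) s (κ W))
        (PP-+ˡ (Rounds.below R h) (NN-* (NN-κ 2) (κ-≤ h)))

      -- Under x = 1/z the half-plane where a coordinate of z exceeds 1 becomes one of the open
      -- discs with 0 on their boundary.
      above-disc : ∀ {a b} → a * sq xs xt ≈ κ (+ 2) * b → PP (a - κ (+ 1)) → PP (κ (+ 2) * b - sq xs xt)
      above-disc {a} {b} e h = PP-resp (trans (solve 2 (λ a n → n :* (a :- con (+ 1)) := a :* n :- n) a (sq xs xt))
          (+-congʳ e)) (PP-* xz.x-pos h)

      below-disc : ∀ {a b} → a * sq xs xt ≈ κ (+ 2) * b → PP (- a - κ (+ 1)) → PP (κ (+ 2) * (- b) - sq xs xt)
      below-disc {a} {b} e h = PP-resp (trans (solve 2 (λ a n → n :* (:- a :- con (+ 1)) := :- (a :* n) :- n) a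
          (sq xs xt))
        (+-congʳ (trans (-‿cong e) (solve 1 (λ b → :- (con (+ 2) :* b) := con (+ 2) :* (:- b)) b)))) (PP-* xz.x-pos h)

    dual : Dual U V ys yt
    dual = record
      { inside = PP-cancel (sq≥0 Ys Yt) (PP-resp
          (trans (solve 1 (λ n → con (+ 2) :* (n :- con (+ 2)) := con (+ 2) :* n :- con (+ 4)) (sq Ys Yt))
            (trans (+-congˡ (-‿cong (sym Yy.norm)))
            (solve 2 (λ n k → con (+ 2) :* n :- n :* k := n :* (con (+ 2) :- k)) (sq Ys Yt) (sq ys yt))))
          (PP-* (PP-κ 1) big))
      -- The directions east and north are exchanged, here and below, because inversion includes a
      -- complex conjugation.
      ; eastern = λ h → reflect (+ 0) (+ 1) (solve 0 (con (+ 0) :* con (+ 0) :+ con (+ 1) :* con (+ 1) := con (+ 1)))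
          (Avoids.northern avoids (above-disc xz.zs-x (above-1 R h)))
      ; western = λ h → reflect (+ 0) -[1+ 0 ] (solve 0
        (con (+ 0) :* con (+ 0) :+ con -[1+ 0 ] :* con -[1+ 0 ] := con (+ 1)))
          (Avoids.southern avoids (below-disc xz.zs-x (below-1 R h)))
      ; northern = λ h → reflect (+ 1) (+ 0) (solve 0 (con (+ 1) :* con (+ 1) :+ con (+ 0) :* con (+ 0) := con (+ 1)))
          (Avoids.eastern avoids (above-disc xz.zt-x (above-1 T h)))
      ; southern = λ h → reflect -[1+ 0 ] (+ 0) (solve 0
        (con -[1+ 0 ] :* con -[1+ 0 ] :+ con (+ 0) :* con (+ 0) := con (+ 1)))
          (Avoids.western avoids (below-disc xz.zt-x (below-1 T h)))
      }

    -- A quotient 0 would leave z in the closed square, so |z| ≤ 1, whereas |x| < 1 gives |z| > 1.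
    nonzero : ¬ (U ≡ + 0 × V ≡ + 0)
    nonzero (e , e') = contradict
      (PP-+ˡ (PP-* (PP-κ 1) small) (NN-* (sq≥0 xs xt) (Within-sq (center R e) (center T e'))))
      (trans (solve 2 (λ n k → con (+ 2) :* (con (+ 2) :- n) :+ n :* (con (+ 2) :- k) := con (+ 4) :- n :* k)
        (sq xs xt) (sq zs zt))
        (trans (+-congˡ (-‿cong xz.norm)) (solve 0 (con (+ 4) :- con (+ 4) := con (+ 0)))))
      where
      center : ∀ {W s} → Rounds W s → W ≡ + 0 → Within s
      center {s = s} R ≡.refl = Within-resp (solve 1 (λ s → s :- con (+ 2) :* con (+ 0) := s) s) (Rounds.within R)

    next-big : NN (sq (ys + κ (+ 2) * κ U) (yt + κ (+ 2) * κ V) - κ (+ 2))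
    next-big = dual-growth dual nonzero

    next-avoids : Avoids (zs - κ (+ 2) * κ U) (zt - κ (+ 2) * κ V) (ys + κ (+ 2) * κ U) (yt + κ (+ 2) * κ V)
    next-avoids = avoids-next outside dual nonzero

  private
    -- Here y = y' + (1 + i), with y and y' in the open unit disc. If U ≤ -1, then y must avoid the
    -- unit disc about 1 + i, so |y'| ≥ 1; otherwise U' ≥ 1 and y' must avoid the one about -(1 +
    -- i), so |y| ≥ 1.
    east-impossible : ∀ {U V U' V' s t s' t'} → Dual U V s t → Dual U' V' s' t' → + 1 ≡ U' ℤ.- U →
      s ≈ s' + κ (+ 2) * κ (+ 1) → t ≈ t' + κ (+ 2) * κ (+ 0) → ⊥
    east-impossible {U} {V} {U'} {V'} {s} {t} {s'} {t'} D D' e p q with U ℤP.≤? -[1+ 0 ]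
    ... | yes h = PP⇒¬NN (Dual.inside D') (NN-resp (+-congʳ (sq-cong
            (trans (+-congʳ p) (solve 1 (λ s → s :+ con (+ 2) :* con (+ 1) :+ con (+ 2) :* con -[1+ 0 ] := s) s'))
            (trans (+-congʳ q) (solve 1 (λ s → s :+ con (+ 2) :* con (+ 0) :+ con (+ 2) :* con (+ 0) := s) t'))))
              (Dual.western D h))
    ... | no ¬h = PP⇒¬NN (Dual.inside D) (NN-resp (+-congʳ (sq-cong (sym p) (sym q))) (Dual.eastern D'
            (≡.subst (+ 1 ℤ.≤_) (≡.trans (≡.cong (λ z → z ℤ.+ U) e)
              (≡.trans (ℤP.+-assoc U' (ℤ.- U) U) (≡.trans (≡.cong (λ z → U' ℤ.+ z) (ℤP.+-inverseˡ U))
              (ℤP.+-identityʳ U'))))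
              (ℤP.+-monoʳ-≤ (+ 1) (0≤ U ¬h)))))
      where
      0≤ : ∀ U → ¬ U ℤ.≤ -[1+ 0 ] → + 0 ℤ.≤ U
      0≤ (+ k) _ = ℤ.+≤+ ℕ.z≤n
      0≤ -[1+ k ] h = ⊥-elim (h (ℤ.-≤- ℕ.z≤n))

    negate-minus : ∀ U' U → ℤ.- (U' ℤ.- U) ≡ U ℤ.- U'
    negate-minus U' U = ≡.trans (ℤP.neg-distrib-+ U' (ℤ.- U))
        (≡.trans (≡.cong (λ z → ℤ.- U' ℤ.+ z) (ℤP.neg-involutive U)) (ℤP.+-comm (ℤ.- U') U))

    minus≡0 : ∀ U' U → + 0 ≡ U' ℤ.- U → U ≡ U'
    minus≡0 U' U e = ≡.sym (ℤP.i-j≡0⇒i≡j U' U (≡.sym e))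

  -- Two points of the open unit disc cannot differ by a lattice vector of modulus 2 or more. The
  -- four remaining nonzero differences all reduce to `east-impossible`: west exchanges the two
  -- records, north and south exchange the coordinates.
  dual-unique : ∀ {U V U' V' s t s' t'} → Dual U V s t → Dual U' V' s' t' →
    s + κ (+ 2) * κ U ≈ s' + κ (+ 2) * κ U' → t + κ (+ 2) * κ V ≈ t' + κ (+ 2) * κ V' → U ≡ U' × V ≡ V'
  dual-unique {U} {V} {U'} {V'} {s} {t} {s'} {t'} D D' p q =
    cases (U' ℤ.- U) (V' ℤ.- V) ≡.refl ≡.refl (classify (U' ℤ.- U) (V' ℤ.- V))
    where
    shift : ∀ {s s' U U'} → s + κ (+ 2) * κ U ≈ s' + κ (+ 2) * κ U' → s ≈ s' + κ (+ 2) * κ (U' ℤ.- U)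
    shift {s} {s'} {U} {U'} p = begin
      s                                        ≈⟨ solve 2 (λ s u → s := s :+ con (+ 2) :* u :- con (+ 2) :* u) s (κ U) ⟩
      s + κ (+ 2) * κ U - κ (+ 2) * κ U        ≈⟨ +-congʳ p ⟩
      s' + κ (+ 2) * κ U' - κ (+ 2) * κ U      ≈⟨ solve 3
          (λ s u v → s :+ con (+ 2) :* v :- con (+ 2) :* u := s :+ con (+ 2) :* (v :- u)) s' (κ U) (κ U') ⟩
      s' + κ (+ 2) * (κ U' - κ U)              ≈⟨ +-congˡ (*-congˡ (κ-- U' U)) ⟨
      s' + κ (+ 2) * κ (U' ℤ.- U) ∎
    forth : ∀ {s s' U U' a} → a ≡ U' ℤ.- U → s + κ (+ 2) * κ U ≈ s' + κ (+ 2) * κ U' → s ≈ s' + κ (+ 2) * κ a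
    forth ≡.refl = shift
    back : ∀ {s s' U U' a} → a ≡ U' ℤ.- U → s + κ (+ 2) * κ U ≈ s' + κ (+ 2) * κ U' → s' ≈ s + κ (+ 2) * κ (ℤ.- a)
    back {U = U} {U'} ≡.refl r = trans (shift (sym r)) (+-congˡ
        (*-congˡ (reflexive (≡.cong κ (≡.sym (negate-minus U' U))))))
    cases : ∀ a b → a ≡ U' ℤ.- U → b ≡ V' ℤ.- V → Far a b ⊎ Small a b → U ≡ U' × V ≡ V'
    cases a b e e' (inj₁ f) = ⊥-elim (PP⇒¬NN (Dual.inside D)
        (NN-resp (+-congʳ (sq-cong (sym (forth e p)) (sym (forth e' q))))
      (far-shift a b s' t' f (PP⇒NN (Dual.inside D')))))
    cases _ _ e e' (inj₂ origin) = minus≡0 U' U e , minus≡0 V' V e'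
    cases _ _ e e' (inj₂ east) = ⊥-elim (east-impossible D D' e (forth e p) (forth e' q))
    cases _ _ e e' (inj₂ west) = ⊥-elim (east-impossible D' D (≡.trans (≡.cong ℤ.-_ e) (negate-minus U' U))
        (back e p) (back e' q))
    cases _ _ e e' (inj₂ north) = ⊥-elim (east-impossible (Dual-swap D) (Dual-swap D') e' (forth e' q) (forth e p))
    cases _ _ e e' (inj₂ south) = ⊥-elim (east-impossible (Dual-swap D') (Dual-swap D)
        (≡.trans (≡.cong ℤ.-_ e') (negate-minus V' V)) (back e' q) (back e p))

  -- Estimates at the start of the orbit and near the corners

  -- The starting point x = √D − w, Y = √D + w with w = U (1 + i) + V (1 − i) nearest to √D.
  record Start (U V : ℤ) (ds dt : Carrier) : Set where
    field
      within-s : Within (ds - κ (+ 2) * κ U)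
      within-t : Within (dt - κ (+ 2) * κ V)
      large    : NN (sq ds dt - κ (+ 2))
      nonzero  : ¬ (U ≡ + 0 × V ≡ + 0)

  private
    Start-swap : ∀ {U V s t} → Start U V s t → Start V U t s
    Start-swap S = record { within-s = within-t ; within-t = within-s ; large = NN-resp (+-congʳ (+-comm _ _)) large
                          ; nonzero = λ (e , e') → nonzero (e' , e) }
      where open Start S

    neg-double : ∀ s U → - (s - κ (+ 2) * κ U) ≈ - s - κ (+ 2) * κ (ℤ.- U)
    neg-double s U = trans (solve 2 (λ s u → :- (s :- con (+ 2) :* u) := :- s :- con (+ 2) :* (:- u)) s (κ U))
        (+-congˡ (-‿cong (*-congˡ (sym (κ-neg U)))))

    Start-neg : ∀ {U V s t} → Start U V s t → Start (ℤ.- U) V (- s) t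
    Start-neg {U} {V} {s} {t} S = record
      { within-s = Within-resp (neg-double s U) (proj₂ within-s , NN-resp
          (solve 1 (λ x → con (+ 1) :+ x := con (+ 1) :- (:- x)) _) (proj₁ within-s))
      ; within-t = within-t
      ; large = NN-resp (solve 2 (λ s t → s :* s :+ t :* t :- con (+ 2) := (:- s) :* (:- s) :+ t :* t :- con (+ 2)) s
        t) large
      ; nonzero = λ (e , e') → nonzero (≡.trans (≡.sym (ℤP.neg-involutive U)) (≡.cong ℤ.-_ e) , e') }
      where open Start S

    sq-large : ∀ {x} → NN (x - κ (+ 3)) → NN (x * x - κ (+ 2))
    sq-large {x} h = NN-resp (solve 1 (λ x → (x :- con (+ 3)) :* (x :- con (+ 3)) :+
        (con (+ 6) :* (x :- con (+ 3)) :+ con (+ 7)) := x :* x :- con (+ 2)) x)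
      (NN-+ (NN-sq _) (NN-+ (NN-* (NN-κ 6) h) (NN-κ 7)))

    sq-large-neg : ∀ {x} → NN (- x - κ (+ 3)) → NN (x * x - κ (+ 2))
    sq-large-neg {x} h = NN-resp (+-congʳ (solve 1 (λ x → (:- x) :* (:- x) := x :* x) x)) (sq-large h)

    first-large : ∀ {s t} → NN (s * s - κ (+ 2)) → NN (sq s t - κ (+ 2))
    first-large {s} {t} h = NN-resp (solve 2 (λ s t → (s :* s :- con (+ 2)) :+ t :* t := s :* s :+ t :* t :- con
        (+ 2)) s t) (NN-+ h (NN-sq t))

    second-large : ∀ {s t} → NN (t * t - κ (+ 2)) → NN (sq s t - κ (+ 2))
    second-large h = NN-resp (+-congʳ (+-comm _ _)) (first-large h)

    -- The constant 3 is 4 - 1, from s + 2U = 4U + (s - 2U) with s - 2U ≥ -1.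
    grown : ∀ {s U} → Within (s - κ (+ 2) * κ U) → + 1 ℤ.≤ U → NN (s + κ (+ 2) * κ U - κ (+ 3))
    grown {s} {U} (a , _) h = NN-resp
      (solve 2 (λ s u → (con (+ 1) :+ (s :- con (+ 2) :* u)) :+ con (+ 4) :* (u :- con (+ 1)) := s :+ con (+ 2) :* u
        :- con (+ 3)) s (κ U))
      (NN-+ a (NN-* (NN-κ 4) (κ-≤ h)))

    grown⁻ : ∀ {s U} → Within (s - κ (+ 2) * κ U) → U ℤ.≤ -[1+ 0 ] → NN (- (s + κ (+ 2) * κ U) - κ (+ 3))
    grown⁻ {s} {U} (_ , b) h = NN-resp
      (solve 2 (λ s u → (con (+ 1) :- (s :- con (+ 2) :* u)) :+ con (+ 4) :* (con -[1+ 0 ] :- u) := :-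
        (s :+ con (+ 2) :* u) :- con (+ 3)) s (κ U))
      (NN-+ b (NN-* (NN-κ 4) (κ-≤ h)))

    nonzero-large : ∀ {s U} → Within (s - κ (+ 2) * κ U) → U ≢ + 0 → NN
        ((s + κ (+ 2) * κ U) * (s + κ (+ 2) * κ U) - κ (+ 2))
    nonzero-large {U = + 0} w h = ⊥-elim (h ≡.refl)
    nonzero-large {U = + suc k} w h = sq-large (grown w (ℤ.+≤+ (ℕ.s≤s ℕ.z≤n)))
    nonzero-large {U = -[1+ k ]} w h = sq-large-neg (grown⁻ w (ℤ.-≤- ℕ.z≤n))

  start-big : ∀ {U V s t} → Start U V s t → NN (sq (s + κ (+ 2) * κ U) (t + κ (+ 2) * κ V) - κ (+ 2))
  start-big {U} {V} S with U ℤP.≟ + 0 | V ℤP.≟ + 0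
  ... | no h | _ = first-large (nonzero-large (Start.within-s S) h)
  ... | yes _ | no h = second-large (nonzero-large (Start.within-t S) h)
  ... | yes e | yes e' = ⊥-elim (Start.nonzero S (e , e'))

  private
    -- Unless w = -(1 + i), a coordinate of Y + (1 + i) has absolute value at least 3. For w = -(1 +
    -- i) that number is √D itself, and |D| ≥ 1.
    start-east : ∀ {U V s t} → Start U V s t → NN (shifted (+ 1) (+ 0) (s + κ (+ 2) * κ U) (t + κ (+ 2) * κ V))
    start-east {U} {V} {s} {t} S with V ℤP.≟ + 0
    ... | no h = second-large (NN-resp (+-congʳ (solve 1
        (λ t → t :* t := (t :+ con (+ 2) :* con (+ 0)) :* (t :+ con (+ 2) :* con (+ 0))) _))
        (nonzero-large (Start.within-t S) h))
    ... | yes e = onAxis U (Start.within-s S) (λ e' → Start.nonzero S (e' , e))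
      where
      onAxis : ∀ W → Within (s - κ (+ 2) * κ W) → W ≢ + 0 → NN
          (shifted (+ 1) (+ 0) (s + κ (+ 2) * κ W) (t + κ (+ 2) * κ V))
      onAxis (+ 0) w h = ⊥-elim (h ≡.refl)
      onAxis (+ suc k) w h = first-large (sq-large (NN-resp
        (solve 1 (λ x → (x :- con (+ 3)) :+ con (+ 2) := (x :+ con (+ 2) :* con (+ 1)) :- con (+ 3))
          (s + κ (+ 2) * κ (+ suc k)))
        (NN-+ (grown w (ℤ.+≤+ (ℕ.s≤s ℕ.z≤n))) (NN-κ 2))))
      onAxis -[1+ 0 ] w h = NN-resp (+-congʳ (sq-cong
        (solve 1 (λ s → s := s :+ con (+ 2) :* con -[1+ 0 ] :+ con (+ 2) :* con (+ 1)) s)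
        (trans (solve 1 (λ t → t := t :+ con (+ 2) :* con (+ 0) :+ con (+ 2) :* con (+ 0)) t)
          (+-congʳ (+-congˡ (*-congˡ (reflexive (≡.cong κ (≡.sym e)))))))))
        (Start.large S)
      onAxis -[1+ suc k ] w h = first-large (sq-large-neg (NN-resp
        (solve 2 (λ s u → (con (+ 1) :- (s :- con (+ 2) :* u)) :+ (con (+ 4) :* (con -[1+ 1 ] :- u) :+ con (+ 2))
          := :- (s :+ con (+ 2) :* u :+ con (+ 2) :* con (+ 1)) :- con (+ 3)) s (κ -[1+ suc k ]))
        (NN-+ (proj₂ w) (NN-+ (NN-* (NN-κ 4) (κ-≤ (ℤ.-≤- (ℕ.s≤s ℕ.z≤n)))) (NN-κ 2)))))

    start-west : ∀ {U V s t} → Start U V s t → NN (shifted -[1+ 0 ] (+ 0) (s + κ (+ 2) * κ U) (t + κ (+ 2) * κ V))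
    start-west {U} {V} {s} {t} S = NN-resp (trans (+-congʳ (sq-cong (+-congʳ (sym eq)) refl))
        (sym (shifted-neg -[1+ 0 ] (+ 0) _ _)))
      (start-east (Start-neg S))
      where
      eq : - (s + κ (+ 2) * κ U) ≈ - s + κ (+ 2) * κ (ℤ.- U)
      eq = trans (solve 2 (λ s u → :- (s :+ con (+ 2) :* u) := :- s :+ con (+ 2) :* (:- u)) s (κ U))
          (+-congˡ (*-congˡ (sym (κ-neg U))))

  start-avoids : ∀ {U V s t xs xt} → Start U V s t → Avoids xs xt (s + κ (+ 2) * κ U) (t + κ (+ 2) * κ V)
  start-avoids S = record
    { eastern = λ _ → start-east S
    ; western = λ _ → start-west S
    ; northern = λ _ → NN-resp (shifted-swap _ _) (start-east (Start-swap S))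
    ; southern = λ _ → NN-resp (shifted-swap _ _) (start-west (Start-swap S)) }

  private
    abs : ∀ x → ∃ λ a → NN a × NN (a - x) × NN (a + x) × a * a ≈ x * x
    abs x with NN-total x
    ... | inj₁ n = x , n , NN-resp (sym (-‿inverseʳ x)) NN-0 , NN-+ n n , refl
    ... | inj₂ n = - x , n , NN-+ n n , NN-resp (sym (-‿inverseˡ x)) NN-0 , solve 1 (λ x → (:- x) :* (:- x) := x :* x) x

    widen : ∀ {a b x} → NN (b - a) → NN (a - x) → NN (b - x)
    widen {a} {b} {x} m n = NN-resp (solve 3 (λ a b x → (b :- a) :+ (a :- x) := b :- x) a b x) (NN-+ m n)
    widen⁺ : ∀ {a b x} → NN (b - a) → NN (a + x) → NN (b + x)
    widen⁺ {a} {b} {x} m n = NN-resp (solve 3 (λ a b x → (b :- a) :+ (a :+ x) := b :+ x) a b x) (NN-+ m n)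

  -- The supremum norm stands in for the Euclidean one, whose square root need not exist in the
  -- algebra.
  sup-norm : ∀ x y → ∃ λ δ → NN δ × (NN (δ - x) × NN (δ + x)) × (NN (δ - y) × NN (δ + y)) × NN (sq x y - δ * δ)
  sup-norm x y with abs x | abs y
  ... | a , a≥0 , a-x , a+x , a² | b , b≥0 , b-y , b+y , b² with NN-total (a - b)
  ...   | inj₁ h = a , a≥0 , (a-x , a+x) , (widen h b-y , widen⁺ h b+y)
                 , NN-resp (trans (solve 2 (λ x y → y := x :+ y :- x) (x * x) (y * y)) (+-congˡ (-‿cong (sym a²))))
                   (NN-sq y)
  ...   | inj₂ h = b , b≥0 , (widen h′ a-x , widen⁺ h′ a+x) , (b-y , b+y)
                 , NN-resp (trans (solve 2 (λ x y → x := x :+ y :- y) (x * x) (y * y)) (+-congˡ (-‿cong (sym b²))))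
                   (NN-sq x)
    where
    h′ : NN (b - a)
    h′ = NN-resp (solve 2 (λ a b → :- (a :- b) := b :- a) a b) h

  private
    sq-≤ : ∀ {x y} → NN (y - x) → NN (y + x) → NN (y * y - x * x)
    sq-≤ {x} {y} m n = NN-resp (solve 2 (λ x y → (y :- x) :* (y :+ x) := y :* y :- x :* x) x y) (NN-* m n)

    -- If 1 - u > 4δ, then |U| ≤ u + δ < 1 - 3δ and |V| ≤ v + δ ≤ 1 + δ, so U² + V² < 2 - 4δ + 10δ²
    -- ≤ 2 because 4δ ≤ 1. This contradicts |Y| ≥ 1.
    gap : ∀ {u v U V δ} → NN u → NN (κ (+ 1) - u) → NN v → NN (κ (+ 1) - v) → NN (sq U V - κ (+ 2)) → NN δ →
          NN (δ - (u + U)) × NN (δ + (u + U)) → NN (δ - (v + V)) × NN (δ + (v + V)) → NN (κ (+ 1) - κ (+ 4) * δ) →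
          NN (κ (+ 4) * δ - (κ (+ 1) - u))
    gap {u} {v} {U} {V} {δ} u≥0 u≤1 v≥0 v≤1 Y δ≥0 (a , b) (c , e) δ≤ with NN⊎PP (κ (+ 4) * δ - (κ (+ 1) - u))
    ... | inj₁ n = n
    ... | inj₂ h = ⊥-elim (contradict
      (PP-+ˡ (PP-* p (PP-+ˡ p (NN-* (NN-κ 2) (NN-+ u≥0 δ≥0))))
        (NN-+ (sq-≤ mu-U mu+U) (NN-+ (sq-≤ mv-V mv+V) (NN-+ (sq-≤ 1-v 1+v)
          (NN-+ Y (NN-* δ≥0 (NN-+ (NN-* (NN-κ 3) δ≤) (NN-+ (NN-κ 1) (NN-* (NN-κ 2) δ≥0)))))))))
      (solve 5 (λ u v U V δ →
          (:- (con (+ 4) :* δ :- (con (+ 1) :- u))) :* ((:- (con (+ 4) :* δ :- (con (+ 1) :- u))) :+ con (+ 2) :*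
            (u :+ δ))
          :+ (((u :+ δ) :* (u :+ δ) :- U :* U) :+ (((v :+ δ) :* (v :+ δ) :- V :* V)
          :+ (((con (+ 1) :+ δ) :* (con (+ 1) :+ δ) :- (v :+ δ) :* (v :+ δ)) :+ ((U :* U :+ V :* V :- con (+ 2))
          :+ δ :* (con (+ 3) :* (con (+ 1) :- con (+ 4) :* δ) :+ (con (+ 1) :+ con (+ 2) :* δ))))))
          := con (+ 0)) u v U V δ))
      where
      p : PP (- (κ (+ 4) * δ - (κ (+ 1) - u)))
      p = h
      mu-U : NN ((u + δ) - U)
      mu-U = NN-resp (solve 3 (λ u U δ → (δ :- (u :+ U)) :+ con (+ 2) :* u := (u :+ δ) :- U) u U δ)
          (NN-+ a (NN-* (NN-κ 2) u≥0))
      mu+U : NN ((u + δ) + U)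
      mu+U = NN-resp (solve 3 (λ u U δ → δ :+ (u :+ U) := (u :+ δ) :+ U) u U δ) b
      mv-V : NN ((v + δ) - V)
      mv-V = NN-resp (solve 3 (λ u U δ → (δ :- (u :+ U)) :+ con (+ 2) :* u := (u :+ δ) :- U) v V δ)
          (NN-+ c (NN-* (NN-κ 2) v≥0))
      mv+V : NN ((v + δ) + V)
      mv+V = NN-resp (solve 3 (λ u U δ → δ :+ (u :+ U) := (u :+ δ) :+ U) v V δ) e
      1-v : NN ((κ (+ 1) + δ) - (v + δ))
      1-v = NN-resp (solve 2 (λ v δ → con (+ 1) :- v := (con (+ 1) :+ δ) :- (v :+ δ)) v δ) v≤1
      1+v : NN ((κ (+ 1) + δ) + (v + δ))
      1+v = NN-+ (NN-+ (NN-κ 1) δ≥0) (NN-+ v≥0 δ≥0)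

  -- Near a corner of the square, x and − Y can only be close to each other if both are close to the corner.
  cusp-bound : ∀ {u v U V} → NN u → NN (κ (+ 1) - u) → NN v → NN (κ (+ 1) - v) → NN (sq U V - κ (+ 2)) →
    let d = sq (u + U) (v + V) in
    NN (κ (+ 1600) * (d * d) - sq (κ (+ 1) - u) (κ (+ 1) - v) * sq (κ (+ 1) + U) (κ (+ 1) + V)) ⊎
    NN (κ (+ 16) * d - κ (+ 1))
  cusp-bound {u} {v} {U} {V} u≥0 u≤1 v≥0 v≤1 Y with sup-norm (u + U) (v + V)
  ... | δ , δ≥0 , a , b , δ²≤d with NN⊎PP (κ (+ 1) - κ (+ 4) * δ)
  ...   | inj₂ h = inj₂ (NN-resp
    (solve 2 (λ δ d → con (+ 16) :* (d :- δ :* δ) :+ (:- (con (+ 1) :- con (+ 4) :* δ)) :*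
      ((:- (con (+ 1) :- con (+ 4) :* δ)) :+ con (+ 2)) := con (+ 16) :* d :- con (+ 1)) δ (sq (u + U) (v + V)))
    (NN-+ (NN-* (NN-κ 16) δ²≤d) (NN-* (PP⇒NN h) (NN-+ (PP⇒NN h) (NN-κ 2)))))
  -- Both factors are quadratic in δ: 1 - u and 1 - v are at most 4δ, which gives 32δ², and |1 + U|
  -- ≤ |1 - u| + |u + U| ≤ 5δ, likewise for V, gives 50δ². Their product is 1600δ⁴.
  ...   | inj₁ h = inj₁ (NN-resp
    (solve 4 (λ e d A B → con (+ 1600) :* (d :* d :- e :* e) :+
      (B :* (con (+ 32) :* e :- A) :+ con (+ 32) :* e :* (con (+ 50) :* e :- B)) := con (+ 1600) :* (d :* d) :- A :*
      B) (δ * δ) (sq (u + U) (v + V)) (sq (κ (+ 1) - u) (κ (+ 1) - v)) (sq (κ (+ 1) + U) (κ (+ 1) + V)))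
    (NN-+ (NN-* (NN-κ 1600) (NN-resp (solve 2 (λ d e → (d :- e) :* (d :+ e) := d :* d :- e :* e) (sq (u + U) (v + V))
      (δ * δ))
             (NN-* δ²≤d (NN-+ (sq≥0 _ _) (NN-sq δ)))))
      (NN-+ (NN-* (sq≥0 _ _) A≤) (NN-* (NN-* (NN-κ 32) (NN-sq δ)) B≤))))
    where
    gu : NN (κ (+ 4) * δ - (κ (+ 1) - u))
    gu = gap u≥0 u≤1 v≥0 v≤1 Y δ≥0 a b h
    gv : NN (κ (+ 4) * δ - (κ (+ 1) - v))
    gv = gap v≥0 v≤1 u≥0 u≤1 (NN-resp (+-congʳ (+-comm _ _)) Y) δ≥0 b a h
    A≤ : NN (κ (+ 32) * (δ * δ) - sq (κ (+ 1) - u) (κ (+ 1) - v))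
    A≤ = NN-resp (solve 3 (λ δ x y → ((con (+ 4) :* δ) :* (con (+ 4) :* δ) :- x :* x) :+
        ((con (+ 4) :* δ) :* (con (+ 4) :* δ) :- y :* y) := con (+ 32) :* (δ :* δ) :- (x :* x :+ y :* y)) δ
        (κ (+ 1) - u) (κ (+ 1) - v))
      (NN-+ (sq-≤ gu (NN-+ (NN-* (NN-κ 4) δ≥0) u≤1)) (sq-≤ gv (NN-+ (NN-* (NN-κ 4) δ≥0) v≤1)))
    five : ∀ {u U} → NN (κ (+ 1) - u) → NN (κ (+ 4) * δ - (κ (+ 1) - u)) → NN (δ - (u + U)) × NN (δ + (u + U)) →
           NN ((κ (+ 5) * δ) * (κ (+ 5) * δ) - (κ (+ 1) + U) * (κ (+ 1) + U))
    five {u} {U} u≤1 g (m , n) = sq-≤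
      (NN-resp (solve 3 (λ u U δ → (con (+ 4) :* δ :- (con (+ 1) :- u)) :+ (δ :- (u :+ U)) := con (+ 5) :* δ :-
        (con (+ 1) :+ U)) u U δ ) (NN-+ g m))
      (NN-resp (solve 3 (λ u U δ → con (+ 4) :* δ :+ (con (+ 1) :- u) :+ (δ :+ (u :+ U)) := con (+ 5) :* δ :+
        (con (+ 1) :+ U)) u U δ) (NN-+ (NN-+ (NN-* (NN-κ 4) δ≥0) u≤1) n))
    B≤ : NN (κ (+ 50) * (δ * δ) - sq (κ (+ 1) + U) (κ (+ 1) + V))
    B≤ = NN-resp (solve 3 (λ δ x y → ((con (+ 5) :* δ) :* (con (+ 5) :* δ) :- x :* x) :+
        ((con (+ 5) :* δ) :* (con (+ 5) :* δ) :- y :* y) := con (+ 50) :* (δ :* δ) :- (x :* x :+ y :* y)) δ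
        (κ (+ 1) + U) (κ (+ 1) + V))
      (NN-+ (five u≤1 gu a) (five v≤1 gv b))

-- Conjugate pairs and the quadratic form

module ConjugateIdentities (E : ℚAlgebra) where
  open ℚAlgebra E

  multiply : ∀ a b c e s D → s * s ≈ D → (a * c + b * e * D) + (a * e + b * c) * s ≈ (a + b * s) * (c + e * s)
  multiply a b c e s D p = trans (+-congʳ (+-congˡ (*-congˡ (sym p))))
    (solve 5 (λ a b c e s → (a :* c :+ b :* e :* (s :* s)) :+ (a :* e :+ b :* c) :* s := (a :+ b :* s) :*
      (c :+ e :* s)) a b c e s)

  numerator : ∀ a β A s → a * A ≈ 1# → a * (β * A + A * s) ≈ β + s
  numerator a β A s p = trans (solve 4 (λ a β A s → a :* (β :* A :+ A :* s) := (a :* A) :* (β :+ s)) a β A s)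
    (trans (*-congʳ p) (*-identityˡ (β + s)))

  difference : ∀ a β A s → a * A ≈ 1# → a * ((β * A + A * s) + ((- β) * A + A * s)) ≈ s + s
  difference a β A s p = trans (solve 4 (λ a β A s → a :* ((β :* A :+ A :* s) :+ ((:- β) :* A :+ A :* s)) := (a :* A)
      :* (s :+ s)) a β A s)
    (trans (*-congʳ p) (*-identityˡ (s + s)))

  -- (ζ − x) (ζ + Y) a is the quadratic polynomial with roots x and − Y, evaluated at ζ.
  evaluate : ∀ a β c A s D ζ → a * A ≈ 1# → s * s ≈ D → β * β + a * c ≈ D →
             a * ((ζ - (β * A + A * s)) * (ζ + ((- β) * A + A * s))) ≈ a * (ζ * ζ) - (β * ζ + β * ζ) - c
  evaluate a β c A s D ζ p q e = begin
    a * ((ζ - (β * A + A * s)) * (ζ + ((- β) * A + A * s)))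
      ≈⟨ solve 5 (λ a β A s ζ → a :* ((ζ :- (β :* A :+ A :* s)) :* (ζ :+ ((:- β) :* A :+ A :* s)))
           := a :* (ζ :* ζ) :- (β :* ζ :+ β :* ζ) :* (a :* A) :+ (a :* A) :* A :* (β :* β :- s :* s)) a β A s ζ ⟩
    a * (ζ * ζ) - (β * ζ + β * ζ) * (a * A) + (a * A) * A * (β * β - s * s)
      ≈⟨ +-congˡ (*-congˡ (+-congˡ (-‿cong (trans q (sym e))))) ⟩
    a * (ζ * ζ) - (β * ζ + β * ζ) * (a * A) + (a * A) * A * (β * β - (β * β + a * c))
      ≈⟨ solve 5 (λ a β c A ζ → a :* (ζ :* ζ) :- (β :* ζ :+ β :* ζ) :* (a :* A) :+ (a :* A) :* A :*
        (β :* β :- (β :* β :+ a :* c))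
           := a :* (ζ :* ζ) :- (β :* ζ :+ β :* ζ) :* (a :* A) :- (a :* A) :* (a :* A) :* c) a β c A ζ ⟩
    a * (ζ * ζ) - (β * ζ + β * ζ) * (a * A) - (a * A) * (a * A) * c
      ≈⟨ +-cong (+-congˡ (-‿cong (trans (*-congˡ p) (*-identityʳ (β * ζ + β * ζ)))))
                (-‿cong (trans (*-congʳ (trans (*-cong p p) (*-identityˡ 1#))) (*-identityˡ c))) ⟩
    a * (ζ * ζ) - (β * ζ + β * ζ) - c ∎
    where open import Relation.Binary.Reasoning.Setoid setoid

-- This is a ζ² - 2β ζ - c. A quarter of its discriminant is β² + a c = D, so its roots are (β ±
-- √D)/a, that is, x and -Y.
polynomial : GI → GI → GI → GI → GI
polynomial a β c ζ = ((a *GI (ζ *GI ζ)) -GI ((β *GI ζ) +GI (β *GI ζ))) -GI c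

module _ (m n : ℤ) (noRoot : ¬ HasSqrtInQi m n) where
  private
    D : GI
    D = (m , n)

  D≢0 : D ≢ 0GI
  D≢0 ≡.refl = noRoot (0G , ≡.refl)

  private
    module Square (E : ℚAlgebra) where
      open ℚAlgebra E
      complete : ∀ a β c ζ d → β * β + a * c ≈ d → a * (ζ * ζ) - (β * ζ + β * ζ) - c ≈ 0# → (a * ζ - β) * (a * ζ - β)
          ≈ d
      complete a β c ζ d e h = trans
        (solve 4 (λ a β c ζ → (a :* ζ :- β) :* (a :* ζ :- β) := (β :* β :+ a :* c) :+ a :*
          (a :* (ζ :* ζ) :- (β :* ζ :+ β :* ζ) :- c)) a β c ζ)
        (trans (+-cong e (trans (*-congˡ h) (zeroʳ a))) (+-identityʳ d))

    ιG-- : ∀ g h → ιG (g -GI h) ≡ ιG g G.- ιG h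
    ιG-- g h = ≡.trans (ιG-+ g (negGI h)) (≡.cong (λ z → ιG g G.+ z) (ιG-neg h))

    ιG-polynomial : ∀ a β c ζ → ιG (polynomial a β c ζ) ≡
                    ιG a G.* (ιG ζ G.* ιG ζ) G.- (ιG β G.* ιG ζ G.+ ιG β G.* ιG ζ) G.- ιG c
    ιG-polynomial a β c ζ = ≡.trans (ιG-- ((a *GI (ζ *GI ζ)) -GI ((β *GI ζ) +GI (β *GI ζ))) c) (≡.cong (λ z → z G.- ιG c)
      (≡.trans (ιG-- (a *GI (ζ *GI ζ)) ((β *GI ζ) +GI (β *GI ζ))) (≡.cong₂ G._-_
        (≡.trans (ιG-* a (ζ *GI ζ)) (≡.cong (λ z → ιG a G.* z) (ιG-* ζ ζ)))
        (≡.trans (ιG-+ (β *GI ζ) (β *GI ζ)) (≡.cong₂ G._+_ (ιG-* β ζ) (ιG-* β ζ))))))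

  -- Completing the square turns a zero ζ into (a ζ - β)² = D, a square root in ℚ(i).
  polynomial≢0 : ∀ a β c ζ → (β *GI β) +GI (a *GI c) ≡ D → polynomial a β c ζ ≢ 0GI
  polynomial≢0 a β c ζ e h = noRoot (s , ≡.trans (*G≡* s s) (≋⇒≡ (Square.complete ℚi (ιG a) (ιG β) (ιG c) (ιG ζ) (ιG D)
    (≡⇒≋ (≡.trans (≡.sym (≡.trans (ιG-+ (β *GI β) (a *GI c)) (≡.cong₂ G._+_ (ιG-* β β) (ιG-* a c)))) (≡.cong ιG e)))
    (≡⇒≋ (≡.trans (≡.sym (ιG-polynomial a β c ζ)) (≡.cong ιG h))))))
    where
    s : GQ
    s = ιG a G.* ιG ζ G.- ιG β

module NormIdentities (F : ℚAlgebra) where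
  open ℚAlgebra F
  open Quadratic F (κ -[1+ 0 ]) using (quadratic)
  private module C = ℚAlgebra quadratic

  nrm : Carrier × Carrier → Carrier
  nrm (x , y) = x * x + y * y

  nrm-cong : ∀ {x y} → x C.≈ y → nrm x ≈ nrm y
  nrm-cong (e , f) = +-cong (*-cong e e) (*-cong f f)

  nrm-* : ∀ x y → nrm (x C.* y) ≈ nrm x * nrm y
  nrm-* (a , b) (c , d) = solve 4 (λ a b c d →
    (a :* c :+ con -[1+ 0 ] :* (b :* d)) :* (a :* c :+ con -[1+ 0 ] :* (b :* d)) :+ (a :* d :+ b :* c) :*
      (a :* d :+ b :* c)
    := (a :* a :+ b :* b) :* (c :* c :+ d :* d)) a b c d

negGI-involutive : ∀ g → negGI (negGI g) ≡ g
negGI-involutive (x , y) = ≡.cong₂ _,_ (ℤP.neg-involutive x) (ℤP.neg-involutive y)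

-- The value is forced: with β' = -(β + c w) the quotient (D - β'²)/c is exact and expands to a - 2β
-- w - c w².
next-c : GI → GI → GI → GI → GI
next-c a β c w = (a -GI ((β *GI w) +GI (β *GI w))) -GI (c *GI (w *GI w))

next-disc : ∀ a β c w → let β' = negGI (β +GI (c *GI w)) in
            (β' *GI β') +GI (c *GI next-c a β c w) ≡ (β *GI β) +GI (a *GI c)
next-disc (a , a') (b , b') (c , c') (w , w') = ≡.cong₂ _,_
  (Z.solve 8 (λ a a' b b' c c' w w' → let A = (a , a') ; B = (b , b') ; C = (c , c') ; W = (w , w') ; B' = neg (B ⊕ C ⊗ W) in
    proj₁ (B' ⊗ B' ⊕ C ⊗ ((A ⊖ (B ⊗ W ⊕ B ⊗ W)) ⊖ C ⊗ (W ⊗ W))) Z.:= proj₁ (B ⊗ B ⊕ A ⊗ C)) ≡.refl a a' b b' c c' w w')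
  (Z.solve 8 (λ a a' b b' c c' w w' → let A = (a , a') ; B = (b , b') ; C = (c , c') ; W = (w , w') ; B' = neg (B ⊕ C ⊗ W) in
    proj₂ (B' ⊗ B' ⊕ C ⊗ ((A ⊖ (B ⊗ W ⊕ B ⊗ W)) ⊖ C ⊗ (W ⊗ W))) Z.:= proj₂ (B ⊗ B ⊕ A ⊗ C)) ≡.refl a a' b b' c c' w w')

start-disc : ∀ w D → (negGI w *GI negGI w) +GI ((+ 1 , + 0) *GI (D -GI (w *GI w))) ≡ D
start-disc (w , w') (d , d') = ≡.cong₂ _,_
  (Z.solve 4 (λ w w' d d' → let W = (w , w') ; D = (d , d') in proj₁ (neg W ⊗ neg W ⊕ (Z.con (+ 1) , Z.con (+ 0)) ⊗ (D ⊖ W ⊗ W)) Z.:= d) ≡.refl w w' d d')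
  (Z.solve 4 (λ w w' d d' → let W = (w , w') ; D = (d , d') in proj₂ (neg W ⊗ neg W ⊕ (Z.con (+ 1) , Z.con (+ 0)) ⊗ (D ⊖ W ⊗ W)) Z.:= d') ≡.refl w w' d d')

private
  +-cancelʳ : ∀ (x y z : ℤ) → x ℤ.+ z ≡ y ℤ.+ z → x ≡ y
  +-cancelʳ x y z e = ≡.trans (lemma x) (≡.trans (≡.cong (λ u → u ℤ.- z) e) (≡.sym (lemma y)))
    where
    lemma : ∀ x → x ≡ x ℤ.+ z ℤ.- z
    lemma x = Z.solve 2 (λ x z → x Z.:= x Z.:+ z Z.:- z) ≡.refl x z

+GI-cancelʳ : ∀ g h k → g +GI k ≡ h +GI k → g ≡ h
+GI-cancelʳ (x , y) (x' , y') (z , w) e = ≡.cong₂ _,_ (+-cancelʳ x x' z (≡.cong proj₁ e))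
    (+-cancelʳ y y' w (≡.cong proj₂ e))

negGI-injective : ∀ g h → negGI g ≡ negGI h → g ≡ h
negGI-injective g h e = ≡.trans (≡.sym (negGI-involutive g)) (≡.trans (≡.cong negGI e) (negGI-involutive h))

advance : GI → GI → GI → GI → GI × GI × GI
advance a β c w = c , negGI (β +GI (c *GI w)) , next-c a β c w

-- The next triple displays c; with w known, its second entry returns β and its third a. Hence
-- recovering w is the only real difficulty for injectivity.
advance-injective : ∀ a β c w a' β' c' w' → w ≡ w' → advance a β c w ≡ advance a' β' c' w' → (a , β , c) ≡
    (a' , β' , c')
advance-injective a β c w a' β' c' .w ≡.refl e = same-c c' (≡.cong proj₁ e) (≡.cong (λ s → proj₁ (proj₂ s)) e)
    (≡.cong (λ s → proj₂ (proj₂ s)) e)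
  where
  same-β : ∀ β' → β ≡ β' → next-c a β c w ≡ next-c a' β' c w → (a , β , c) ≡ (a' , β' , c)
  same-β .β ≡.refl q = ≡.cong (_, (β , c)) (+GI-cancelʳ a a' (negGI ((β *GI w) +GI (β *GI w)))
    (+GI-cancelʳ (a -GI ((β *GI w) +GI (β *GI w))) (a' -GI ((β *GI w) +GI (β *GI w))) (negGI (c *GI (w *GI w))) q))
  same-c : ∀ c' → c ≡ c' → negGI (β +GI (c *GI w)) ≡ negGI (β' +GI (c' *GI w)) → next-c a β c w ≡ next-c a' β' c' w →
      (a , β , c) ≡ (a' , β' , c')
  same-c .c ≡.refl p q = same-β β' (+GI-cancelʳ β β' (c *GI w)
      (negGI-injective (β +GI (c *GI w)) (β' +GI (c *GI w)) p)) q

-- Finiteness of bounded sets of Gaussian integers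

Bounded : ℕ → GI → Set
Bounded M (x , y) = ℤ.∣ x ∣ ℕ.≤ M × ℤ.∣ y ∣ ℕ.≤ M

private
  norm-∣∣ : ∀ x y → normGI (x , y) ≡ + (ℤ.∣ x ∣ ℕ.* ℤ.∣ x ∣ ℕ.+ ℤ.∣ y ∣ ℕ.* ℤ.∣ y ∣)
  norm-∣∣ x y = ≡.cong₂ ℤ._+_ (square x) (square y)
    where
    square : ∀ x → x ℤ.* x ≡ + (ℤ.∣ x ∣ ℕ.* ℤ.∣ x ∣)
    square (+ k) = ≡.sym (ℤP.pos-* k k)
    square -[1+ k ] = ≡.refl

  k≤k² : ∀ k → k ℕ.≤ k ℕ.* k
  k≤k² zero = ℕ.z≤n
  k≤k² (suc k) = ℕP.m≤m*n (suc k) (suc k)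

norm-bounded : ∀ g M → normGI g ℤ.≤ + M → Bounded M g
norm-bounded (x , y) M h = ℕP.≤-trans (k≤k² ℤ.∣ x ∣) (ℕP.≤-trans (ℕP.m≤m+n _ _) h′)
                         , ℕP.≤-trans (k≤k² ℤ.∣ y ∣) (ℕP.≤-trans (ℕP.m≤n+m _ _) h′)
  where
  h′ : ℤ.∣ x ∣ ℕ.* ℤ.∣ x ∣ ℕ.+ ℤ.∣ y ∣ ℕ.* ℤ.∣ y ∣ ℕ.≤ M
  h′ = ℤP.drop‿+≤+ (≡.subst (ℤ._≤ + M) (norm-∣∣ x y) h)

*GI-bounded : ∀ {A B g h} → Bounded A g → Bounded B h → Bounded (A ℕ.* B ℕ.+ A ℕ.* B) (g *GI h)
*GI-bounded {A} {B} {x , y} {x' , y'} (p , q) (p' , q') =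
    ℕP.≤-trans (ℤP.∣i-j∣≤∣i∣+∣j∣ (x ℤ.* x') (y ℤ.* y')) (ℕP.+-mono-≤ (prod x x' p p') (prod y y' q q'))
  , ℕP.≤-trans (ℤP.∣i+j∣≤∣i∣+∣j∣ (x ℤ.* y') (y ℤ.* x')) (ℕP.+-mono-≤ (prod x y' p q') (prod y x' q p'))
  where
  prod : ∀ {A B} x y → ℤ.∣ x ∣ ℕ.≤ A → ℤ.∣ y ∣ ℕ.≤ B → ℤ.∣ x ℤ.* y ∣ ℕ.≤ A ℕ.* B
  prod x y p q = ≡.subst (ℕ._≤ _) (≡.sym (ℤP.∣i*j∣≡∣i∣*∣j∣ x y)) (ℕP.*-mono-≤ p q)

-GI-bounded : ∀ {A B g h} → Bounded A g → Bounded B h → Bounded (A ℕ.+ B) (g -GI h)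
-GI-bounded {g = x , y} {x' , y'} (p , q) (p' , q') =
    ℕP.≤-trans (ℤP.∣i-j∣≤∣i∣+∣j∣ x x') (ℕP.+-mono-≤ p p')
  , ℕP.≤-trans (ℤP.∣i-j∣≤∣i∣+∣j∣ y y') (ℕP.+-mono-≤ q q')

-- The norm of β² is the square of the norm of β, and a natural number is at most its own square.
sqrt-bounded : ∀ {M} β → Bounded M (β *GI β) → Bounded (M ℕ.* M ℕ.+ M ℕ.* M) β
sqrt-bounded {M} β@(x , y) (p , q) = norm-bounded β _ (ℤP.≤-trans
    (small (ℤ.∣ x ∣ ℕ.* ℤ.∣ x ∣ ℕ.+ ℤ.∣ y ∣ ℕ.* ℤ.∣ y ∣) (norm-∣∣ x y))
    (≡.subst (ℤ._≤ + (M ℕ.* M ℕ.+ M ℕ.* M)) (≡.trans (≡.sym (norm-∣∣ (proj₁ (β *GI β)) (proj₂ (β *GI β)))) norm-β²)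
      (ℤ.+≤+ (ℕP.+-mono-≤ (ℕP.*-mono-≤ p p) (ℕP.*-mono-≤ q q)))))
  where
  norm-β² : normGI (β *GI β) ≡ normGI β ℤ.* normGI β
  norm-β² = Z.solve 2 (λ x y → (x Z.:* x Z.:- y Z.:* y) Z.:* (x Z.:* x Z.:- y Z.:* y) Z.:+ (x Z.:* y Z.:+ y Z.:* x)
      Z.:* (x Z.:* y Z.:+ y Z.:* x)
              Z.:= (x Z.:* x Z.:+ y Z.:* y) Z.:* (x Z.:* x Z.:+ y Z.:* y)) ≡.refl x y
  small : ∀ k → normGI β ≡ + k → normGI β ℤ.≤ normGI β ℤ.* normGI β
  small k e = ≡.subst (λ z → z ℤ.≤ z ℤ.* z) (≡.sym e) (≡.subst (+ k ℤ.≤_) (ℤP.pos-* k k) (ℤ.+≤+ (k≤k² k)))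

module _ (M : ℕ) where
  private
    code : ∀ z → ℤ.∣ z ∣ ℕ.≤ M → Fin (2 ℕ.* suc M)
    code (+ k) h = Fin.combine {2} {suc M} Fin.zero (Fin.fromℕ< (ℕ.s≤s h))
    code -[1+ k ] h = Fin.combine {2} {suc M} (Fin.suc Fin.zero) (Fin.fromℕ< (ℕ.s≤s h))

    code-injective : ∀ z z' p q → code z p ≡ code z' q → z ≡ z'
    code-injective (+ k) (+ l) p q e = ≡.cong +_ (FP.fromℕ<-injective _ _ (ℕ.s≤s p) (ℕ.s≤s q)
        (proj₂ (FP.combine-injective {2} {suc M} Fin.zero (Fin.fromℕ< (ℕ.s≤s p)) Fin.zero (Fin.fromℕ< (ℕ.s≤s q)) e)))
    code-injective -[1+ k ] -[1+ l ] p q e = ≡.cong -[1+_]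
        (ℕP.suc-injective (FP.fromℕ<-injective _ _ (ℕ.s≤s p) (ℕ.s≤s q)
        (proj₂ (FP.combine-injective {2} {suc M} (Fin.suc Fin.zero) (Fin.fromℕ< (ℕ.s≤s p)) (Fin.suc Fin.zero)
        (Fin.fromℕ< (ℕ.s≤s q)) e))))
    code-injective (+ k) -[1+ l ] p q e with () ← proj₁
        (FP.combine-injective {2} {suc M} Fin.zero (Fin.fromℕ< (ℕ.s≤s p)) (Fin.suc Fin.zero) (Fin.fromℕ< (ℕ.s≤s q)) e)
    code-injective -[1+ k ] (+ l) p q e with () ← proj₁
        (FP.combine-injective {2} {suc M} (Fin.suc Fin.zero) (Fin.fromℕ< (ℕ.s≤s p)) Fin.zero (Fin.fromℕ< (ℕ.s≤s q)) e)

  codeGI : ∀ g → Bounded M g → Fin (2 ℕ.* suc M ℕ.* (2 ℕ.* suc M))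
  codeGI (x , y) (p , q) = Fin.combine (code x p) (code y q)

  codeGI-injective : ∀ g h p q → codeGI g p ≡ codeGI h q → g ≡ h
  codeGI-injective (x , y) (x' , y') (p , q) (p' , q') e = let e₁ , e₂ = FP.combine-injective (code x p) (code y q) (code x' p') (code y' q') e in
    ≡.cong₂ _,_ (code-injective x x' p p' e₁) (code-injective y y' q q' e₂)

-- Pure periodicity from injectivity along an orbit

module _ {A : Set} (f : A → A) (t : ℕ → A) (orbit : ∀ k → t (suc k) ≡ f (t k))
         (injective : ∀ i j → f (t i) ≡ f (t j) → t i ≡ t j) where

  -- Injectivity pulls the coincidence at index i back to index 0, removing the preperiod;
  -- determinism then carries it forward to every k.
  periodic-from-start : ∀ i l → t i ≡ t (i ℕ.+ l) → ∀ k → t (k ℕ.+ l) ≡ t k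
  periodic-from-start zero l e zero = ≡.sym e
  periodic-from-start zero l e (suc k) = ≡.trans (orbit (k ℕ.+ l))
      (≡.trans (≡.cong f (periodic-from-start zero l e k)) (≡.sym (orbit k)))
  periodic-from-start (suc i) l e = periodic-from-start i l
      (injective i (i ℕ.+ l) (≡.trans (≡.sym (orbit i)) (≡.trans e (orbit (i ℕ.+ l)))))

  purely-periodic : ∀ {M} (code : ℕ → Fin M) → (∀ i j → code i ≡ code j → t i ≡ t j) →
                    ∃ λ l → 1 ℕ.≤ l × (∀ k → t (k ℕ.+ l) ≡ t k)
  purely-periodic {M} code code-injective with FP.pigeonhole (ℕP.n<1+n M) (λ (i : Fin (suc M)) → code (Fin.toℕ i))
  ... | i , j , i<j , e = Fin.toℕ j ℕ.∸ Fin.toℕ i , ℕP.m<n⇒0<n∸m i<j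
      , periodic-from-start (Fin.toℕ i) _ (≡.trans (code-injective _ _ e)
        (≡.cong t (≡.sym (ℕP.m+[n∸m]≡n (ℕP.<⇒≤ i<j)))))

-- The floor function read in the ordered model

module Hurwitz (m n : ℤ) (model : SqrtModel m n) where
  open SqrtModel model
  open OrderedTheory ordered
  open QuadraticField m n
  open NormIdentities algebra
  open Reals m n using (val; Pos; _-L_; _+L_; scaleL; constL; _<L_; _≤L_; _≈L_; CL; halfL; m½L; coords; coordsRot; mulGI; subGI;
    InXo; InXbar; ShapeA; ShapeB; InQ; InLA; InLB; toCL; sgn; ε; InZi; FloorH; HStep; PurelyPeriodic)
  open import Relation.Binary.Reasoning.Setoid setoid

  private
    φ-two : φ two ≈ κ (+ 2)
    φ-two = sym (κ≈φι (+ 2))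
    φS : r * r ≈ φ (ι m ℚ.* ι m ℚ.+ ι n ℚ.* ι n)
    φS = trans r² (sym (trans (φ-+ (ι m ℚ.* ι m) (ι n ℚ.* ι n)) (+-cong
      (trans (φ-* (ι m) (ι m)) (sym (*-cong (κ≈φι m) (κ≈φι m))))
        (trans (φ-* (ι n) (ι n)) (sym (*-cong (κ≈φι n) (κ≈φι n)))))))
    φ-2a² : ∀ a → φ (two ℚ.* (a ℚ.* a)) ≈ κ (+ 2) * (φ a * φ a)
    φ-2a² a = trans (φ-* two (a ℚ.* a)) (*-cong φ-two (φ-* a a))

  module P = Cut (ι m ℚ.* ι m ℚ.+ ι n ℚ.* ι n) p r (κ m) p≥0 r≥0 φS 2p²
    (λ a → two ℚ.* (a ℚ.* a) ℚ.- ι m)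
    (λ a → trans (φ-- (two ℚ.* (a ℚ.* a)) (ι m)) (+-cong (φ-2a² a) (-‿cong (sym (κ≈φι m)))))
  module Q = Cut (ι m ℚ.* ι m ℚ.+ ι n ℚ.* ι n) q r (- κ m) q≥0 r≥0 φS 2q²
    (λ a → two ℚ.* (a ℚ.* a) ℚ.+ ι m)
    (λ a → trans (φ-+ (two ℚ.* (a ℚ.* a)) (ι m)) (+-cong (φ-2a² a)
      (trans (sym (κ≈φι m)) (solve 1 (λ x → x := :- (:- x)) (κ m)))))

  ev : Lin → Carrier
  ev (a , b , c) = φ a + φ b * p + φ c * q

  ev-+ : ∀ e f → ev (e +L f) ≈ ev e + ev f
  ev-+ (a , b , c) (a' , b' , c') = trans
    (+-cong (+-cong (φ-+ a a') (*-congʳ (φ-+ b b'))) (*-congʳ (φ-+ c c')))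
    (solve 8 (λ a b c a' b' c' p q → (a :+ a') :+ (b :+ b') :* p :+ (c :+ c') :* q
      := (a :+ b :* p :+ c :* q) :+ (a' :+ b' :* p :+ c' :* q)) (φ a) (φ b) (φ c) (φ a') (φ b') (φ c') p q)

  ev-- : ∀ e f → ev (e -L f) ≈ ev e - ev f
  ev-- (a , b , c) (a' , b' , c') = trans
    (+-cong (+-cong (φ-- a a') (*-congʳ (φ-- b b'))) (*-congʳ (φ-- c c')))
    (solve 8 (λ a b c a' b' c' p q → (a :- a') :+ (b :- b') :* p :+ (c :- c') :* q
      := (a :+ b :* p :+ c :* q) :- (a' :+ b' :* p :+ c' :* q)) (φ a) (φ b) (φ c) (φ a') (φ b') (φ c') p q)

  ev-scale : ∀ k e → ev (scaleL k e) ≈ φ k * ev e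
  ev-scale k (a , b , c) = trans
    (+-cong (+-cong (φ-* k a) (*-congʳ (φ-* k b))) (*-congʳ (φ-* k c)))
    (solve 6 (λ k a b c p q → (k :* a) :+ (k :* b) :* p :+ (k :* c) :* q
      := k :* (a :+ b :* p :+ c :* q)) (φ k) (φ a) (φ b) (φ c) p q)

  ev-const : ∀ k → ev (constL k) ≈ φ k
  ev-const k = trans (+-cong (+-congˡ (trans (*-congʳ φ-0) (zeroˡ p))) (trans (*-congʳ φ-0) (zeroˡ q)))
    (trans (+-identityʳ _) (+-identityʳ _))

  private
    affine : Lin → Carrier → Carrier → Carrier
    affine (a , b , c) x y = φ a + φ b * x + φ c * y

    φ-val : ∀ e x y → φ (val e x y) ≈ affine e (φ x) (φ y)
    φ-val (a , b , c) x y = trans (φ-+ (a ℚ.+ b ℚ.* x) (c ℚ.* y))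
      (+-cong (trans (φ-+ a (b ℚ.* x)) (+-congˡ (φ-* b x))) (φ-* c y))

    interpolate : ∀ {a a' s f f'} → PP (s - a) → PP (a' - s) → PP f → PP f' → PP ((a' - s) * f + (s - a) * f')
    interpolate x y u v = PP-+ˡ (PP-* y u) (PP⇒NN (PP-* x v))

    between : ∀ {a a' s} → PP (s - a) → PP (a' - s) → PP (a' - a)
    between {a} {a'} {s} x y = PP-resp (solve 3 (λ a a' s → (s :- a) :+ (a' :- s) := a' :- a) a a' s)
        (PP-+ˡ x (PP⇒NN y))

  -- The function is affine in each variable, so its value at (p , q) is a convex combination of the
  -- four corner values: first along the edges in p, then between them in q.
  Pos-sound : ∀ e → Pos e → PP (ev e)
  Pos-sound e@(c₀ , c₁ , c₂) (a , a' , b , b' , la , ua , lb , ub , v , v' , w , w') =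
    PP-cancel {φ b' - φ b} (PP⇒NN (between (Q.lower-sound lb) (Q.upper-sound ub))) (PP-resp
      (solve 7 (λ c₀ c₁ c₂ p q b b' →
         (b' :- q) :* (c₀ :+ c₁ :* p :+ c₂ :* b) :+ (q :- b) :* (c₀ :+ c₁ :* p :+ c₂ :* b')
         := (b' :- b) :* (c₀ :+ c₁ :* p :+ c₂ :* q)) (φ c₀) (φ c₁) (φ c₂) p q (φ b) (φ b'))
      (interpolate (Q.lower-sound lb) (Q.upper-sound ub) (edge v w) (edge v' w')))
    where
    edge : ∀ {y} → 0ℚ ℚ.< val e a y → 0ℚ ℚ.< val e a' y → PP (affine e p (φ y))
    edge {y} v w = PP-cancel {φ a' - φ a} (PP⇒NN (between (P.lower-sound la) (P.upper-sound ua))) (PP-resp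
      (solve 7 (λ c₀ c₁ c₂ p y a a' →
         (a' :- p) :* (c₀ :+ c₁ :* a :+ c₂ :* y) :+ (p :- a) :* (c₀ :+ c₁ :* a' :+ c₂ :* y)
         := (a' :- a) :* (c₀ :+ c₁ :* p :+ c₂ :* y)) (φ c₀) (φ c₁) (φ c₂) p (φ y) (φ a) (φ a'))
      (interpolate (P.lower-sound la) (P.upper-sound ua)
        (PP-resp (φ-val e a y) (0<⇒PP v)) (PP-resp (φ-val e a' y) (0<⇒PP w))))

  private
    abs-bound : ∀ c → ∃ λ k → NN (κ (+ k) - c) × NN (κ (+ k) + c)
    abs-bound c = let k , h = arch 1# c PP-1 ; l , h' = arch 1# (- c) PP-1 in
      k ℕ.+ l
      , NN-resp (sym (trans (+-congʳ (κ-+ (+ k) (+ l)))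
        (trans (solve 4 (λ k l c o → (k :+ l) :- c := (k :- c) :+ l) (κ (+ k)) (κ (+ l)) c 1#)
          (+-congʳ (+-congʳ (sym (*-identityʳ (κ (+ k)))))))))
          (NN-+ h (NN-κ l))
      , NN-resp (sym (trans (+-congʳ (κ-+ (+ k) (+ l)))
        (trans (solve 4 (λ k l c o → (k :+ l) :+ c := (l :- (:- c)) :+ k) (κ (+ k)) (κ (+ l)) c 1#)
          (+-congʳ (+-congʳ (sym (*-identityʳ (κ (+ l)))))))))
          (NN-+ h' (NN-κ k))

    slope-bound : ∀ {c k δ w} → NN (k - c) → NN (k + c) → NN (w + δ) → NN (w - δ) → NN (k * w + c * δ)
    slope-bound {c} {k} {δ} {w} h h' n n' = NN-cancel (PP-κ 1) (NN-resp
      (solve 4 (λ c k δ w → (w :+ δ) :* (k :+ c) :+ (w :- δ) :* (k :- c) := con (+ 2) :* (k :* w :+ c :* δ)) c k δ w)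
      (NN-+ (NN-* n h') (NN-* n' h)))

  private
    module Box (c₀ c₁ c₂ : ℚ) (N k₁ k₂ : ℕ) (ε : ℚ) (0<ε : 0ℚ ℚ.< ε)
               (ε-inverse : (κ (+ 1) + κ (+ N) * (κ (+ 2) * (κ (+ k₁) + κ (+ k₂)))) * φ ε ≈ 1#)
               (hN : NN (κ (+ N) * ev (c₀ , c₁ , c₂) - 1#))
               (h₁ : NN (κ (+ k₁) - φ c₁)) (h₁′ : NN (κ (+ k₁) + φ c₁))
               (h₂ : NN (κ (+ k₂) - φ c₂)) (h₂′ : NN (κ (+ k₂) + φ c₂)) where
      e : Lin
      e = c₀ , c₁ , c₂
      w : Carrier
      w = φ ε + φ ε
      C : Carrier
      C = κ (+ k₁) + κ (+ k₂)
      margin : PP (ev e - w * C)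
      margin = PP-cancel (NN-κ N) (PP-resp
        (trans (+-congˡ (+-congˡ (+-congˡ (-‿cong (sym ε-inverse))))) eq)
        (PP-+ʳ hN (PP-+ˡ (0<⇒PP 0<ε) (NN-resp (sym (-‿inverseʳ 1#)) NN-0))))
        where
        eq : κ (+ N) * ev e - 1# + (φ ε + (1# - (κ (+ 1) + κ (+ N) * (κ (+ 2) * C)) * φ ε)) ≈ κ (+ N) * (ev e - w * C)
        eq = solve 5 (λ N E o ε C → N :* E :- o :+ (ε :+ (o :- (con (+ 1) :+ N :* (con (+ 2) :* C)) :* ε))
               := N :* (E :- (ε :+ ε) :* C)) (κ (+ N)) (ev e) 1# (φ ε) C
      corner : ∀ {x y} → NN (w + (φ x - p)) → NN (w - (φ x - p)) → NN (w + (φ y - q)) → NN (w - (φ y - q)) → 0ℚ ℚ.<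
          val e x y
      corner {x} {y} n₁ n₂ n₃ n₄ = PP⇒0< (PP-resp
        (trans (solve 10 (λ c₀ c₁ c₂ p q x y w k₁ k₂ →
           ((c₀ :+ c₁ :* p :+ c₂ :* q) :- w :* (k₁ :+ k₂)) :+
             ((k₁ :* w :+ c₁ :* (x :- p)) :+ (k₂ :* w :+ c₂ :* (y :- q)))
           := c₀ :+ c₁ :* x :+ c₂ :* y) (φ c₀) (φ c₁) (φ c₂) p q (φ x) (φ y) w (κ (+ k₁)) (κ (+ k₂)))
             (sym (φ-val e x y)))
        (PP-+ˡ margin (NN-+ (slope-bound h₁ h₁′ n₁ n₂) (slope-bound h₂ h₂′ n₃ n₄))))
      build : P.Near ε → Q.Near ε → Pos e
      build (a , a' , la , ua , na , na') (b , b' , lb , ub , nb , nb') =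
        a , a' , b , b' , la , ua , lb , ub
        , corner na (below la P.lower-sound) nb (below lb Q.lower-sound)
        , corner na (below la P.lower-sound) (above ub Q.upper-sound) nb'
        , corner (above ua P.upper-sound) na' nb (below lb Q.lower-sound)
        , corner (above ua P.upper-sound) na' (above ub Q.upper-sound) nb'
        where
        w≥0 : NN w
        w≥0 = NN-+ (φ-NN (ℚP.<⇒≤ 0<ε)) (φ-NN (ℚP.<⇒≤ 0<ε))
        below : ∀ {x s} {L : ℚ → Set} → L x → (∀ {a} → L a → PP (s - φ a)) → NN (w - (φ x - s))
        below {x} {s} l sound = NN-resp (solve 3 (λ w x s → w :+ (s :- x) := w :- (x :- s)) w (φ x) s)
            (NN-+ w≥0 (PP⇒NN (sound l)))
        above : ∀ {x s} {U : ℚ → Set} → U x → (∀ {a} → U a → PP (φ a - s)) → NN (w + (φ x - s))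
        above u sound = NN-+ w≥0 (PP⇒NN (sound u))

  -- With N times the value at least 1, with k₁ and k₂ bounding the two slopes and ε = 1/(1 + 2N(k₁
  -- + k₂)), the function changes by at most 2ε(k₁ + k₂) over a box of tolerance 2ε. N times this
  -- change is below 1, so every corner value stays positive.
  Pos-complete : ∀ e → PP (ev e) → Pos e
  Pos-complete e@(c₀ , c₁ , c₂) pos =
    let N , hN = arch (ev e) 1# pos
        k₁ , h₁ , h₁′ = abs-bound (φ c₁)
        k₂ , h₂ , h₂′ = abs-bound (φ c₂)
        ε , 0<ε , inv = reciprocal (N ℕ.* (2 ℕ.* (k₁ ℕ.+ k₂)))
    in Box.build c₀ c₁ c₂ N k₁ k₂ ε 0<ε
         (trans (*-congʳ (sym (trans (κ-+ (+ 1) (+ (N ℕ.* (2 ℕ.* (k₁ ℕ.+ k₂)))))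
           (+-congˡ (trans (κ-pos-* N (2 ℕ.* (k₁ ℕ.+ k₂)))
           (*-congˡ (trans (κ-pos-* 2 (k₁ ℕ.+ k₂)) (*-congˡ (κ-+ (+ k₁) (+ k₂)))))))))) inv)
         hN h₁ h₁′ h₂ h₂′ (P.near ε 0<ε) (Q.near ε 0<ε)
    where
    reciprocal : ∀ t → ∃ λ ε → 0ℚ ℚ.< ε × κ (+ suc t) * φ ε ≈ 1#
    reciprocal t = ℚ.1/ T , ℚP.positive⁻¹ (ℚ.1/ T) {{ℚP.1/pos⇒pos T}}
      , trans (*-congʳ (κ≈φι (+ suc t))) (trans (sym (φ-* T (ℚ.1/ T)))
        (trans (reflexive (≡.cong φ (ℚP.*-inverseʳ T))) φ-1))
      where
      T : ℚ
      T = ι (+ suc t)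
      instance
        T>0 : ℚ.Positive T
        T>0 = ℚ.positive (ℚP.<-≤-trans (ℚP.positive⁻¹ 1ℚ) (ι-mono-≤ {+ 1} {+ suc t} (ℤ.+≤+ (ℕ.s≤s ℕ.z≤n))))
        T≢0 : ℚ.NonZero T
        T≢0 = ℚP.pos⇒nonZero T

  <L⇒PP : ∀ {e f} → e <L f → PP (ev f - ev e)
  <L⇒PP {e} {f} h = PP-resp (ev-- f e) (Pos-sound (f -L e) h)

  PP⇒<L : ∀ {e f} → PP (ev f - ev e) → e <L f
  PP⇒<L {e} {f} h = Pos-complete (f -L e) (PP-resp (sym (ev-- f e)) h)

  -- The relation `≤L` is only a negation; the decided sign in the model turns it into a positive
  -- statement.
  ≤L⇒NN : ∀ {e f} → e ≤L f → NN (ev f - ev e)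
  ≤L⇒NN {e} {f} h with NN⊎PP (ev f - ev e)
  ... | inj₁ n = n
  ... | inj₂ q = ⊥-elim (h (PP⇒<L {f} {e} (PP-resp (solve 2 (λ x y → :- (y :- x) := x :- y) (ev e) (ev f)) q)))

  NN⇒≤L : ∀ {e f} → NN (ev f - ev e) → e ≤L f
  NN⇒≤L {e} {f} n h = PP⇒¬NN- (solve 2 (λ x y → x :- y := :- (y :- x)) (ev e) (ev f)) (<L⇒PP {f} {e} h) n

  double : Lin → Carrier
  double u = κ (+ 2) * ev u

  private
    half² : κ (+ 2) * φ ½ ≈ κ (+ 1)
    half² = trans (*-congʳ (κ≈φι (+ 2))) (trans (sym (φ-* (ι (+ 2)) ½)) (trans φ-1 (sym κ-1)))

    ev-half : ev halfL ≈ φ ½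
    ev-half = ev-const ½

    ev-m½ : ev m½L ≈ - φ ½
    ev-m½ = trans (ev-const (ℚ.- ½)) (φ-neg ½)

    low : ∀ u → κ (+ 2) * (ev u - ev m½L) ≈ κ (+ 1) + double u
    low u = trans (*-congˡ (+-congˡ (-‿cong ev-m½))) (trans
      (solve 2 (λ u h → con (+ 2) :* (u :- (:- h)) := con (+ 2) :* h :+ con (+ 2) :* u) (ev u) (φ ½)) (+-congʳ half²))

    high : ∀ u → κ (+ 2) * (ev halfL - ev u) ≈ κ (+ 1) - double u
    high u = trans (*-congˡ (+-congʳ ev-half)) (trans
      (solve 2 (λ u h → con (+ 2) :* (h :- u) := con (+ 2) :* h :- con (+ 2) :* u) (ev u) (φ ½)) (+-congʳ half²))

    flip : ∀ {x y z} → κ (+ 2) * (x - y) ≈ z → κ (+ 2) * (y - x) ≈ - z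
    flip {x} {y} e = trans (solve 2 (λ x y → con (+ 2) :* (y :- x) := :- (con (+ 2) :* (x :- y))) x y) (-‿cong e)

    PP-double : ∀ {x y} → κ (+ 2) * x ≈ y → PP x → PP y
    PP-double e h = PP-resp e (PP-* (PP-κ 1) h)
    PP-halve : ∀ {x y} → κ (+ 2) * x ≈ y → PP y → PP x
    PP-halve e h = PP-cancel (NN-κ 2) (PP-resp (sym e) h)
    NN-double : ∀ {x y} → κ (+ 2) * x ≈ y → NN x → NN y
    NN-double e h = NN-resp e (NN-* (NN-κ 2) h)
    NN-halve : ∀ {x y} → κ (+ 2) * x ≈ y → NN y → NN x
    NN-halve e h = NN-cancel (PP-κ 1) (NN-resp (sym e) h)

  Xbar-sound : ∀ u v → InXbar (u , v) → Within (double u) × Within (double v)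
  Xbar-sound u v (a , b , c , d) = (NN-double (low u) (≤L⇒NN {m½L} {u} a) , NN-double (high u) (≤L⇒NN {u} {halfL} b))
                                 , (NN-double (low v) (≤L⇒NN {m½L} {v} c) , NN-double (high v) (≤L⇒NN {v} {halfL} d))

  Xbar-complete : ∀ u v → Within (double u) → Within (double v) → InXbar (u , v)
  Xbar-complete u v (a , b) (c , d) = NN⇒≤L {m½L} {u} (NN-halve (low u) a) , NN⇒≤L {u} {halfL} (NN-halve (high u) b)
                                    , NN⇒≤L {m½L} {v} (NN-halve (low v) c) , NN⇒≤L {v} {halfL} (NN-halve (high v) d)

  private
    low< : ∀ u → m½L <L u → NN (κ (+ 1) + double u)
    low< u h = PP⇒NN (PP-double (low u) (<L⇒PP {m½L} {u} h))
    high< : ∀ u → u <L halfL → NN (κ (+ 1) - double u)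
    high< u h = PP⇒NN (PP-double (high u) (<L⇒PP {u} {halfL} h))
    low≤ : ∀ u → m½L ≤L u → NN (κ (+ 1) + double u)
    low≤ u h = NN-double (low u) (≤L⇒NN {m½L} {u} h)
    high≤ : ∀ u → u ≤L halfL → NN (κ (+ 1) - double u)
    high≤ u h = NN-double (high u) (≤L⇒NN {u} {halfL} h)
    at-low : ∀ u → u ≈L m½L → Within (double u)
    at-low u (h , h′) = low≤ u h′ , NN-resp
      (solve 1 (λ x → (:- (con (+ 1) :+ x)) :+ con (+ 2) := con (+ 1) :- x) (double u))
      (NN-+ (NN-double (flip {ev u} {ev m½L} (low u)) (≤L⇒NN {u} {m½L} h)) (NN-κ 2))
    at-high : ∀ u → u ≈L halfL → Within (double u)
    at-high u (h , h′) = NN-resp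
      (solve 1 (λ x → (:- (con (+ 1) :- x)) :+ con (+ 2) := con (+ 1) :+ x) (double u))
      (NN-+ (NN-double (flip {ev halfL} {ev u} (high u)) (≤L⇒NN {halfL} {u} h′)) (NN-κ 2)) , high≤ u h

  ShapeA-sound : ∀ u v → ShapeA (u , v) → Within (double u) × Within (double v)
  ShapeA-sound u v (inj₁ (a , b , c , d)) = (low< u a , high< u b) , (low< v c , high< v d)
  ShapeA-sound u v (inj₂ (inj₁ (a , b , e))) = (low< u a , high≤ u b) , at-low v e
  ShapeA-sound u v (inj₂ (inj₂ (inj₁ (e , c , d)))) = at-high u e , (low≤ v c , high≤ v d)
  ShapeA-sound u v (inj₂ (inj₂ (inj₂ (a , b , e)))) = (low< u a , high≤ u b) , at-high v e

  ShapeB-sound : ∀ u v → ShapeB (u , v) → Within (double u) × Within (double v)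
  ShapeB-sound u v (inj₁ (a , b , c , d)) = (low< u a , high< u b) , (low< v c , high< v d)
  ShapeB-sound u v (inj₂ (inj₁ (a , b , e))) = (low< u a , high≤ u b) , at-high v e
  ShapeB-sound u v (inj₂ (inj₂ (e , c , d))) = at-high u e , (low< v c , high≤ v d)

  private
    mk-low< : ∀ u → PP (κ (+ 1) + double u) → m½L <L u
    mk-low< u h = PP⇒<L {m½L} {u} (PP-halve (low u) h)
    mk-high< : ∀ u → PP (κ (+ 1) - double u) → u <L halfL
    mk-high< u h = PP⇒<L {u} {halfL} (PP-halve (high u) h)
    mk-low≤ : ∀ u → NN (κ (+ 1) + double u) → m½L ≤L u
    mk-low≤ u h = NN⇒≤L {m½L} {u} (NN-halve (low u) h)
    mk-high≤ : ∀ u → NN (κ (+ 1) - double u) → u ≤L halfL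
    mk-high≤ u h = NN⇒≤L {u} {halfL} (NN-halve (high u) h)
    mk-at-low : ∀ u → NN (κ (+ 1) + double u) → NN (- (κ (+ 1) + double u)) → u ≈L m½L
    mk-at-low u a b = NN⇒≤L {u} {m½L} (NN-halve (flip {ev u} {ev m½L} (low u)) b) , mk-low≤ u a
    mk-at-high : ∀ u → NN (κ (+ 1) - double u) → NN (- (κ (+ 1) - double u)) → u ≈L halfL
    mk-at-high u a b = mk-high≤ u a , NN⇒≤L {halfL} {u} (NN-halve (flip {ev halfL} {ev u} (high u)) b)

  ShapeA-complete : ∀ u v → PP (κ (+ 1) + double u) → NN (κ (+ 1) - double u) → Within (double v) → ShapeA (u , v)
  ShapeA-complete u v a b (c , d) = cases (NN? (- (κ (+ 1) - double u))) (NN? (- (κ (+ 1) - double v)))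
      (NN? (- (κ (+ 1) + double v)))
    where
    cases : Dec (NN (- (κ (+ 1) - double u))) → Dec (NN (- (κ (+ 1) - double v))) → Dec
        (NN (- (κ (+ 1) + double v))) → ShapeA (u , v)
    cases (yes b′) _ _ = inj₂ (inj₂ (inj₁ (mk-at-high u b b′ , mk-low≤ v c , mk-high≤ v d)))
    cases (no _) (yes d′) _ = inj₂ (inj₂ (inj₂ (mk-low< u a , mk-high≤ u b , mk-at-high v d d′)))
    cases (no _) (no _) (yes c′) = inj₂ (inj₁ (mk-low< u a , mk-high≤ u b , mk-at-low v c c′))
    cases (no b′) (no d′) (no c′) = inj₁ (mk-low< u a , mk-high< u b′ , mk-low< v c′ , mk-high< v d′)

  ShapeB-complete : ∀ u v → PP (κ (+ 1) + double u) → NN (κ (+ 1) - double u) →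
                    PP (κ (+ 1) + double v) → NN (κ (+ 1) - double v) → ShapeB (u , v)
  ShapeB-complete u v a b c d = cases (NN? (- (κ (+ 1) - double u))) (NN? (- (κ (+ 1) - double v)))
    where
    cases : Dec (NN (- (κ (+ 1) - double u))) → Dec (NN (- (κ (+ 1) - double v))) → ShapeB (u , v)
    cases (yes b′) _ = inj₂ (inj₂ (mk-at-high u b b′ , mk-low< v c , mk-high≤ v d))
    cases (no _) (yes d′) = inj₂ (inj₁ (mk-low< u a , mk-high≤ u b , mk-at-high v d d′))
    cases (no b′) (no d′) = inj₁ (mk-low< u a , mk-high< u b′ , mk-low< v c , mk-high< v d′)

  diag anti : CL → Carrier
  diag (x , y) = ev x + ev y
  anti (x , y) = ev x - ev y

  private
    Within-neg : ∀ {x} → Within (- x) → Within x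
    Within-neg {x} (a , b) = NN-resp (solve 1 (λ x → con (+ 1) :- (:- x) := con (+ 1) :+ x) x) b , a

    half-double : ∀ e → double (scaleL ½ e) ≈ ev e
    half-double e = trans (*-congˡ (ev-scale ½ e)) (trans (sym (*-assoc _ _ _)) (trans (*-congʳ
      (trans (*-congʳ (κ≈φι (+ 2))) (trans (sym (φ-* (ι (+ 2)) ½)) φ-1))) (*-identityˡ _)))

    double-coords : ∀ z → double (proj₁ (coords z)) ≈ diag z × double (proj₂ (coords z)) ≈ anti z
    double-coords (x , y) = trans (half-double (x +L y)) (ev-+ x y) , trans (half-double (x -L y)) (ev-- x y)

    ev-ι : ∀ g x → ev (scaleL (ι g) x) ≈ κ g * ev x
    ev-ι g x = trans (ev-scale (ι g) x) (*-congʳ (sym (κ≈φι g)))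

    ev-mulGI : ∀ g h x y → ev (proj₁ (mulGI (g , h) (x , y))) ≈ κ g * ev x - κ h * ev y
                         × ev (proj₂ (mulGI (g , h) (x , y))) ≈ κ g * ev y + κ h * ev x
    ev-mulGI g h x y = trans (ev-- (scaleL (ι g) x) (scaleL (ι h) y)) (+-cong (ev-ι g x) (-‿cong (ev-ι h y)))
                     , trans (ev-+ (scaleL (ι g) y) (scaleL (ι h) x)) (+-cong (ev-ι g y) (ev-ι h x))

    -- The effect of multiplication by i⁻ᵏ on the pair (Re + Im , Re - Im).
    rotated : Fin 4 → Carrier → Carrier → Carrier × Carrier
    rotated 0F s t = s , t
    rotated 1F s t = - t , s
    rotated 2F s t = - s , - t
    rotated 3F s t = t , - s

    double-mul : ∀ g h z → let z′ = coords (mulGI (g , h) z) ; x = ev (proj₁ z) ; y = ev (proj₂ z) in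
                 double (proj₁ z′) ≈ (κ g * x - κ h * y) + (κ g * y + κ h * x)
               × double (proj₂ z′) ≈ (κ g * x - κ h * y) - (κ g * y + κ h * x)
    double-mul g h (x , y) = let d , d′ = double-coords (mulGI (g , h) (x , y)) ; e , e′ = ev-mulGI g h x y in
      trans d (+-cong e e′) , trans d′ (+-cong e (-‿cong e′))

    double-coordsRot : ∀ k z → double (proj₁ (coordsRot k z)) ≈ proj₁ (rotated k (diag z) (anti z))
                             × double (proj₂ (coordsRot k z)) ≈ proj₂ (rotated k (diag z) (anti z))
    double-coordsRot 0F z@(x , y) = let d , d′ = double-mul (+ 1) (+ 0) z in
        trans d (solve 2 (λ x y → (con (+ 1) :* x :- con (+ 0) :* y) :+ (con (+ 1) :* y :+ con (+ 0) :* x) := x :+ y)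
            (ev x) (ev y))
      , trans d′ (solve 2 (λ x y → (con (+ 1) :* x :- con (+ 0) :* y) :- (con (+ 1) :* y :+ con (+ 0) :* x) := x :-
        y) (ev x) (ev y))
    double-coordsRot 1F z@(x , y) = let d , d′ = double-mul (+ 0) -[1+ 0 ] z in
        trans d (solve 2 (λ x y → (con (+ 0) :* x :- con -[1+ 0 ] :* y) :+ (con (+ 0) :* y :+ con -[1+ 0 ] :* x) :=
            :- (x :- y)) (ev x) (ev y))
      , trans d′ (solve 2 (λ x y → (con (+ 0) :* x :- con -[1+ 0 ] :* y) :- (con (+ 0) :* y :+ con -[1+ 0 ] :* x) :=
        x :+ y) (ev x) (ev y))
    double-coordsRot 2F z@(x , y) = let d , d′ = double-mul -[1+ 0 ] (+ 0) z in
        trans d (solve 2 (λ x y → (con -[1+ 0 ] :* x :- con (+ 0) :* y) :+ (con -[1+ 0 ] :* y :+ con (+ 0) :* x) :=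
            :- (x :+ y)) (ev x) (ev y))
      , trans d′ (solve 2 (λ x y → (con -[1+ 0 ] :* x :- con (+ 0) :* y) :- (con -[1+ 0 ] :* y :+ con (+ 0) :* x) :=
        :- (x :- y)) (ev x) (ev y))
    double-coordsRot 3F z@(x , y) = let d , d′ = double-mul (+ 0) (+ 1) z in
        trans d (solve 2 (λ x y → (con (+ 0) :* x :- con (+ 1) :* y) :+ (con (+ 0) :* y :+ con (+ 1) :* x) := x :- y)
            (ev x) (ev y))
      , trans d′ (solve 2 (λ x y → (con (+ 0) :* x :- con (+ 1) :* y) :- (con (+ 0) :* y :+ con (+ 1) :* x) := :-
        (x :+ y)) (ev x) (ev y))

    ev-sub : ∀ x g → ev (x -L constL (ι g)) ≈ ev x - κ g
    ev-sub x g = trans (ev-- x (constL (ι g))) (+-congˡ (-‿cong (trans (ev-const (ι g)) (sym (κ≈φι g)))))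

    diag-sub : ∀ z U V → diag (subGI z (grid U V)) ≈ diag z - κ (+ 2) * κ U
    diag-sub (x , y) U V = trans (+-cong (trans (ev-sub x (U ℤ.+ V)) (+-congˡ (-‿cong (κ-+ U V)))) (trans (ev-sub y (U ℤ.- V)) (+-congˡ (-‿cong (κ-- U V)))))
      (solve 4 (λ x y u v → (x :- (u :+ v)) :+ (y :- (u :- v)) := (x :+ y) :- con (+ 2) :* u) (ev x) (ev y) (κ U) (κ V))

    anti-sub : ∀ z U V → anti (subGI z (grid U V)) ≈ anti z - κ (+ 2) * κ V
    anti-sub (x , y) U V = trans (+-cong (trans (ev-sub x (U ℤ.+ V)) (+-congˡ (-‿cong (κ-+ U V)))) (-‿cong (trans (ev-sub y (U ℤ.- V)) (+-congˡ (-‿cong (κ-- U V))))))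
      (solve 4 (λ x y u v → (x :- (u :+ v)) :- (y :- (u :- v)) := (x :- y) :- con (+ 2) :* v) (ev x) (ev y) (κ U) (κ V))

    unrotate : ∀ k s t → Within (proj₁ (rotated k s t)) → Within (proj₂ (rotated k s t)) → Within s × Within t
    unrotate 0F s t a b = a , b
    unrotate 1F s t a b = b , Within-neg a
    unrotate 2F s t a b = Within-neg a , Within-neg b
    unrotate 3F s t a b = Within-neg b , a

    unrotate-coords : ∀ k z → let u , v = coordsRot k z in
                      Within (double u) × Within (double v) → Within (diag z) × Within (anti z)
    unrotate-coords k z (a , b) = let e , e′ = double-coordsRot k z in
      unrotate k (diag z) (anti z) (Within-resp e a) (Within-resp e′ b)

  Remainder : CL → ℤ → ℤ → Set
  Remainder z U V = Within (diag z - κ (+ 2) * κ U) × Within (anti z - κ (+ 2) * κ V)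

  private
    remainder : ∀ z U V → Within (diag (subGI z (grid U V))) × Within (anti (subGI z (grid U V))) → Remainder z U V
    remainder z U V (a , b) = Within-resp (diag-sub z U V) a , Within-resp (anti-sub z U V) b

    axis-grid : ∀ k C → ∃ λ U → ∃ λ V → axis k C ≡ grid U V
    axis-grid 0F C = C , + 0 , ≡.refl
    axis-grid 1F C = + 0 , ℤ.- C , ≡.refl
    axis-grid 2F C = ℤ.- C , + 0 , ≡.refl
    axis-grid 3F C = + 0 , C , ≡.refl

    quadrant-grid : ∀ k C L → ∃ λ U → ∃ λ V → quadrant k C L ≡ grid U V
    quadrant-grid 0F C L = C , L , ≡.refl
    quadrant-grid 1F C L = L , ℤ.- C , ≡.refl
    quadrant-grid 2F C L = ℤ.- C , ℤ.- L , ≡.refl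
    quadrant-grid 3F C L = ℤ.- L , C , ≡.refl

    from-rotated : ∀ k z w U V → w ≡ grid U V → Within (double (proj₁ (coordsRot k (subGI z w)))) × Within
        (double (proj₂ (coordsRot k (subGI z w)))) →
                   Remainder z U V
    from-rotated k z _ U V ≡.refl h = remainder z U V (unrotate-coords k (subGI z (grid U V)) h)

  -- All shapes are reduced to the closed square around w: the estimates for the starting quotient
  -- use the bounds |s - 2U| ≤ 1 and |t - 2V| ≤ 1.
  InQ-sound : ∀ z w → InQ z w → ∃ λ U → ∃ λ V → w ≡ grid U V × Remainder z U V
  InQ-sound z w (inj₁ (e , h)) = + 0 , + 0 , e
    , (let d , d′ = double-coords z ; a , b = Xbar-sound (proj₁ (coords z)) (proj₂ (coords z)) h in
       Within-resp (trans d (sub-0 (diag z))) a , Within-resp (trans d′ (sub-0 (anti z))) b)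
    where
    sub-0 : ∀ x → x ≈ x - κ (+ 2) * κ (+ 0)
    sub-0 = solve 1 (λ x → x := x :- con (+ 2) :* con (+ 0))
  InQ-sound z w (inj₂ (inj₁ (k , (c , e) , h))) =
    let U , V , g = axis-grid k (+ suc c) ; e′ = ≡.trans e (≡.trans (axis-≡ k c) g) in
    U , V , e′ , from-rotated k z w U V e′ (ShapeA-sound (proj₁ (coordsRot k (subGI z w)))
        (proj₂ (coordsRot k (subGI z w))) h)
  InQ-sound z w (inj₂ (inj₂ (k , (c , l , e) , h))) =
    let U , V , g = quadrant-grid k (+ suc c) (+ suc l) ; e′ = ≡.trans e (≡.trans (quadrant-≡ k c l) g) in
    U , V , e′ , from-rotated k z w U V e′ (ShapeB-sound (proj₁ (coordsRot k (subGI z w)))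
        (proj₂ (coordsRot k (subGI z w))) h)

  private
    HalfOpen : Carrier → Set
    HalfOpen x = PP (κ (+ 1) + x) × NN (κ (+ 1) - x)

    HalfOpen-resp : ∀ {x y} → x ≈ y → HalfOpen x → HalfOpen y
    HalfOpen-resp e (a , b) = PP-resp (+-congˡ e) a , NN-resp (+-congˡ (-‿cong e)) b

    rotated-cong : ∀ k {s s' t t'} → s ≈ s' → t ≈ t' → proj₁ (rotated k s t) ≈ proj₁ (rotated k s' t') × proj₂
        (rotated k s t) ≈ proj₂ (rotated k s' t')
    rotated-cong 0F p q = p , q
    rotated-cong 1F p q = -‿cong q , p
    rotated-cong 2F p q = -‿cong p , -‿cong q
    rotated-cong 3F p q = q , -‿cong p

    rotated-sub : ∀ k z U V → let u , v = coordsRot k (subGI z (grid U V)) ; s , t = rotated k (diag z - κ (+ 2) * κ U) (anti z - κ (+ 2) * κ V) in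
                  s ≈ double u × t ≈ double v
    rotated-sub k z U V = let e , e′ = double-coordsRot k (subGI z (grid U V)) ; f , f′ = rotated-cong k (diag-sub z U V) (anti-sub z U V) in
      sym (trans e f) , sym (trans e′ f′)

    on-axis : ∀ k z U V → InLA k (grid U V) →
              let s , t = rotated k (diag z - κ (+ 2) * κ U) (anti z - κ (+ 2) * κ V) in
              HalfOpen s → Within t → InQ z (grid U V)
    on-axis k z U V c a b = let e , e′ = rotated-sub k z U V ; a₁ , a₂ = HalfOpen-resp e a in
      inj₂ (inj₁ (k , c , ShapeA-complete (proj₁ (coordsRot k (subGI z (grid U V))))
          (proj₂ (coordsRot k (subGI z (grid U V)))) a₁ a₂ (Within-resp e′ b)))

    in-quadrant : ∀ k z U V → InLB k (grid U V) →
              let s , t = rotated k (diag z - κ (+ 2) * κ U) (anti z - κ (+ 2) * κ V) in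
              HalfOpen s → HalfOpen t → InQ z (grid U V)
    in-quadrant k z U V c a b = let e , e′ = rotated-sub k z U V ; a₁ , a₂ = HalfOpen-resp e a ; b₁ , b₂ = HalfOpen-resp e′ b in
      inj₂ (inj₂ (k , c , ShapeB-complete (proj₁ (coordsRot k (subGI z (grid U V))))
          (proj₂ (coordsRot k (subGI z (grid U V)))) a₁ a₂ b₁ b₂))

    module _ {U s} (R : Rounds U s) where
      open Rounds R
      private
        δ : Carrier
        δ = s - κ (+ 2) * κ U
        δ≈- : κ (+ 1) + δ ≈ κ (+ 1) - (- δ)
        δ≈- = solve 1 (λ d → con (+ 1) :+ d := con (+ 1) :- (:- d)) δ
      positive : + 1 ℤ.≤ U → HalfOpen δ
      positive h = above h , proj₂ within
      negative : U ℤ.≤ -[1+ 0 ] → HalfOpen (- δ)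
      negative h = below h , NN-resp δ≈- (proj₁ within)
      opposite : Within (- δ)
      opposite = proj₂ within , NN-resp δ≈- (proj₁ within)

  -- After rotation by i⁻ᵏ every nonzero coordinate of w is positive, where rounding halves towards
  -- zero means the interval (-1, 1]; a zero coordinate allows all of [-1, 1]. The signs of U and V
  -- thus select the origin, shape A or shape B.
  InQ-complete : ∀ z U V → Rounds U (diag z) → Rounds V (anti z) → InQ z (grid U V)
  InQ-complete z U V R T = cases U V ≡.refl ≡.refl
    where
    place : ∀ {u v w} → u ≡ U → v ≡ V → w ≡ grid u v → grid U V ≡ w
    place p q e = ≡.trans (≡.cong₂ grid (≡.sym p) (≡.sym q)) (≡.sym e)
    up : ∀ {k W} → + suc k ≡ W → + 1 ℤ.≤ W
    up ≡.refl = ℤ.+≤+ (ℕ.s≤s ℕ.z≤n)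
    down : ∀ {k W} → -[1+ k ] ≡ W → W ℤ.≤ -[1+ 0 ]
    down ≡.refl = ℤ.-≤- ℕ.z≤n
    sub-0 : ∀ {W} x → + 0 ≡ W → x - κ (+ 2) * κ W ≈ x
    sub-0 x ≡.refl = solve 1 (λ x → x :- con (+ 2) :* con (+ 0) := x) x
    cases : ∀ u v → u ≡ U → v ≡ V → InQ z (grid U V)
    cases (+ zero) (+ zero) p q = inj₁ (≡.sym (≡.cong₂ grid p q) , Xbar-complete (proj₁ (coords z)) (proj₂ (coords z))
      (Within-resp (trans (sub-0 (diag z) p) (sym (proj₁ (double-coords z)))) (Rounds.within R))
      (Within-resp (trans (sub-0 (anti z) q) (sym (proj₂ (double-coords z)))) (Rounds.within T)))
    cases (+ suc k) (+ zero) p q = on-axis 0F z U V (k , place p q (axis-≡ 0F k)) (positive R (up p)) (Rounds.within T)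
    cases (+ zero) -[1+ k ] p q = on-axis 1F z U V (k , place p q (axis-≡ 1F k)) (negative T (down q)) (Rounds.within R)
    cases -[1+ k ] (+ zero) p q = on-axis 2F z U V (k , place p q (axis-≡ 2F k)) (negative R (down p)) (opposite T)
    cases (+ zero) (+ suc k) p q = on-axis 3F z U V (k , place p q (axis-≡ 3F k)) (positive T (up q)) (opposite R)
    cases (+ suc k) (+ suc l) p q = in-quadrant 0F z U V (k , l , place p q (quadrant-≡ 0F k l)) (positive R (up p)) (positive T (up q))
    cases (+ suc k) -[1+ l ] p q = in-quadrant 1F z U V (l , k , place p q (quadrant-≡ 1F l k)) (negative T (down q)) (positive R (up p))
    cases -[1+ k ] -[1+ l ] p q = in-quadrant 2F z U V (k , l , place p q (quadrant-≡ 2F k l)) (negative R (down p)) (negative T (down q))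
    cases -[1+ k ] (+ suc l) p q = in-quadrant 3F z U V (l , k , place p q (quadrant-≡ 3F l k)) (positive T (up q)) (negative R (down p))

  -- Complex values of elements of ℚ(i)(√D)

  module _ (σ : Bool) where

    complex : ℚAlgebra
    complex = Quadratic.quadratic algebra (κ -[1+ 0 ])

    module C = ℚAlgebra complex
    private module I = ConjugateIdentities complex

    P Q : Carrier
    P = φ (sgn σ) * p
    Q = φ (sgn σ) * (φ ε * q)

    halve : ∀ {x y} → κ (+ 2) * x ≈ κ (+ 2) * y → x ≈ y
    halve {x} {y} e = antisym
      (NN-cancel (PP-κ 1) (NN-resp (trans (trans (sym (-‿inverseʳ _)) (+-congʳ (sym e)))
        (solve 2 (λ x y → con (+ 2) :* x :- con (+ 2) :* y := con (+ 2) :* (x :- y)) x y)) NN-0))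
      (NN-cancel (PP-κ 1) (NN-resp (trans (trans (sym (-‿inverseʳ _)) (+-congʳ e))
        (solve 2 (λ x y → con (+ 2) :* x :- con (+ 2) :* y := con (+ 2) :* (x :- y)) y x)) NN-0))

    private
      square-sign : ∀ {e} → e ℚ.* e ≡ 1ℚ → φ e * φ e ≈ κ (+ 1)
      square-sign {e} h = trans (sym (φ-* e e)) (trans (reflexive (≡.cong φ h)) (trans φ-1 (sym κ-1)))

      sgn² : ∀ σ → sgn σ ℚ.* sgn σ ≡ 1ℚ
      sgn² true = ≡.refl
      sgn² false = ≡.refl

      ε² : ∀ n → signℚ n ℚ.* signℚ n ≡ 1ℚ
      ε² (+ _) = ≡.refl
      ε² -[1+ _ ] = ≡.refl

      ε∣n∣ : ∀ n → φ (signℚ n) * κ (+ ℤ.∣ n ∣) ≈ κ n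
      ε∣n∣ (+ k) = trans (*-congʳ φ-1) (*-identityˡ _)
      ε∣n∣ -[1+ k ] = trans (*-congʳ (trans (φ-neg 1ℚ) (-‿cong (trans φ-1 (sym κ-1))))) (trans
        (solve 1 (λ x → (:- con (+ 1)) :* x := :- x) (κ (+ suc k))) (sym (κ-neg (+ suc k))))

    2P² : κ (+ 2) * (P * P) ≈ r + κ m
    2P² = begin
      κ (+ 2) * (P * P)
        ≈⟨ solve 2 (λ s p → con (+ 2) :* ((s :* p) :* (s :* p)) := (s :* s) :* (con (+ 2) :* (p :* p))) (φ (sgn σ)) p ⟩
      φ (sgn σ) * φ (sgn σ) * (κ (+ 2) * (p * p))  ≈⟨ *-cong (square-sign (sgn² σ)) 2p² ⟩
      κ (+ 1) * (r + κ m)                          ≈⟨ solve 1 (λ x → con (+ 1) :* x := x) _ ⟩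
      r + κ m ∎

    2Q² : κ (+ 2) * (Q * Q) ≈ r - κ m
    2Q² = begin
      κ (+ 2) * (Q * Q)
        ≈⟨ solve 3 (λ s e q → con (+ 2) :* ((s :* (e :* q)) :* (s :* (e :* q))) := (s :* s) :*
          ((e :* e) :* (con (+ 2) :* (q :* q)))) (φ (sgn σ)) (φ ε) q ⟩
      φ (sgn σ) * φ (sgn σ) * (φ ε * φ ε * (κ (+ 2) * (q * q)))
          ≈⟨ *-cong (square-sign (sgn² σ)) (*-cong (square-sign (ε² n)) 2q²) ⟩
      κ (+ 1) * (κ (+ 1) * (r - κ m))              ≈⟨ solve 1 (λ x → con (+ 1) :* (con (+ 1) :* x) := x) _ ⟩
      r - κ m ∎

    2PQ : κ (+ 2) * (P * Q) ≈ κ n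
    2PQ = begin
      κ (+ 2) * (P * Q)
        ≈⟨ solve 4 (λ s p e q → con (+ 2) :* ((s :* p) :* (s :* (e :* q))) := (s :* s) :*
          (e :* (con (+ 2) :* (p :* q)))) (φ (sgn σ)) p (φ ε) q ⟩
      φ (sgn σ) * φ (sgn σ) * (φ ε * (κ (+ 2) * (p * q)))
          ≈⟨ *-cong (square-sign (sgn² σ)) (trans (*-congˡ 2pq) (ε∣n∣ n)) ⟩
      κ (+ 1) * κ n                                ≈⟨ solve 1 (λ x → con (+ 1) :* x := x) _ ⟩
      κ n ∎

    P²+Q² : P * P + Q * Q ≈ r
    P²+Q² = halve (begin
      κ (+ 2) * (P * P + Q * Q)                 ≈⟨ distribˡ _ _ _ ⟩
      κ (+ 2) * (P * P) + κ (+ 2) * (Q * Q)     ≈⟨ +-cong 2P² 2Q² ⟩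
      r + κ m + (r - κ m)                       ≈⟨ solve 2 (λ r m → r :+ m :+ (r :- m) := con (+ 2) :* r) r (κ m) ⟩
      κ (+ 2) * r ∎)

    root : Carrier × Carrier
    root = P , Q

    gaussian : GQ → Carrier × Carrier
    gaussian (a , b) = φ a , φ b

    ⟦_⟧ : GI → Carrier × Carrier
    ⟦ (a , b) ⟧ = κ a , κ b

    private
      φ-κ : ∀ z → φ (ℚA.κ z) ≈ κ z
      φ-κ z = trans (reflexive (≡.cong φ (ℚA.κ≈φι z))) (sym (κ≈φι z))

      gaussian-+ : ∀ x y → gaussian (x G.+ y) C.≈ gaussian x C.+ gaussian y
      gaussian-+ (a , b) (c , e) = φ-+ a c , φ-+ b e

      gaussian-* : ∀ x y → gaussian (x G.* y) C.≈ gaussian x C.* gaussian y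
      gaussian-* (a , b) (c , e) =
          trans (φ-+ (a ℚ.* c) (ℚA.κ -[1+ 0 ] ℚ.* (b ℚ.* e))) (+-cong (φ-* a c)
            (trans (φ-* (ℚA.κ -[1+ 0 ]) (b ℚ.* e)) (*-cong (φ-κ -[1+ 0 ]) (φ-* b e))))
        , trans (φ-+ (a ℚ.* e) (b ℚ.* c)) (+-cong (φ-* a e) (φ-* b c))

      gaussian-ι : ∀ g → gaussian (ιG g) C.≈ ⟦ g ⟧
      gaussian-ι (a , b) = sym (κ≈φι a) , sym (κ≈φι b)

    root² : root C.* root C.≈ ⟦ D ⟧
    root² = halve (begin
        κ (+ 2) * (P * P + κ -[1+ 0 ] * (Q * Q))
          ≈⟨ solve 2 (λ p q → con (+ 2) :* (p :+ con -[1+ 0 ] :* q) := con (+ 2) :* p :- con (+ 2) :* q) (P * P)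
            (Q * Q) ⟩
        κ (+ 2) * (P * P) - κ (+ 2) * (Q * Q)  ≈⟨ +-cong 2P² (-‿cong 2Q²) ⟩
        r + κ m - (r - κ m)                    ≈⟨ solve 2 (λ r m → r :+ m :- (r :- m) := con (+ 2) :* m) r (κ m) ⟩
        κ (+ 2) * κ m ∎)
      , (begin
        P * Q + Q * P                          ≈⟨ solve 2 (λ p q → p :* q :+ q :* p := con (+ 2) :* (p :* q)) P Q ⟩
        κ (+ 2) * (P * Q)                      ≈⟨ 2PQ ⟩
        κ n ∎)

    value : K → Carrier × Carrier
    value (a , b) = gaussian a C.+ gaussian b C.* root

    value-ev : ∀ k → ev (proj₁ (toCL σ k)) ≈ proj₁ (value k) × ev (proj₂ (toCL σ k)) ≈ proj₂ (value k)
    value-ev ((a₁ , a₂) , (b₁ , b₂)) =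
        trans (+-cong (+-congˡ (*-congʳ (φ-* b₁ (sgn σ))))
            (*-congʳ (trans (φ-neg (b₂ ℚ.* sgn σ ℚ.* ε))
            (-‿cong (trans (φ-* (b₂ ℚ.* sgn σ) ε) (*-congʳ (φ-* b₂ (sgn σ))))))))
          (solve 7 (λ a b c s e p q → a :+ (b :* s) :* p :+ (:- ((c :* s) :* e)) :* q
            := a :+ (b :* (s :* p) :+ con -[1+ 0 ] :* (c :* (s :* (e :* q))))) (φ a₁) (φ b₁) (φ b₂) (φ (sgn σ)) (φ ε)
              p q)
      , trans (+-cong (+-congˡ (*-congʳ (φ-* b₂ (sgn σ))))
        (*-congʳ (trans (φ-* (b₁ ℚ.* sgn σ) ε) (*-congʳ (φ-* b₁ (sgn σ))))))
          (solve 7 (λ a b c s e p q → a :+ (c :* s) :* p :+ ((b :* s) :* e) :* q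
            := a :+ (b :* (s :* (e :* q)) :+ c :* (s :* p))) (φ a₂) (φ b₁) (φ b₂) (φ (sgn σ)) (φ ε) p q)

    private
      C-trans : ∀ {x y z} → x C.≈ y → y C.≈ z → x C.≈ z
      C-trans {x} {y} {z} = C.trans {x} {y} {z}

    value-mul : ∀ x y → value (mulK m n x y) C.≈ value x C.* value y
    value-mul (a , b) (c , e) = C-trans (C.reflexive (≡.cong value (mulK≡ a b c e))) (C-trans
      (C.+-cong {gaussian (a G.* c G.+ b G.* e G.* ιG D)}
        {gaussian a C.* gaussian c C.+ gaussian b C.* gaussian e C.* gaussian (ιG D)}
        (C-trans (gaussian-+ (a G.* c) (b G.* e G.* ιG D))
          (C.+-cong {gaussian (a G.* c)} {gaussian a C.* gaussian c} (gaussian-* a c)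
          (C-trans (gaussian-* (b G.* e) (ιG D)) (C.*-congʳ {gaussian (ιG D)} {gaussian (b G.* e)}
            {gaussian b C.* gaussian e} (gaussian-* b e)))))
        (C.*-congʳ {root} {gaussian (a G.* e G.+ b G.* c)} {gaussian a C.* gaussian e C.+ gaussian b C.* gaussian c}
          (C-trans (gaussian-+ (a G.* e) (b G.* c)) (C.+-cong {gaussian (a G.* e)} {gaussian a C.* gaussian e}
            (gaussian-* a e) (gaussian-* b c)))))
      (I.multiply (gaussian a) (gaussian b) (gaussian c) (gaussian e) root (gaussian (ιG D))
        (C-trans root² (sym (proj₁ (gaussian-ι D)) , sym (proj₂ (gaussian-ι D))))))

    private
      value-0 : ∀ a → value (a , 0G) C.≈ gaussian a
      value-0 a = C-trans (C.+-congˡ {gaussian a} (C-trans (C.*-congʳ {root} {gaussian 0G} {C.0#} (φ-0 , φ-0))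
          (C.zeroˡ root))) (C.+-identityʳ (gaussian a))

    value-embed : ∀ g → value (embedGI g) C.≈ ⟦ g ⟧
    value-embed g = C-trans (value-0 (ιG g)) (gaussian-ι g)

    value-1 : value 1K C.≈ ⟦ (+ 1 , + 0) ⟧
    value-1 = value-embed (+ 1 , + 0)

    value-+ : ∀ x y → value (x +K y) C.≈ value x C.+ value y
    value-+ ((a₁ , a₂) , (b₁ , b₂)) ((c₁ , c₂) , (e₁ , e₂)) =
        trans (+-cong (φ-+ a₁ c₁) (+-cong (*-congʳ (φ-+ b₁ e₁)) (*-congˡ (*-congʳ (φ-+ b₂ e₂)))))
          (solve 8 (λ a c b e b' e' p q → (a :+ c) :+ ((b :+ e) :* p :+ con -[1+ 0 ] :* ((b' :+ e') :* q))
            := (a :+ (b :* p :+ con -[1+ 0 ] :* (b' :* q))) :+ (c :+ (e :* p :+ con -[1+ 0 ] :* (e' :* q)))) (φ a₁)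
              (φ c₁) (φ b₁) (φ e₁) (φ b₂) (φ e₂) P Q)
      , trans (+-cong (φ-+ a₂ c₂) (+-cong (*-congʳ (φ-+ b₁ e₁)) (*-congʳ (φ-+ b₂ e₂))))
          (solve 8 (λ a c b e b' e' p q → (a :+ c) :+ ((b :+ e) :* q :+ ((b' :+ e') :* p))
            := (a :+ (b :* q :+ (b' :* p))) :+ (c :+ (e :* q :+ (e' :* p)))) (φ a₂) (φ c₂) (φ b₁) (φ e₁) (φ b₂)
              (φ e₂) P Q)

    value-sqrt : value sqrtK C.≈ root
    value-sqrt = C-trans (C.+-cong {gaussian 0G} {C.0#} (φ-0 , φ-0)
        (C-trans (C.*-congʳ {root} {gaussian 1G} {C.1#} (φ-1 , φ-0)) (C.*-identityˡ root))) (C.+-identityˡ root)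

    value-point : ∀ a β → value (point a β) C.≈ ⟦ β ⟧ C.* gaussian (ginv a) C.+ gaussian (ginv a) C.* root
    value-point a β = C.+-congʳ {gaussian (ginv a) C.* root} {gaussian (ιG β G.* ginv a)} {⟦ β ⟧ C.* gaussian (ginv a)}
      (C-trans (gaussian-* (ιG β) (ginv a)) (C.*-congʳ {gaussian (ginv a)} {gaussian (ιG β)} {⟦ β ⟧} (gaussian-ι β)))

    reciprocal : ∀ a → a ≢ 0GI → ⟦ a ⟧ C.* gaussian (ginv a) C.≈ C.1#
    reciprocal a h = C-trans (C.*-congʳ {gaussian (ginv a)} {⟦ a ⟧} {gaussian (ιG a)}
        (sym (proj₁ (gaussian-ι a)) , sym (proj₂ (gaussian-ι a))))
      (C-trans {_} {gaussian (ιG a G.* ginv a)} (sym (proj₁ (gaussian-* (ιG a) (ginv a))) , sym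
        (proj₂ (gaussian-* (ιG a) (ginv a))))
      (C-trans (C.reflexive (≡.cong gaussian (ginv-inverse a h))) (φ-1 , φ-0)))

    value-numerator : ∀ a β → a ≢ 0GI → ⟦ a ⟧ C.* value (point a β) C.≈ ⟦ β ⟧ C.+ root
    value-numerator a β h = C-trans (C.*-congˡ {⟦ a ⟧} {value (point a β)} (value-point a β))
      (I.numerator ⟦ a ⟧ ⟦ β ⟧ (gaussian (ginv a)) root (reciprocal a h))

    module _ (noRoot : ¬ HasSqrtInQi m n) where
      private
        C-sym : ∀ {x y} → x C.≈ y → y C.≈ x
        C-sym {x} {y} = C.sym {x} {y}

      ⟦⟧-* : ∀ g h → ⟦ g *GI h ⟧ C.≈ ⟦ g ⟧ C.* ⟦ h ⟧
      ⟦⟧-* (x , y) (x' , y') =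
          trans (κ-- (x ℤ.* x') (y ℤ.* y')) (trans (+-cong (κ-* x x') (-‿cong (κ-* y y')))
            (solve 4 (λ a b c d → a :* c :- b :* d := a :* c :+ con -[1+ 0 ] :* (b :* d)) (κ x) (κ y) (κ x') (κ y')))
        , trans (κ-+ (x ℤ.* y') (y ℤ.* x')) (+-cong (κ-* x y') (κ-* y x'))

      ⟦⟧-+ : ∀ g h → ⟦ g +GI h ⟧ C.≈ ⟦ g ⟧ C.+ ⟦ h ⟧
      ⟦⟧-+ (x , y) (x' , y') = κ-+ x x' , κ-+ y y'

      ⟦⟧-- : ∀ g h → ⟦ g -GI h ⟧ C.≈ ⟦ g ⟧ C.- ⟦ h ⟧
      ⟦⟧-- (x , y) (x' , y') = κ-- x x' , κ-- y y'

      ⟦⟧-neg : ∀ g → ⟦ negGI g ⟧ C.≈ C.- ⟦ g ⟧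
      ⟦⟧-neg (x , y) = κ-neg x , κ-neg y

      nrm-⟦⟧ : ∀ g → nrm ⟦ g ⟧ ≈ κ (normGI g)
      nrm-⟦⟧ (x , y) = sym (trans (κ-+ (x ℤ.* x) (y ℤ.* y)) (+-cong (κ-* x x) (κ-* y y)))

      nrm≥0 : ∀ x → NN (nrm x)
      nrm≥0 (x , y) = NN-+ (NN-sq x) (NN-sq y)

      -- Separation from the corners and the bound on a

      record Triple (a β c : GI) : Set where
        field
          a≢0 : a ≢ 0GI
          c≢0 : c ≢ 0GI
          disc : (β *GI β) +GI (a *GI c) ≡ D

      module _ {a β c} (T : Triple a β c) where
        open Triple T

        private
          N : Carrier
          N = κ (normGI a)
          x y′ : Carrier × Carrier
          x = value (point a β)
          y′ = value (point a (negGI β))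

        N≥1 : NN (N - κ (+ 1))
        N≥1 = κ-≤ (1≤norm a a≢0)

        N>0 : PP N
        N>0 = PP-resp (solve 1 (λ n → (n :- con (+ 1)) :+ con (+ 1) := n) N) (PP-+ʳ N≥1 (PP-κ 0))

        private
          factor : ∀ ζ → ⟦ a ⟧ C.* ((⟦ ζ ⟧ C.- x) C.* (⟦ ζ ⟧ C.+ y′)) C.≈ ⟦ polynomial a β c ζ ⟧
          factor ζ = C-trans
            (C.*-congˡ {⟦ a ⟧} (C.*-cong {⟦ ζ ⟧ C.- x} {⟦ ζ ⟧ C.- (⟦ β ⟧ C.* A C.+ A C.* root)}
              (C.+-congˡ {⟦ ζ ⟧} (C.-‿cong {x} (value-point a β)))
              (C.+-congˡ {⟦ ζ ⟧} (C-trans (value-point a (negGI β))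
                (C.+-congʳ {A C.* root} (C.*-congʳ {A} {⟦ negGI β ⟧} {C.- ⟦ β ⟧} (⟦⟧-neg β)))))))
            (C-trans (I.evaluate ⟦ a ⟧ ⟦ β ⟧ ⟦ c ⟧ A root (⟦ D ⟧) ⟦ ζ ⟧ (reciprocal a a≢0) root²
                (C-trans (C-sym {⟦ (β *GI β) +GI (a *GI c) ⟧}
                  (C-trans (⟦⟧-+ (β *GI β) (a *GI c)) (C.+-cong {⟦ β *GI β ⟧} (⟦⟧-* β β) (⟦⟧-* a c))))
                  (C.reflexive (≡.cong ⟦_⟧ disc))))
              (C-sym {⟦ polynomial a β c ζ ⟧} (C-trans (⟦⟧-- ((a *GI (ζ *GI ζ)) -GI ((β *GI ζ) +GI (β *GI ζ))) c) (C.+-congʳ {C.- ⟦ c ⟧}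
                (C-trans (⟦⟧-- (a *GI (ζ *GI ζ)) ((β *GI ζ) +GI (β *GI ζ))) (C.+-cong {⟦ a *GI (ζ *GI ζ) ⟧}
                  (C-trans (⟦⟧-* a (ζ *GI ζ)) (C.*-congˡ {⟦ a ⟧} (⟦⟧-* ζ ζ)))
                  (C.-‿cong {⟦ (β *GI ζ) +GI (β *GI ζ) ⟧}
                    (C-trans (⟦⟧-+ (β *GI ζ) (β *GI ζ)) (C.+-cong {⟦ β *GI ζ ⟧} (⟦⟧-* β ζ) (⟦⟧-* β ζ))))))))))
            where
            A : Carrier × Carrier
            A = gaussian (ginv a)

        -- The quadratic form of x takes nonzero Gaussian integer values, so x and − Y stay away from ζ.
        separated : ∀ ζ → NN (N * (nrm (⟦ ζ ⟧ C.- x) * nrm (⟦ ζ ⟧ C.+ y′)) - κ (+ 1))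
        separated ζ = NN-resp (+-congʳ (trans (sym (nrm-⟦⟧ (polynomial a β c ζ))) (trans (sym (nrm-cong (factor ζ)))
            (trans (nrm-* ⟦ a ⟧ _) (*-cong (nrm-⟦⟧ a) (nrm-* (⟦ ζ ⟧ C.- x) (⟦ ζ ⟧ C.+ y′)))))))
          (κ-≤ (1≤norm (polynomial a β c ζ) (polynomial≢0 m n noRoot a β c ζ disc)))

        separated-pos : ∀ ζ → PP (nrm (⟦ ζ ⟧ C.- x))
        separated-pos ζ = PP-cancel (NN-* (PP⇒NN N>0) (nrm≥0 (⟦ ζ ⟧ C.+ y′))) (PP-resp
          (solve 3 (λ N u v → (N :* (u :* v) :- con (+ 1)) :+ con (+ 1) := (N :* v) :* u) N (nrm (⟦ ζ ⟧ C.- x))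
            (nrm (⟦ ζ ⟧ C.+ y′)))
          (PP-+ʳ (separated ζ) (PP-κ 0)))

        -- Indeed x + Y = 2√D / a, and |√D|² = r.
        gap-norm : N * nrm (x C.+ y′) ≈ κ (+ 4) * r
        gap-norm = begin
          N * nrm (x C.+ y′)              ≈⟨ *-congʳ (nrm-⟦⟧ a) ⟨
          nrm ⟦ a ⟧ * nrm (x C.+ y′)      ≈⟨ nrm-* ⟦ a ⟧ (x C.+ y′) ⟨
          nrm (⟦ a ⟧ C.* (x C.+ y′))      ≈⟨ nrm-cong (C-trans (C.*-congˡ {⟦ a ⟧} (C.+-cong {x} (value-point a β)
              (C-trans (value-point a (negGI β)) (C.+-congʳ {A C.* root}
                (C.*-congʳ {A} {⟦ negGI β ⟧} {C.- ⟦ β ⟧} (⟦⟧-neg β))))))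
              (I.difference ⟦ a ⟧ ⟦ β ⟧ A root (reciprocal a a≢0))) ⟩
          nrm (root C.+ root)             ≈⟨ solve 2 (λ p q → (p :+ p) :* (p :+ p) :+ (q :+ q) :* (q :+ q) := con
              (+ 4) :* (p :* p :+ q :* q)) P Q ⟩
          κ (+ 4) * (P * P + Q * Q)       ≈⟨ *-congˡ P²+Q² ⟩
          κ (+ 4) * r ∎
          where
          A : Carrier × Carrier
          A = gaussian (ginv a)

      S T : Carrier × Carrier → Carrier
      S (x , y) = x + y
      T (x , y) = x - y

      sq-ST : ∀ x → sq (S x) (T x) ≈ κ (+ 2) * nrm x
      sq-ST (x , y) = solve 2 (λ x y → (x :+ y) :* (x :+ y) :+ (x :- y) :* (x :- y) := con (+ 2) :*
          (x :* x :+ y :* y)) x y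

      private
        data Unit : ℤ → Set where
          plus  : Unit (+ 1)
          minus : Unit -[1+ 0 ]

        unit² : ∀ {e} → Unit e → κ e * κ e ≈ κ (+ 1)
        unit² plus = solve 0 (con (+ 1) :* con (+ 1) := con (+ 1))
        unit² minus = solve 0 (con -[1+ 0 ] :* con -[1+ 0 ] := con (+ 1))

        sign : ∀ x → ∃ λ e → Unit e × NN (κ e * x)
        sign x with NN-total x
        ... | inj₁ h = + 1 , plus , NN-resp (solve 1 (λ x → x := con (+ 1) :* x) x) h
        ... | inj₂ h = -[1+ 0 ] , minus , NN-resp (solve 1 (λ x → :- x := con -[1+ 0 ] :* x) x) h

        Within-unit : ∀ {e x} → Unit e → Within x → NN (κ (+ 1) - κ e * x)
        Within-unit {x = x} plus (_ , h) = NN-resp (solve 1 (λ x → con (+ 1) :- x := con (+ 1) :- con (+ 1) :* x) x) h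
        Within-unit {x = x} minus (h , _) = NN-resp (solve 1 (λ x → con (+ 1) :+ x := con (+ 1) :- con -[1+ 0 ] :* x)
            x) h

        -- The corners of the square are the units of ℤ[i]. The signs of S x and T x pick the corner
        -- in the quadrant of x, and multiplication by these signs moves it to (1 , 1), where
        -- `cusp-bound` is stated.
        corner : ∀ {e f} → Unit e → Unit f → ∃ λ ζ → S ⟦ ζ ⟧ ≈ κ e × T ⟦ ζ ⟧ ≈ κ f
        corner plus plus = (+ 1 , + 0) , solve 0 (con (+ 1) :+ con (+ 0) := con (+ 1)) , solve 0
            (con (+ 1) :- con (+ 0) := con (+ 1))
        corner plus minus = (+ 0 , + 1) , solve 0 (con (+ 0) :+ con (+ 1) := con (+ 1)) , solve 0
            (con (+ 0) :- con (+ 1) := con -[1+ 0 ])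
        corner minus plus = (+ 0 , -[1+ 0 ]) , solve 0 (con (+ 0) :+ con -[1+ 0 ] := con -[1+ 0 ]) , solve 0
            (con (+ 0) :- con -[1+ 0 ] := con (+ 1))
        corner minus minus = (-[1+ 0 ] , + 0) , solve 0 (con -[1+ 0 ] :+ con (+ 0) := con -[1+ 0 ]) , solve 0
            (con -[1+ 0 ] :- con (+ 0) := con -[1+ 0 ])

        minus-unit : ∀ {e z} x → Unit e → z ≈ κ e → (κ (+ 1) - κ e * x) * (κ (+ 1) - κ e * x) ≈ (z - x) * (z - x)
        minus-unit {e} {z} x u p = begin
          (κ (+ 1) - κ e * x) * (κ (+ 1) - κ e * x)
            ≈⟨ solve 2 (λ e x → (con (+ 1) :- e :* x) :* (con (+ 1) :- e :* x) := con (+ 1) :- con (+ 2) :* (e :* x)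
              :+ (e :* e) :* (x :* x)) (κ e) x ⟩
          κ (+ 1) - κ (+ 2) * (κ e * x) + (κ e * κ e) * (x * x)
            ≈⟨ +-cong (+-congʳ (sym (unit² u))) (*-congʳ (unit² u)) ⟩
          κ e * κ e - κ (+ 2) * (κ e * x) + κ (+ 1) * (x * x)
            ≈⟨ solve 2 (λ e x → e :* e :- con (+ 2) :* (e :* x) :+ con (+ 1) :* (x :* x) := (e :- x) :* (e :- x))
              (κ e) x ⟩
          (κ e - x) * (κ e - x)
            ≈⟨ *-cong (+-congʳ (sym p)) (+-congʳ (sym p)) ⟩
          (z - x) * (z - x) ∎

        plus-unit : ∀ {e z} x → Unit e → z ≈ κ e → (κ (+ 1) + κ e * x) * (κ (+ 1) + κ e * x) ≈ (z + x) * (z + x)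
        plus-unit {e} {z} x u p = trans (solve 2 (λ e x → (con (+ 1) :+ e :* x) :* (con (+ 1) :+ e :* x) :=
            (con (+ 1) :- e :* (:- x)) :* (con (+ 1) :- e :* (:- x))) (κ e) x)
          (trans (minus-unit (- x) u p) (solve 2 (λ z x → (z :- (:- x)) :* (z :- (:- x)) := (z :+ x) :* (z :+ x)) z x))

        unit-sq : ∀ {e} x → Unit e → κ e * x * (κ e * x) ≈ x * x
        unit-sq {e} x u = trans (solve 2 (λ e x → e :* x :* (e :* x) := (e :* e) :* (x :* x)) (κ e) x)
          (trans (*-congʳ (unit² u)) (solve 1 (λ x → con (+ 1) :* x := x) (x * x)))

        minus-corner : ∀ {e f} ζ x → Unit e → Unit f → S ⟦ ζ ⟧ ≈ κ e → T ⟦ ζ ⟧ ≈ κ f →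
                       sq (κ (+ 1) - κ e * S x) (κ (+ 1) - κ f * T x) ≈ κ (+ 2) * nrm (⟦ ζ ⟧ C.- x)
        minus-corner (z , w) (x , y) ue uf p q = trans (+-cong (minus-unit (x + y) ue p) (minus-unit (x - y) uf q))
          (solve 4 (λ z w x y → (z :+ w :- (x :+ y)) :* (z :+ w :- (x :+ y)) :+ (z :- w :- (x :- y)) :*
            (z :- w :- (x :- y))
            := con (+ 2) :* ((z :- x) :* (z :- x) :+ (w :- y) :* (w :- y))) (κ z) (κ w) x y)

        plus-corner : ∀ {e f} ζ x → Unit e → Unit f → S ⟦ ζ ⟧ ≈ κ e → T ⟦ ζ ⟧ ≈ κ f →
                       sq (κ (+ 1) + κ e * S x) (κ (+ 1) + κ f * T x) ≈ κ (+ 2) * nrm (⟦ ζ ⟧ C.+ x)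
        plus-corner (z , w) (x , y) ue uf p q = trans (+-cong (plus-unit (x + y) ue p) (plus-unit (x - y) uf q))
          (solve 4 (λ z w x y → (z :+ w :+ (x :+ y)) :* (z :+ w :+ (x :+ y)) :+ (z :- w :+ (x :- y)) :*
            (z :- w :+ (x :- y))
            := con (+ 2) :* ((z :+ x) :* (z :+ x) :+ (w :+ y) :* (w :+ y))) (κ z) (κ w) x y)

      r≥1 : NN (r - κ (+ 1))
      r≥1 = sq-cancel-NN r≥0 (NN-resp (trans (+-cong (sym (nrm-⟦⟧ D))
          (sym (-‿cong (solve 0 (con (+ 1) :* con (+ 1) := con (+ 1)))))) (+-congʳ (sym r²)))
        (κ-≤ (1≤norm D (D≢0 m n noRoot))))

      module _ {a β c} (tr : Triple a β c) where
        open Triple tr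
        private
          N : Carrier
          N = κ (normGI a)
          x y′ : Carrier × Carrier
          x = value (point a β)
          y′ = value (point a (negGI β))

        -- In the closed square |x| ≥ 1 is possible only at a corner, where x would equal a unit of
        -- ℤ[i], against `separated-pos`.
        small : Within (S x) → Within (T x) → PP (κ (+ 2) - sq (S x) (T x))
        small wS wT with NN⊎PP (sq (S x) (T x) - κ (+ 2))
        ... | inj₂ h = PP-resp (solve 1 (λ s → :- (s :- con (+ 2)) := con (+ 2) :- s) (sq (S x) (T x))) h
        ... | inj₁ h =
          let e , ue , eS = sign (S x) ; f , uf , fT = sign (T x) ; ζ , p , q = corner ue uf in
          ⊥-elim (PP⇒¬NN- (trans (minus-corner ζ x ue uf p q)
              (solve 1 (λ z → z := :- (:- z)) (κ (+ 2) * nrm (⟦ ζ ⟧ C.- x))))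
            (PP-resp (sym (minus-corner ζ x ue uf p q)) (PP-* (PP-κ 1) (separated-pos tr ζ)))
            (NN-resp (trans (solve 2 (λ u v → (:- (u :* u)) :+ (:- (v :* v)) := :- (u :* u :+ v :* v)) _ _)
              (-‿cong (minus-corner ζ x ue uf p q)))
              (NN-+ (edge eS (Within-unit ue wS) (NN-resp (+-congʳ (sym (unit-sq (S x) ue))) (NN-resp
                       (solve 2 (λ s t → (s :* s :+ t :* t :- con (+ 2)) :+ (con (+ 1) :+ t) :* (con (+ 1) :- t) := s
                         :* s :- con (+ 1)) (S x) (T x))
                       (NN-+ h (NN-* (proj₁ wT) (proj₂ wT))))))
                    (edge fT (Within-unit uf wT) (NN-resp (+-congʳ (sym (unit-sq (T x) uf))) (NN-resp
                       (solve 2 (λ s t → (s :* s :+ t :* t :- con (+ 2)) :+ (con (+ 1) :+ s) :* (con (+ 1) :- s) := t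
                         :* t :- con (+ 1)) (S x) (T x))
                       (NN-+ h (NN-* (proj₁ wS) (proj₂ wS)))))))))
          where
          edge : ∀ {u} → NN u → NN (κ (+ 1) - u) → NN (u * u - κ (+ 1)) → NN (- ((κ (+ 1) - u) * (κ (+ 1) - u)))
          edge {u} u≥0 u≤1 k = NN-resp (solve 1 (λ u → (con (+ 1) :- u) :* (u :- con (+ 1)) := :-
              ((con (+ 1) :- u) :* (con (+ 1) :- u))) u)
            (NN-* u≤1 (NN-cancel (PP-+ʳ u≥0 (PP-κ 0)) (NN-resp
              (solve 1 (λ u → u :* u :- con (+ 1) := (u :+ con (+ 1)) :* (u :- con (+ 1))) u) k)))

        -- Put d = 2|x + Y|², so that N d = 8r. If 16 d ≥ 1, then N ≤ 128 r, and r ≥ 1 absorbs this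
        -- in the final bound. Otherwise A B ≤ 1600 d² for the doubled squared distances A = 2|ζ -
        -- x|² and B = 2|ζ + Y|², while the quadratic form at the corner ζ forces N A B ≥ 4. Hence
        -- 4N ≤ 1600 (N d)² = 1600 · 64 r², that is N ≤ 25600 r².
        coefficient-bound : Within (S x) → Within (T x) → NN (sq (S y′) (T y′) - κ (+ 2)) → normGI a ℤ.≤ + 25600 ℤ.*
            normGI D
        coefficient-bound wS wT big =
          let e , ue , eS = sign (S x) ; f , uf , fT = sign (T x) ; ζ , p , q = corner ue uf in
          κ-NN⇒≤ (NN-resp (+-congʳ (sym (trans (κ-* (+ 25600) (normGI D)) (*-congˡ (trans (sym (nrm-⟦⟧ D)) (sym r²))))))
            (conclude (minus-corner ζ x ue uf p q) (plus-corner ζ y′ ue uf p q)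
              (trans (+-cong (trans (*-cong (sym (distribˡ _ _ _)) (sym (distribˡ _ _ _))) (unit-sq _ ue))
                (trans (*-cong (sym (distribˡ _ _ _)) (sym (distribˡ _ _ _))) (unit-sq _ uf)))
                (solve 4 (λ x y z w → (x :+ y :+ (z :+ w)) :* (x :+ y :+ (z :+ w)) :+ (x :- y :+ (z :- w)) :*
                  (x :- y :+ (z :- w)) := con (+ 2) :* ((x :+ z) :* (x :+ z) :+ (y :+ w) :* (y :+ w))) (proj₁ x)
                  (proj₂ x) (proj₁ y′) (proj₂ y′)))
              (separated tr ζ)
              (cusp-bound eS (Within-unit ue wS) fT (Within-unit uf wT)
                (NN-resp (+-congʳ (sym (+-cong (unit-sq _ ue) (unit-sq _ uf)))) big))))
          where
          conclude : ∀ {A B d A′ B′} → A ≈ κ (+ 2) * A′ → B ≈ κ (+ 2) * B′ → d ≈ κ (+ 2) * nrm (x C.+ y′) → NN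
              (N * (A′ * B′) - κ (+ 1)) →
                     NN (κ (+ 1600) * (d * d) - A * B) ⊎ NN (κ (+ 16) * d - κ (+ 1)) → NN (κ (+ 25600) * (r * r) - N)
          conclude {A} {B} {d} {A′} {B′} p q s sep k = bound k
            where
            Nd : N * d ≈ κ (+ 8) * r
            Nd = trans (*-congˡ s) (trans (solve 2 (λ N x → N :* (con (+ 2) :* x) := con (+ 2) :* (N :* x)) N
                (nrm (x C.+ y′)))
              (trans (*-congˡ (gap-norm tr)) (solve 1 (λ r → con (+ 2) :* (con (+ 4) :* r) := con (+ 8) :* r) r)))
            NAB : κ (+ 4) * (N * (A′ * B′)) ≈ N * (A * B)
            NAB = trans (solve 3 (λ N a b → con (+ 4) :* (N :* (a :* b)) := N :*
                ((con (+ 2) :* a) :* (con (+ 2) :* b))) N A′ B′) (*-congˡ (*-cong (sym p) (sym q)))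
            bound : NN (κ (+ 1600) * (d * d) - A * B) ⊎ NN (κ (+ 16) * d - κ (+ 1)) → NN (κ (+ 25600) * (r * r) - N)
            bound (inj₁ h) = NN-cancel (PP-κ 3) (NN-resp (begin
                N * (N * (κ (+ 1600) * (d * d) - A * B)) + N * (κ (+ 4) * (N * (A′ * B′) - κ (+ 1)))
                  ≈⟨ +-congˡ (*-congˡ (trans (solve 1 (λ z → con (+ 4) :* (z :- con (+ 1)) := con (+ 4) :* z :- con
                    (+ 4)) (N * (A′ * B′))) (+-congʳ NAB))) ⟩
                N * (N * (κ (+ 1600) * (d * d) - A * B)) + N * (N * (A * B) - κ (+ 4))
                  ≈⟨ solve 3 (λ N d z → N :* (N :* (con (+ 1600) :* (d :* d) :- z)) :+ N :* (N :* z :- con (+ 4)) :=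
                    con (+ 1600) :* ((N :* d) :* (N :* d)) :- con (+ 4) :* N) N d (A * B) ⟩
                κ (+ 1600) * ((N * d) * (N * d)) - κ (+ 4) * N
                  ≈⟨ +-congʳ (*-congˡ (*-cong Nd Nd)) ⟩
                κ (+ 1600) * ((κ (+ 8) * r) * (κ (+ 8) * r)) - κ (+ 4) * N
                  ≈⟨ solve 2 (λ N r → con (+ 1600) :* ((con (+ 8) :* r) :* (con (+ 8) :* r)) :- con (+ 4) :* N := con
                    (+ 4) :* (con (+ 25600) :* (r :* r) :- N)) N r ⟩
                κ (+ 4) * (κ (+ 25600) * (r * r) - N) ∎)
              (NN-+ (NN-* N≥0 (NN-* N≥0 h)) (NN-* N≥0 (NN-* (NN-κ 4) sep))))
              where
              N≥0 : NN N
              N≥0 = PP⇒NN (N>0 tr)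
            bound (inj₂ h) = NN-resp (begin
                N * (κ (+ 16) * d - κ (+ 1)) + (κ (+ 128) * (r * (r - κ (+ 1))) + κ (+ 25472) * (r * r))
                  ≈⟨ +-congʳ (trans (solve 2 (λ N d → N :* (con (+ 16) :* d :- con (+ 1)) := con (+ 16) :* (N :* d)
                    :- N) N d) (+-congʳ (*-congˡ Nd))) ⟩
                κ (+ 16) * (κ (+ 8) * r) - N + (κ (+ 128) * (r * (r - κ (+ 1))) + κ (+ 25472) * (r * r))
                  ≈⟨ solve 2 (λ N r → con (+ 16) :* (con (+ 8) :* r) :- N :+
                    (con (+ 128) :* (r :* (r :- con (+ 1))) :+ con (+ 25472) :* (r :* r)) := con (+ 25600) :*
                    (r :* r) :- N) N r ⟩
                κ (+ 25600) * (r * r) - N ∎)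
              (NN-+ (NN-* (PP⇒NN (N>0 tr)) h) (NN-+ (NN-* (NN-κ 128) (NN-* r≥0 r≥1)) (NN-* (NN-κ 25472) (NN-sq r))))

      -- Excluding |Y| = 1

      irrational : ∀ u v → P ≈ φ u → Q ≈ φ v → ⊥
      irrational u v p q = noRoot ((u , v) , ≡.cong₂ _,_
        (φ-injective (begin
          φ (u ℚ.* u ℚ.- v ℚ.* v)        ≈⟨ trans (φ-- (u ℚ.* u) (v ℚ.* v)) (+-cong (φ-* u u) (-‿cong (φ-* v v))) ⟩
          φ u * φ u - φ v * φ v          ≈⟨ +-cong (*-cong p p) (-‿cong (*-cong q q)) ⟨
          P * P - Q * Q                  ≈⟨ solve 2 (λ p q → p :- q := p :+ con -[1+ 0 ] :* q) (P * P) (Q * Q) ⟩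
          P * P + κ -[1+ 0 ] * (Q * Q)   ≈⟨ proj₁ root² ⟩
          κ m                            ≈⟨ κ≈φι m ⟩
          φ (ι m) ∎))
        (φ-injective (begin
          φ (u ℚ.* v ℚ.+ v ℚ.* u)        ≈⟨ trans (φ-+ (u ℚ.* v) (v ℚ.* u)) (+-cong (φ-* u v) (φ-* v u)) ⟩
          φ u * φ v + φ v * φ u          ≈⟨ +-cong (*-cong p q) (*-cong q p) ⟨
          P * Q + Q * P                  ≈⟨ proj₂ root² ⟩
          κ n                            ≈⟨ κ≈φι n ⟩
          φ (ι n) ∎)))

      private
        solve-linear : ∀ t x u → t ≢ 0ℚ → φ t * x ≈ φ u → x ≈ φ (recip t ℚ.* u)
        solve-linear t x u t≢0 h = begin
          x                        ≈⟨ *-identityˡ x ⟨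
          1# * x                   ≈⟨ *-congʳ φ-1 ⟨
          φ 1ℚ * x                 ≡⟨ ≡.cong (λ z → φ z * x)
              (≡.trans (≡.sym (recip-inverse t t≢0)) (ℚP.*-comm t (recip t))) ⟩
          φ (recip t ℚ.* t) * x    ≈⟨ trans (*-congʳ (φ-* (recip t) t)) (*-assoc _ _ _) ⟩
          φ (recip t) * (φ t * x)  ≈⟨ *-congˡ h ⟩
          φ (recip t) * φ u        ≈⟨ φ-* (recip t) u ⟨
          φ (recip t ℚ.* u) ∎

      module _ {a β c} (tr : Triple a β c) where
        open Triple tr
        private
          N : Carrier
          N = κ (normGI a)
          b₁ b₂ : ℤ
          b₁ = proj₁ β
          b₂ = proj₂ β
          x y′ : Carrier × Carrier
          x = value (point a β)
          y′ = value (point a (negGI β))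

          -- Twice the real scalar product of β and √D, the cross term in |√D ± β|².
          τ : Carrier
          τ = κ (+ 2) * (κ b₁ * P + κ b₂ * Q)

          norm-x : N * nrm x ≈ κ (normGI β) + r + τ
          norm-x = begin
            N * nrm x                   ≈⟨ trans (*-congʳ (sym (nrm-⟦⟧ a))) (sym (nrm-* ⟦ a ⟧ x)) ⟩
            nrm (⟦ a ⟧ C.* x)           ≈⟨ nrm-cong (value-numerator a β a≢0) ⟩
            nrm (⟦ β ⟧ C.+ root)        ≈⟨ solve 4 (λ b c p q → (b :+ p) :* (b :+ p) :+ (c :+ q) :* (c :+ q)
                                             := (b :* b :+ c :* c) :+ (p :* p :+ q :* q) :+ con (+ 2) :*
                                               (b :* p :+ c :* q)) (κ b₁) (κ b₂) P Q ⟩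
            nrm ⟦ β ⟧ + (P * P + Q * Q) + τ  ≈⟨ +-congʳ (+-cong (nrm-⟦⟧ β) P²+Q²) ⟩
            κ (normGI β) + r + τ ∎

          norm-y : N * nrm y′ ≈ κ (normGI β) + r - τ
          norm-y = begin
            N * nrm y′                  ≈⟨ trans (*-congʳ (sym (nrm-⟦⟧ a))) (sym (nrm-* ⟦ a ⟧ y′)) ⟩
            nrm (⟦ a ⟧ C.* y′)          ≈⟨ nrm-cong (C.trans {⟦ a ⟧ C.* y′} {⟦ negGI β ⟧ C.+ root}
                (value-numerator a (negGI β) a≢0) (C.+-congʳ {root} {⟦ negGI β ⟧} {C.- ⟦ β ⟧} (⟦⟧-neg β))) ⟩
            nrm (C.- ⟦ β ⟧ C.+ root)    ≈⟨ solve 4 (λ b c p q → (:- b :+ p) :* (:- b :+ p) :+ (:- c :+ q) :* (:- c :+ q)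
                                             := (b :* b :+ c :* c) :+ (p :* p :+ q :* q) :- con (+ 2) :*
                                               (b :* p :+ c :* q)) (κ b₁) (κ b₂) P Q ⟩
            nrm ⟦ β ⟧ + (P * P + Q * Q) - τ  ≈⟨ +-congʳ (+-cong (nrm-⟦⟧ β) P²+Q²) ⟩
            κ (normGI β) + r - τ ∎

          P-τ : P * τ ≈ κ b₁ * (r + κ m) + κ b₂ * κ n
          P-τ = trans (solve 4 (λ b c p q → p :* (con (+ 2) :* (b :* p :+ c :* q)) := b :* (con (+ 2) :* (p :* p)) :+
              c :* (con (+ 2) :* (p :* q))) (κ b₁) (κ b₂) P Q)
            (+-cong (*-congˡ 2P²) (*-congˡ 2PQ))

          Q-τ : Q * τ ≈ κ b₁ * κ n + κ b₂ * (r - κ m)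
          Q-τ = trans (solve 4 (λ b c p q → q :* (con (+ 2) :* (b :* p :+ c :* q)) := b :* (con (+ 2) :* (p :* q)) :+
              c :* (con (+ 2) :* (q :* q))) (κ b₁) (κ b₂) P Q)
            (+-cong (*-congˡ 2PQ) (*-congˡ 2Q²))

          -- (r − k)² = τ² is linear in r because r² and τ² − 2 |β|² r are integers.
          k e : Carrier
          k = N - κ (normGI β)
          e = κ (+ 2) * (κ m * (κ b₁ * κ b₁ - κ b₂ * κ b₂) + κ (+ 2) * (κ b₁ * (κ b₂ * κ n)))

          τ² : τ * τ ≈ κ (+ 2) * κ (normGI β) * r + e
          τ² = begin
            τ * τ
              ≈⟨ solve 3 (λ b c t → (con (+ 2) :* (b :+ c)) :* t := con (+ 2) :* (b :* t :+ c :* t)) (κ b₁ * P)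
                (κ b₂ * Q) τ ⟩
            κ (+ 2) * (κ b₁ * P * τ + κ b₂ * Q * τ)
              ≈⟨ *-congˡ (+-cong (trans (*-assoc _ _ _) (*-congˡ P-τ)) (trans (*-assoc _ _ _) (*-congˡ Q-τ))) ⟩
            κ (+ 2) * (κ b₁ * (κ b₁ * (r + κ m) + κ b₂ * κ n) + κ b₂ * (κ b₁ * κ n + κ b₂ * (r - κ m)))
              ≈⟨ solve 5 (λ b c r m n → con (+ 2) :* (b :* (b :* (r :+ m) :+ c :* n) :+ c :* (b :* n :+ c :* (r :- m)))
                   := con (+ 2) :* (b :* b :+ c :* c) :* r :+ con (+ 2) :*
                     (m :* (b :* b :- c :* c) :+ con (+ 2) :* (b :* (c :* n)))) (κ b₁) (κ b₂) r (κ m) (κ n) ⟩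
            κ (+ 2) * nrm ⟦ β ⟧ * r + e
              ≈⟨ +-congʳ (*-congʳ (*-congˡ (nrm-⟦⟧ β))) ⟩
            κ (+ 2) * κ (normGI β) * r + e ∎

          -- The integer value of 2 N r when |Y| = 1: expand (r - k)² = τ² = 2|β|² r + e, replace r²
          -- by |D|², and use k + |β|² = N.
          G : ℤ
          G = normGI D ℤ.+ (normGI a ℤ.- normGI β) ℤ.* (normGI a ℤ.- normGI β)
              ℤ.- + 2 ℤ.* (m ℤ.* (b₁ ℤ.* b₁ ℤ.- b₂ ℤ.* b₂) ℤ.+ + 2 ℤ.* (b₁ ℤ.* (b₂ ℤ.* n)))

          κG : κ G ≈ nrm ⟦ D ⟧ + k * k - e
          κG = trans (κ-- _ _) (+-cong
            (trans (κ-+ _ _) (+-cong (sym (nrm-⟦⟧ D)) (trans (κ-* _ _) (*-cong (κ-- (normGI a) (normGI β)) (κ-- (normGI a) (normGI β))))))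
            (-‿cong (trans (κ-* _ _) (*-congˡ (trans (κ-+ _ _) (+-cong
              (trans (κ-* _ _) (*-congˡ (trans (κ-- _ _) (+-cong (κ-* b₁ b₁) (-‿cong (κ-* b₂ b₂))))))
              (trans (κ-* _ _) (*-congˡ (trans (κ-* _ _) (*-congˡ (κ-* b₂ n)))))))))))

        module _ (onCircle : nrm y′ ≈ κ (+ 1)) where
          private
            τ≈r-k : τ ≈ r - k
            τ≈r-k = begin
              τ
                  ≈⟨ solve 3 (λ b r t → t := (b :+ r) :- (b :+ r :- t)) (κ (normGI β)) r τ ⟩
              κ (normGI β) + r - (κ (normGI β) + r - τ)
                  ≈⟨ +-congˡ (-‿cong (trans (sym norm-y)
                  (trans (*-congˡ onCircle) (solve 1 (λ z → z :* con (+ 1) := z) N)))) ⟩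
              κ (normGI β) + r - N
                  ≈⟨ solve 3 (λ b r z → b :+ r :- z := r :- (z :- b)) (κ (normGI β)) r N ⟩
              r - k ∎

            linear : κ (+ 2) * N * r ≈ κ G
            linear = begin
              κ (+ 2) * N * r
                ≈⟨ solve 4 (λ z b r e → con (+ 2) :* z :* r := con (+ 2) :* b :* r :+ e :+
                  (con (+ 2) :* (z :- b) :* r :- e)) N (κ (normGI β)) r e ⟩
              κ (+ 2) * κ (normGI β) * r + e + (κ (+ 2) * k * r - e)
                ≈⟨ +-congʳ (trans (sym τ²) (*-cong τ≈r-k τ≈r-k)) ⟩
              (r - k) * (r - k) + (κ (+ 2) * k * r - e)
                ≈⟨ solve 3 (λ r k e → (r :- k) :* (r :- k) :+ (con (+ 2) :* k :* r :- e) := r :* r :+ k :* k :- e) r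
                  k e ⟩
              r * r + k * k - e
                ≈⟨ +-congʳ (+-congʳ r²) ⟩
              nrm ⟦ D ⟧ + k * k - e
                ≈⟨ κG ⟨
              κ G ∎

            2N : ℤ
            2N = + 2 ℤ.* normGI a

            2N≢0 : ι 2N ≢ 0ℚ
            2N≢0 h = PP⇒¬NN- (solve 1 (λ x → x := :- (:- x)) (κ 2N))
              (PP-resp (sym (κ-* (+ 2) (normGI a))) (PP-* (PP-κ 1) (N>0 tr)))
              (NN-resp (sym (trans (-‿cong (trans (κ≈φι 2N) (trans (reflexive (≡.cong φ h)) φ-0))) -0#≈0#)) NN-0)

            ρ : ℚ
            ρ = recip (ι 2N) ℚ.* ι G

            r≈ρ : r ≈ φ ρ
            r≈ρ = solve-linear (ι 2N) r (ι G) 2N≢0 (trans (*-congʳ (trans (sym (κ≈φι 2N)) (κ-* (+ 2) (normGI a))))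
                (trans linear (κ≈φι G)))

            t : ℚ
            t = ρ ℚ.- ι (normGI a ℤ.- normGI β)

            τ≈t : τ ≈ φ t
            τ≈t = trans τ≈r-k (trans (+-cong r≈ρ (-‿cong (trans (sym (κ-- (normGI a) (normGI β))) (κ≈φι _)))) (sym (φ-- ρ _)))

            u v : ℚ
            u = ι b₁ ℚ.* (ρ ℚ.+ ι m) ℚ.+ ι b₂ ℚ.* ι n
            v = ι b₁ ℚ.* ι n ℚ.+ ι b₂ ℚ.* (ρ ℚ.- ι m)

            τ-P : φ t * P ≈ φ u
            τ-P = trans (*-congʳ (sym τ≈t)) (trans (*-comm τ P) (trans P-τ (sym (trans (φ-+ _ _) (+-cong
              (trans (φ-* (ι b₁) (ρ ℚ.+ ι m)) (*-cong (sym (κ≈φι b₁))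
                (trans (φ-+ ρ (ι m)) (+-cong (sym r≈ρ) (sym (κ≈φι m))))))
              (trans (φ-* (ι b₂) (ι n)) (*-cong (sym (κ≈φι b₂)) (sym (κ≈φι n)))))))))

            τ-Q : φ t * Q ≈ φ v
            τ-Q = trans (*-congʳ (sym τ≈t)) (trans (*-comm τ Q) (trans Q-τ (sym (trans (φ-+ _ _) (+-cong
              (trans (φ-* (ι b₁) (ι n)) (*-cong (sym (κ≈φι b₁)) (sym (κ≈φι n))))
              (trans (φ-* (ι b₂) (ρ ℚ.- ι m)) (*-cong (sym (κ≈φι b₂)) (trans (φ-- ρ (ι m)) (+-cong (sym r≈ρ) (-‿cong (sym (κ≈φι m))))))))))))

            -- Once r is rational, so are τ, τ P and τ Q. If τ were nonzero, dividing by it would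
            -- make P and Q rational and √D Gaussian rational.
            τ≈0 : τ ≈ κ (+ 0)
            τ≈0 with t ℚP.≟ 0ℚ
            ... | yes z = trans τ≈t (trans (reflexive (≡.cong φ z)) (trans φ-0 (sym κ-0)))
            ... | no z = ⊥-elim (irrational (recip t ℚ.* u) (recip t ℚ.* v) (solve-linear t P u z τ-P)
                (solve-linear t Q v z τ-Q))

          -- With τ = 0 the numbers √D + β and √D - β have equal modulus, hence so do x and Y.
          conjugate-onCircle : N * nrm x ≈ N
          conjugate-onCircle = begin
            N * nrm x                    ≈⟨ norm-x ⟩
            κ (normGI β) + r + τ         ≈⟨ +-congˡ (trans τ≈0
                (trans (solve 0 (con (+ 0) := :- con (+ 0))) (-‿cong (sym τ≈0)))) ⟩
            κ (normGI β) + r - τ         ≈⟨ norm-y ⟨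
            N * nrm y′                   ≈⟨ *-congˡ onCircle ⟩
            N * κ (+ 1)                  ≈⟨ solve 1 (λ z → z :* con (+ 1) := z) N ⟩
            N ∎

        -- If |Y| = 1 then √D lies in ℚ(i) or |x| = 1 as well.
        off-circle : PP (κ (+ 2) - sq (S x) (T x)) → NN (sq (S y′) (T y′) - κ (+ 2)) → PP (sq (S y′) (T y′) - κ (+ 2))
        off-circle sm h with NN⊎PP (κ (+ 2) - sq (S y′) (T y′))
        ... | inj₂ l = PP-resp (solve 1 (λ s → :- (con (+ 2) :- s) := s :- con (+ 2)) (sq (S y′) (T y′))) l
        ... | inj₁ l = ⊥-elim (contradict (PP-* (N>0 tr) sm) (begin
            N * (κ (+ 2) - sq (S x) (T x))       ≈⟨ *-congˡ (+-congˡ (-‿cong (sq-ST x))) ⟩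
            N * (κ (+ 2) - κ (+ 2) * nrm x)      ≈⟨ solve 2
                (λ N z → N :* (con (+ 2) :- con (+ 2) :* z) := con (+ 2) :* N :- con (+ 2) :* (N :* z)) N (nrm x) ⟩
            κ (+ 2) * N - κ (+ 2) * (N * nrm x)  ≈⟨ +-congˡ (-‿cong (*-congˡ (conjugate-onCircle circle))) ⟩
            κ (+ 2) * N - κ (+ 2) * N            ≈⟨ solve 1 (λ N → N :- N := con (+ 0)) (κ (+ 2) * N) ⟩
            κ (+ 0) ∎))
          where
          circle : nrm y′ ≈ κ (+ 1)
          circle = halve (trans (sym (sq-ST y′)) (trans (antisym h l) (solve 0 (con (+ 2) := con (+ 2) :* con (+ 1)))))

      private
        S-cong : ∀ {x y} → x C.≈ y → S x ≈ S y
        S-cong (p , q) = +-cong p q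
        T-cong : ∀ {x y} → x C.≈ y → T x ≈ T y
        T-cong (p , q) = +-cong p (-‿cong q)

      Avoids-resp : ∀ {xs xt Ys Yt xs' xt' Ys' Yt'} → xs ≈ xs' → xt ≈ xt' → Ys ≈ Ys' → Yt ≈ Yt' → Avoids xs xt Ys
          Yt → Avoids xs' xt' Ys' Yt'
      Avoids-resp p q P Q A = record
        { eastern  = λ h → out (A.eastern (PP-resp (+-cong (*-congˡ (sym p)) norm) h))
        ; western  = λ h → out (A.western (PP-resp (+-cong (*-congˡ (-‿cong (sym p))) norm) h))
        ; northern = λ h → out (A.northern (PP-resp (+-cong (*-congˡ (sym q)) norm) h))
        ; southern = λ h → out (A.southern (PP-resp (+-cong (*-congˡ (-‿cong (sym q))) norm) h)) }
        where
        module A = Avoids A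
        norm = -‿cong (sq-cong (sym p) (sym q))
        out : ∀ {a b} → NN (shifted a b _ _) → NN (shifted a b _ _)
        out = NN-resp (+-congʳ (sq-cong (+-congʳ P) (+-congʳ Q)))

      -- For c = 0 the relation would read β² = D.
      c≢0-from-disc : ∀ a β c → (β *GI β) +GI (a *GI c) ≡ D → c ≢ 0GI
      c≢0-from-disc (a , a') β .(0GI) e ≡.refl = noRoot
          (ιG β , ≡.trans (*G≡* (ιG β) (ιG β)) (≡.trans (≡.sym (ιG-* β β)) (≡.cong ιG (≡.trans (≡.sym vanish) e))))
        where
        vanish : (β *GI β) +GI ((a , a') *GI 0GI) ≡ β *GI β
        vanish = ≡.cong₂ _,_
          (Z.solve 3 (λ a a' b → b Z.:+ (a Z.:* Z.con (+ 0) Z.:- a' Z.:* Z.con (+ 0)) Z.:= b) ≡.refl a a'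
            (proj₁ (β *GI β)))
          (Z.solve 3 (λ a a' b → b Z.:+ (a Z.:* Z.con (+ 0) Z.:+ a' Z.:* Z.con (+ 0)) Z.:= b) ≡.refl a a'
            (proj₂ (β *GI β)))

      -- The invariant along the orbit of triples

      record Invariant (a β c : GI) : Set where
        field
          triple  : Triple a β c
          reduced : let x = value (point a β) ; Y = value (point a (negGI β)) in Reduced (S x) (T x) (S Y) (T Y)

      Good : GI × GI × GI → Set
      Good (a , β , c) = Invariant a β c

      -- The geometric steps deliver only closed conditions; irrationality, through `small` and
      -- `off-circle`, upgrades them to |x| < 1 < |Y|, which the next step needs.
      good : ∀ a β c → Triple a β c → let x = value (point a β) ; Y = value (point a (negGI β)) in
             Within (S x) → Within (T x) → NN (sq (S Y) (T Y) - κ (+ 2)) → Avoids (S x) (T x) (S Y) (T Y) → Good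
                 (a , β , c)
      good a β c tr wS wT h av = record { triple = tr ; reduced = record
        { within-s = wS ; within-t = wT ; small = sm ; big = off-circle tr sm h ; avoids = av } }
        where sm = small tr wS wT

      quotient : GI → GI → ℤ × ℤ
      quotient β c = proj₁ (round (S z)) , proj₁ (round (T z))
        where z = value (point c (negGI β))

      partial : GI → GI → GI
      partial β c = grid (proj₁ (quotient β c)) (proj₂ (quotient β c))

      step : GI × GI × GI → GI × GI × GI
      step (a , β , c) = advance a β c (partial β c)

      S-grid : ∀ U V → S ⟦ grid U V ⟧ ≈ κ (+ 2) * κ U
      S-grid U V = trans (+-cong (κ-+ U V) (κ-- U V)) (solve 2 (λ u v → u :+ v :+ (u :- v) := con (+ 2) :* u) (κ U) (κ V))
      T-grid : ∀ U V → T ⟦ grid U V ⟧ ≈ κ (+ 2) * κ V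
      T-grid U V = trans (+-cong (κ-+ U V) (-‿cong (κ-- U V))) (solve 2 (λ u v → u :+ v :- (u :- v) := con (+ 2) :* v) (κ U) (κ V))

      S-+ : ∀ x y → S (x C.+ y) ≈ S x + S y
      S-+ (a , b) (c , d) = solve 4 (λ a b c d → (a :+ c) :+ (b :+ d) := (a :+ b) :+ (c :+ d)) a b c d
      T-+ : ∀ x y → T (x C.+ y) ≈ T x + T y
      T-+ (a , b) (c , d) = solve 4 (λ a b c d → (a :+ c) :- (b :+ d) := (a :- b) :+ (c :- d)) a b c d
      S-neg : ∀ x → S (C.- x) ≈ - S x
      S-neg (a , b) = solve 2 (λ a b → (:- a) :+ (:- b) := :- (a :+ b)) a b
      T-neg : ∀ x → T (C.- x) ≈ - T x
      T-neg (a , b) = solve 2 (λ a b → (:- a) :- (:- b) := :- (a :- b)) a b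

      S-plus : ∀ {y} x U V → y C.≈ x C.+ ⟦ grid U V ⟧ → S y ≈ S x + κ (+ 2) * κ U
      S-plus x U V e = trans (S-cong e) (trans (S-+ x ⟦ grid U V ⟧) (+-congˡ (S-grid U V)))
      T-plus : ∀ {y} x U V → y C.≈ x C.+ ⟦ grid U V ⟧ → T y ≈ T x + κ (+ 2) * κ V
      T-plus x U V e = trans (T-cong e) (trans (T-+ x ⟦ grid U V ⟧) (+-congˡ (T-grid U V)))
      S-minus : ∀ {y} x U V → y C.≈ x C.- ⟦ grid U V ⟧ → S y ≈ S x - κ (+ 2) * κ U
      S-minus x U V e = trans (S-cong e) (trans (S-+ x (C.- ⟦ grid U V ⟧))
          (+-congˡ (trans (S-neg ⟦ grid U V ⟧) (-‿cong (S-grid U V)))))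
      T-minus : ∀ {y} x U V → y C.≈ x C.- ⟦ grid U V ⟧ → T y ≈ T x - κ (+ 2) * κ V
      T-minus x U V e = trans (T-cong e) (trans (T-+ x (C.- ⟦ grid U V ⟧))
          (+-congˡ (trans (T-neg ⟦ grid U V ⟧) (-‿cong (T-grid U V)))))

      private
        inverses : ∀ x y → mulK m n x y ≡ 1K → let u = value x ; v = value y in Inverse (S u) (T u) (S v) (T v)
        inverses x y e = inverse (proj₁ u) (proj₂ u) (proj₁ v) (proj₂ v)
          (trans (solve 4 (λ a b c d → a :* c :- b :* d := a :* c :+ con -[1+ 0 ] :* (b :* d)) (proj₁ u) (proj₂ u)
            (proj₁ v) (proj₂ v)) (proj₁ one))
          (proj₂ one)
          where
          u v : Carrier × Carrier
          u = value x
          v = value y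
          one : u C.* v C.≈ ⟦ (+ 1 , + 0) ⟧
          one = C-trans (C-sym {value (mulK m n x y)} (value-mul x y)) (C-trans (C.reflexive (≡.cong value e)) value-1)

        minus-embed : ∀ x w → x +K embedGI (negGI w) ≡ x -K embedGI w
        minus-embed ((a , a') , (b , b')) (w , w') = ≡.cong₂ _,_
          (≡.cong₂ _,_ (≡.cong (λ z → a ℚ.+ z) (ι-neg w)) (≡.cong (λ z → a' ℚ.+ z) (ι-neg w'))) ≡.refl

        distribute-neg : ∀ c β w → negGI (β +GI (c *GI w)) ≡ negGI β +GI (c *GI negGI w)
        distribute-neg (c , c') (b , b') (w , w') = ≡.cong₂ _,_
          (Z.solve 5 (λ c c' b w w' → Z.:- (b Z.:+ (c Z.:* w Z.:- c' Z.:* w')) Z.:= (Z.:- b) Z.:+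
            (c Z.:* (Z.:- w) Z.:- c' Z.:* (Z.:- w'))) ≡.refl c c' b w w')
          (Z.solve 5 (λ c c' b w w' → Z.:- (b Z.:+ (c Z.:* w' Z.:+ c' Z.:* w)) Z.:= (Z.:- b) Z.:+
            (c Z.:* (Z.:- w') Z.:+ c' Z.:* (Z.:- w))) ≡.refl c c' b' w w')

        point-advance : ∀ c β w → c ≢ 0GI → point c (negGI (β +GI (c *GI w))) ≡ point c (negGI β) -K embedGI w
        point-advance c β w h = ≡.trans (≡.cong (point c) (distribute-neg c β w))
          (≡.trans (point-shift c (negGI β) (negGI w) h) (minus-embed (point c (negGI β)) w))

      module _ (a β c : GI) (G : Good (a , β , c)) where
        open Invariant G using (triple; reduced)
        open Triple triple

        private
          U V : ℤ
          U = proj₁ (quotient β c)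
          V = proj₂ (quotient β c)
          w : GI
          w = partial β c
          z y x' Y' : Carrier × Carrier
          z = value (point c (negGI β))
          y = value (point c β)
          x' = value (point c (negGI (β +GI (c *GI w))))
          Y' = value (point c (negGI (negGI (β +GI (c *GI w)))))

        rounds-S : Rounds U (S z)
        rounds-S = proj₂ (round (S z))

        rounds-T : Rounds V (T z)
        rounds-T = proj₂ (round (T z))

        x-z : mulK m n (point a β) (point c (negGI β)) ≡ 1K
        x-z = point-mul a β c a≢0 c≢0 disc

        Y-y : mulK m n (point a (negGI β)) (point c β) ≡ 1K
        Y-y = ≡.trans (≡.cong (λ b → mulK m n (point a (negGI β)) (point c b)) (≡.sym (negGI-involutive β)))
          (point-mul a (negGI β) c a≢0 c≢0 (≡.trans (≡.cong (_+GI (a *GI c)) (neg-square β)) disc))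
          where
          neg-square : ∀ g → negGI g *GI negGI g ≡ g *GI g
          neg-square (x , y) = ≡.cong₂ _,_
            (Z.solve 2 (λ x y → (Z.:- x) Z.:* (Z.:- x) Z.:- (Z.:- y) Z.:* (Z.:- y) Z.:= x Z.:* x Z.:- y Z.:* y)
              ≡.refl x y)
            (Z.solve 2 (λ x y → (Z.:- x) Z.:* (Z.:- y) Z.:+ (Z.:- y) Z.:* (Z.:- x) Z.:= x Z.:* y Z.:+ y Z.:* x)
              ≡.refl x y)

        private
          module St = Step reduced (inverses (point a β) (point c (negGI β)) x-z) (inverses (point a (negGI β)) (point c β) Y-y) rounds-S rounds-T

          x'-eq : x' C.≈ z C.- ⟦ w ⟧
          x'-eq = C-trans (C.reflexive (≡.cong value (≡.trans (≡.cong (point c) (distribute-neg c β w))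
              (point-shift c (negGI β) (negGI w) c≢0))))
            (C-trans (value-+ (point c (negGI β)) (embedGI (negGI w)))
              (C.+-congˡ {z} (C-trans (value-embed (negGI w)) (⟦⟧-neg w))))

        Y'-eq : Y' C.≈ y C.+ ⟦ w ⟧
        Y'-eq = C-trans (C.reflexive (≡.cong value (≡.trans (≡.cong (point c) (negGI-involutive (β +GI (c *GI w))))
            (point-shift c β w c≢0))))
          (C-trans (value-+ (point c β) (embedGI w)) (C.+-congˡ {y} (value-embed w)))

        dual : Dual U V (S y) (T y)
        dual = St.dual

        next-good : Good (step (a , β , c))
        next-good = good c (negGI (β +GI (c *GI w))) (next-c a β c w)
          (record { a≢0 = c≢0 ; c≢0 = c≢0-from-disc c (negGI (β +GI (c *GI w))) (next-c a β c w) d ; disc = d })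
          (Within-resp (sym (S-minus z U V x'-eq)) (Rounds.within rounds-S))
          (Within-resp (sym (T-minus z U V x'-eq)) (Rounds.within rounds-T))
          (NN-resp (+-congʳ (sq-cong (sym (S-plus y U V Y'-eq)) (sym (T-plus y U V Y'-eq)))) St.next-big)
          (Avoids-resp (sym (S-minus z U V x'-eq)) (sym (T-minus z U V x'-eq)) (sym (S-plus y U V Y'-eq))
            (sym (T-plus y U V Y'-eq)) St.next-avoids)
          where
          d = ≡.trans (next-disc a β c w) disc

        private
          -- The coefficient of √D in a point is `ginv` of its denominator. Being nonzero, it shows
          -- that the point is neither 0 nor a Gaussian integer, so the expansion never stops and
          -- the floor is always given by the sets Q_w.
          ginv≢0 : ∀ b → b ≢ 0GI → ginv b ≢ 0G
          ginv≢0 b h e = contradict (PP-resp (sym κ-1) PP-1) (begin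
            κ (+ 1)                                ≈⟨ trans κ-1 (sym (proj₁ (reciprocal b h))) ⟩
            proj₁ (⟦ b ⟧ C.* gaussian (ginv b))    ≈⟨ proj₁
                (C.*-congˡ {⟦ b ⟧} {gaussian (ginv b)} {C.0#} (C-trans (C.reflexive (≡.cong gaussian e)) (φ-0 , φ-0))) ⟩
            proj₁ (⟦ b ⟧ C.* C.0#)                 ≈⟨ proj₁ (C.zeroʳ ⟦ b ⟧) ⟩
            0#                                     ≈⟨ κ-0 ⟨
            κ (+ 0) ∎)

        hurwitz-step : HStep σ (point a β) (point c (negGI (β +GI (c *GI w))))
        hurwitz-step = (λ e → ginv≢0 a a≢0 (≡.cong proj₂ e)) , point c (negGI β) , w , x-z
          , inj₂ ((λ (g , e) → ginv≢0 c c≢0 (≡.cong proj₂ e))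
                 , InQ-complete (toCL σ (point c (negGI β))) U V
                     (Rounds-resp (sym (+-cong (proj₁ v) (proj₂ v))) rounds-S)
                     (Rounds-resp (sym (+-cong (proj₁ v) (-‿cong (proj₂ v)))) rounds-T))
          , point-advance c β w c≢0
          where
          v = value-ev (point c (negGI β))

      private
        conjugate : GI × GI × GI → Carrier × Carrier
        conjugate s = value (point (proj₁ s) (negGI (proj₁ (proj₂ s))))

        -- The next triple determines the next Y, which is y + w. Both decompositions satisfy
        -- `Dual`, so `dual-unique` recovers w.
        same-partial : ∀ a β c a' β' c' → Good (a , β , c) → Good (a' , β' , c') →
                       conjugate (step (a , β , c)) C.≈ conjugate (step (a' , β' , c')) → partial β c ≡ partial β' c'
        same-partial a β c a' β' c' G G' e =
          let U , V = quotient β c ; U' , V' = quotient β' c'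
              p , q = dual-unique (dual a β c G) (dual a' β' c' G')
                (trans (sym (S-plus (value (point c β)) U V (Y'-eq a β c G)))
                  (trans (S-cong e) (S-plus (value (point c' β')) U' V' (Y'-eq a' β' c' G'))))
                (trans (sym (T-plus (value (point c β)) U V (Y'-eq a β c G)))
                  (trans (T-cong e) (T-plus (value (point c' β')) U' V' (Y'-eq a' β' c' G'))))
          in ≡.cong₂ grid p q

      step-injective : ∀ s s' → Good s → Good s' → step s ≡ step s' → s ≡ s'
      step-injective (a , β , c) (a' , β' , c') G G' e = advance-injective a β c (partial β c) a' β' c' (partial β' c')
        (same-partial a β c a' β' c' G G' (C.reflexive (≡.cong conjugate e))) e

      private
        1GI : GI
        1GI = + 1 , + 0

        1≢0 : 1GI ≢ 0GI
        1≢0 ()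

        value-monic : ∀ β → value (point 1GI β) C.≈ ⟦ β ⟧ C.+ root
        value-monic β = C-trans (C.sym {⟦ 1GI ⟧ C.* value (point 1GI β)} (C-trans
            (C.*-congʳ {value (point 1GI β)} {⟦ 1GI ⟧} {C.1#} (κ-1 , κ-0)) (C.*-identityˡ (value (point 1GI β)))))
          (value-numerator 1GI β 1≢0)

        initial : GI → GI × GI × GI
        initial w = 1GI , negGI w , D -GI (w *GI w)

        start-point : ∀ w → point 1GI (negGI w) ≡ sqrtK -K embedGI w
        start-point w = ≡.trans (≡.cong₂ (λ u v → u G.* v , v) (ιG-neg w) ginv-1)
            (≡.cong₂ _,_ (≡.trans (≋⇒≡ (G.*-identityʳ (G.- ιG w))) (≋⇒≡ (G.sym (G.+-identityˡ (G.- ιG w))))) ≡.refl)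
          where
          ginv-1 : ginv 1GI ≡ 1G
          ginv-1 = ≡.trans (≡.sym (≋⇒≡ (G.*-identityˡ (ginv 1GI)))) (ginv-inverse 1GI 1≢0)

        root-large : NN (sq (S root) (T root) - κ (+ 2))
        root-large = NN-resp (trans (solve 1 (λ r → con (+ 2) :* (r :- con (+ 1)) := con (+ 2) :* r :- con (+ 2)) r)
          (+-congʳ (trans (*-congˡ (sym P²+Q²)) (sym (sq-ST root))))) (NN-* (NN-κ 2) r≥1)

        start-triple : ∀ w → Triple 1GI (negGI w) (D -GI (w *GI w))
        start-triple w = record { a≢0 = 1≢0 ; c≢0 = c≢0-from-disc 1GI (negGI w) (D -GI (w *GI w)) (start-disc w D) ;
            disc = start-disc w D }

        start-good : ∀ U V → Remainder (toCL σ sqrtK) U V → Good (initial (grid U V))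
        start-good U V (wS , wT) = good 1GI (negGI w) (D -GI (w *GI w)) (start-triple w) within-S within-T
            (NN-resp (+-congʳ (sq-cong (sym S-Y) (sym T-Y))) (start-big st))
            (Avoids-resp refl refl (sym S-Y) (sym T-Y) (start-avoids st))
          where
          w : GI
          w = grid U V
          x Y : Carrier × Carrier
          x = value (point 1GI (negGI w))
          Y = value (point 1GI (negGI (negGI w)))
          ev-root : ev (proj₁ (toCL σ sqrtK)) ≈ P × ev (proj₂ (toCL σ sqrtK)) ≈ Q
          ev-root = trans (proj₁ (value-ev sqrtK)) (proj₁ value-sqrt) , trans (proj₂ (value-ev sqrtK))
              (proj₂ value-sqrt)
          rS : Within (S root - κ (+ 2) * κ U)
          rS = Within-resp (+-congʳ (+-cong (proj₁ ev-root) (proj₂ ev-root))) wS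
          rT : Within (T root - κ (+ 2) * κ V)
          rT = Within-resp (+-congʳ (+-cong (proj₁ ev-root) (-‿cong (proj₂ ev-root)))) wT
          x-eq : x C.≈ root C.- ⟦ w ⟧
          x-eq = C-trans (value-monic (negGI w)) (C-trans (C.+-congʳ {root} {⟦ negGI w ⟧} (⟦⟧-neg w))
              (C.+-comm (C.- ⟦ w ⟧) root))
          Y-eq : Y C.≈ root C.+ ⟦ w ⟧
          Y-eq = C-trans (C.reflexive (≡.cong (λ b → value (point 1GI b)) (negGI-involutive w)))
              (C-trans (value-monic w) (C.+-comm ⟦ w ⟧ root))
          S-Y : S Y ≈ S root + κ (+ 2) * κ U
          S-Y = S-plus root U V Y-eq
          T-Y : T Y ≈ T root + κ (+ 2) * κ V
          T-Y = T-plus root U V Y-eq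
          S-x : S x ≈ S root - κ (+ 2) * κ U
          S-x = S-minus root U V x-eq
          T-x : T x ≈ T root - κ (+ 2) * κ V
          T-x = T-minus root U V x-eq
          within-S : Within (S x)
          within-S = Within-resp (sym S-x) rS
          within-T : Within (T x)
          within-T = Within-resp (sym T-x) rT
          st : Start U V (S root) (T root)
          -- For w = 0 the point x would be √D, but |x| < 1 while |√D| ≥ 1.
          st = record { within-s = rS ; within-t = rT ; large = root-large ; nonzero = λ (p , q) →
            PP⇒¬NN (small (start-triple w) within-S within-T)
                (NN-resp (+-congʳ (sq-cong (sym (at-0 p S-x)) (sym (at-0 q T-x)))) root-large) }
            where
            at-0 : ∀ {W s d} → W ≡ + 0 → s ≈ d - κ (+ 2) * κ W → s ≈ d
            at-0 {d = d} ≡.refl e = trans e (solve 1 (λ d → d :- con (+ 2) :* con (+ 0) := d) d)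

      -- Finiteness of the orbit and the periodic expansion

      module _ (w₀ : GI) (good₀ : Good (initial w₀)) where
        private
          orbit : ℕ → GI × GI × GI
          orbit zero = initial w₀
          orbit (suc k) = step (orbit k)

          orbit-good : ∀ k → Good (orbit k)
          orbit-good zero = good₀
          orbit-good (suc k) = next-good (proj₁ (orbit k)) (proj₁ (proj₂ (orbit k))) (proj₂ (proj₂ (orbit k)))
              (orbit-good k)

          B : ℕ
          B = ℤ.∣ + 25600 ℤ.* normGI D ∣

          d : ℕ
          d = ℤ.∣ m ∣ ℕ.+ ℤ.∣ n ∣

          -- A bound for the coordinates of β² = D - a c, where d accounts for D and B for a and c.
          -- Then 2E² bounds β by `sqrt-bounded`, and M dominates the bounds of all three entries.
          E : ℕ
          E = d ℕ.+ (B ℕ.* B ℕ.+ B ℕ.* B)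

          M : ℕ
          M = B ℕ.+ (E ℕ.* E ℕ.+ E ℕ.* E)

          first-bounded : ∀ s → Good s → Bounded B (proj₁ s)
          first-bounded (a , β , c) G = norm-bounded a B (ℤP.≤-trans
              (coefficient-bound triple within-s within-t (PP⇒NN big)) (i≤∣i∣ (+ 25600 ℤ.* normGI D)))
            where
            open Invariant G
            open Reduced reduced
            i≤∣i∣ : ∀ i → i ℤ.≤ + ℤ.∣ i ∣
            i≤∣i∣ (+ k) = ℤP.≤-refl
            i≤∣i∣ -[1+ k ] = ℤ.-≤+

          second-bounded : ∀ s → Good s → Bounded B (proj₁ s) → Bounded B (proj₂ (proj₂ s)) → Bounded
              (E ℕ.* E ℕ.+ E ℕ.* E) (proj₁ (proj₂ s))
          second-bounded (a , β , c) G ha hc = sqrt-bounded β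
              (≡.subst (Bounded E) (≡.sym β²) (-GI-bounded {d} {B ℕ.* B ℕ.+ B ℕ.* B} {D} {a *GI c}
              (ℕP.m≤m+n ℤ.∣ m ∣ ℤ.∣ n ∣ , ℕP.m≤n+m ℤ.∣ n ∣ ℤ.∣ m ∣) (*GI-bounded {B} {B} {a} {c} ha hc)))
            where
            β² : β *GI β ≡ D -GI (a *GI c)
            β² = +GI-cancelʳ (β *GI β) (D -GI (a *GI c)) (a *GI c)
                (≡.trans (Triple.disc (Invariant.triple G)) (≡.sym (minus-plus D (a *GI c))))
              where
              minus-plus : ∀ g h → (g -GI h) +GI h ≡ g
              minus-plus (x , y) (x' , y') = ≡.cong₂ _,_ (cancel x x') (cancel y y')
                where
                cancel : ∀ x y → x ℤ.- y ℤ.+ y ≡ x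
                cancel x y = ≡.trans (ℤP.+-assoc x (ℤ.- y) y)
                    (≡.trans (≡.cong (λ z → x ℤ.+ z) (ℤP.+-inverseˡ y)) (ℤP.+-identityʳ x))

          Bounded³ : GI × GI × GI → Set
          Bounded³ (a , β , c) = Bounded M a × Bounded M β × Bounded M c

          widen : ∀ {A A'} g → A ℕ.≤ A' → Bounded A g → Bounded A' g
          widen g h (p , q) = ℕP.≤-trans p h , ℕP.≤-trans q h

          -- The entry c is the leading coefficient of the next triple, so the bound for a, applied
          -- one step later, bounds c as well.
          bounded : ∀ s → Good s → Good (step s) → Bounded³ s
          bounded s@(a , β , c) G G' =
            let ha = first-bounded s G ; hc = first-bounded (step s) G' in
              widen a (ℕP.m≤m+n B _) ha , widen β (ℕP.m≤n+m _ B) (second-bounded s G ha hc) , widen c (ℕP.m≤m+n B _) hc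

          L : ℕ
          L = 2 ℕ.* suc M ℕ.* (2 ℕ.* suc M)

          code : ∀ s → Bounded³ s → Fin (L ℕ.* (L ℕ.* L))
          code (a , β , c) (p , q , r) = Fin.combine {L} (codeGI M a p)
              (Fin.combine {L} {L} (codeGI M β q) (codeGI M c r))

          code-injective : ∀ s s' p p' → code s p ≡ code s' p' → s ≡ s'
          code-injective (a , β , c) (a' , β' , c') (p , q , r) (p' , q' , r') e =
            let e₁ , e₂ = FP.combine-injective {L} (codeGI M a p) (Fin.combine {L} {L} (codeGI M β q) (codeGI M c r)) (codeGI M a' p') (Fin.combine {L} {L} (codeGI M β' q') (codeGI M c' r')) e
                e₃ , e₄ = FP.combine-injective {L} {L} (codeGI M β q) (codeGI M c r) (codeGI M β' q')
                    (codeGI M c' r') e₂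
            in ≡.cong₂ _,_ (codeGI-injective M a a' p p' e₁) (≡.cong₂ _,_ (codeGI-injective M β β' q q' e₃) (codeGI-injective M c c' r r' e₄))

          orbit-bounded : ∀ k → Bounded³ (orbit k)
          orbit-bounded k = bounded (orbit k) (orbit-good k) (orbit-good (suc k))

          number : GI × GI × GI → K
          number (a , β , c) = point a β

          hstep : ∀ s → Good s → Reals.HStep m n σ (number s) (number (step s))
          hstep (a , β , c) G = hurwitz-step a β c G

          periodic : ∃ λ l → 1 ℕ.≤ l × (∀ k → orbit (k ℕ.+ l) ≡ orbit k)
          periodic = purely-periodic step orbit (λ _ → ≡.refl)
            (λ i j → step-injective (orbit i) (orbit j) (orbit-good i) (orbit-good j))
            (λ k → code (orbit k) (orbit-bounded k))
            (λ i j → code-injective (orbit i) (orbit j) (orbit-bounded i) (orbit-bounded j))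

        periodic-expansion : PurelyPeriodic σ (sqrtK -K embedGI w₀)
        periodic-expansion = (λ k → number (orbit k)) , start-point w₀ , (λ k → hstep (orbit k) (orbit-good k))
          , proj₁ periodic , proj₁ (proj₂ periodic) , (λ k → ≡.cong number (proj₂ (proj₂ periodic) k))

      expansion : ∀ w₀ → FloorH σ sqrtK w₀ → PurelyPeriodic σ (sqrtK -K embedGI w₀)
      -- The coefficient of √D in `sqrtK` is 1, so √D is not a Gaussian integer.
      expansion w₀ (inj₁ e) = ⊥-elim (ℚP.1≢0 (≡.cong (λ k → proj₁ (proj₂ k)) e))
      expansion w₀ (inj₂ (_ , inQ)) = let U , V , e , R = InQ-sound (toCL σ sqrtK) w₀ inQ in
        periodic-expansion w₀ (≡.subst (λ w → Good (initial w)) (≡.sym e) (start-good U V R))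

theorem6p4 : (m n : ℤ) (σ : Bool) → ¬ HasSqrtInQi m n →
    (w₀ : GI) → Reals.FloorH m n σ sqrtK w₀ →
    Reals.PurelyPeriodic m n σ (sqrtK -K embedGI w₀)
theorem6p4 m n σ noRoot w₀ = Hurwitz.expansion m n (sqrtModel m n) σ noRoot w₀
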